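{- Let $q>2$ be a prime power, $n\ge 3$, and let $(\Omega,\{R_0,\dots,R_4\})$ be the association scheme on the points of $\mathsf{Q}^-(2n-1,q)$ outside a nondegenerate hyperplane, with simultaneous eigenspaces $V_0,\dots,V_4$ ordered as in the context. Let $\theta\subseteq\Omega$ be nontrivial ($\emptyset\ne\theta\ne\Omega$). If $\chi_\theta\in V_0\perp V_1$ (intriguing set of type 1), or $\chi_\theta\in V_0\perp V_3$ (intriguing set of type 3), or $\chi_\theta\in V_0\perp V_1\perp V_3$ (a $\{2,4\}$-design), then $|\theta|=\tfrac12|\Omega|$. Moreover, if $n=3$ and $\chi_\theta\in V_0\perp V_1\perp V_4$ (a $\{2,3\}$-design), then either $\chi_\theta\in V_0\perp V_4$ (i.e. $\theta$ is a $\{1,2,3\}$-design) or $|\theta|=\tfrac12|\Omega|$.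
   Context: Let $\Omega$ be the set of points of $\mathsf{Q}^-(2n-1,q)$ not in a fixed hyperplane $\Pi$ with nondegenerate section. With $\perp$ the polarity of the quadric, for $P\in\Omega$ the line through $P$ and the pole $\Pi^\perp$ meets the quadric in exactly two points, and $P^\sigma$ denotes the one other than $P$. Write $X\sim Y$ if $X\ne Y$ and $X,Y$ are collinear on the quadric. Relations: $R_0$ identity; $R_1=\{(X,Y):Y\not\sim X,\ X\sim Y^\sigma\}$; $R_2=\{(X,Y):Y\not\sim X,\ X\not\sim Y^\sigma\}$; $R_3=\{(X,Y):Y\sim X,\ X\not\sim Y^\sigma\}$; $R_4=\{(X,Y):X=Y^\sigma\}$. This is an association scheme whose minimal idempotents $E_0=\frac1{|\Omega|}J,E_1,\dots,E_4$ are ordered so that the eigenvalue of the adjacency matrix of $R_\ell$ on $V_i$ (the column space of $E_i$) is the $(i,\ell)$ entry of \[ \begin{bmatrix} 1 & ( q^{n-2}-1)(q^{n-1}+1) & q^{n-2} ( q-2) (q^{n-1}+1) & ( q^{n-2}-1)(q^{n-1}+1) & 1\\ 1 & {q}^{n-1}+1 & 0 & -( {q}^{n-1}+1) & -1\\ 1 & q^{n-2}-1 & -2q^{n-2} & q^{n-2}-1 & 1\\ 1 & -( q^{n-2}-1) & 0 & q^{n-2}-1 & -1\\ 1 &-q^{n - 2}(q - 2)-1& 2q^{n-2}( q-2) & -q^{n - 2}(q - 2)-1& 1 \end{bmatrix}. \] For $T\subseteq\{1,\dots,4\}$, a (Delsarte) $T$-design is a subset $\theta$ with $\chi_\theta E_i=0$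 for all $i\in T$; $\chi_\theta$ is the characteristic vector. -}

module Defs where

open import Data.Bool using (Bool; true; false; _∧_; not; if_then_else_)
open import Data.Nat as ℕ using (ℕ; suc; _∸_)
open import Data.Integer as ℤ using (ℤ; +_)
open import Data.Rational as ℚ using (ℚ; 0ℚ; 1ℚ; _/_)
open import Data.Fin using (Fin; zero; suc)
open import Data.Product using (_×_; _,_; Σ-syntax)
open import Data.Product.Properties using () renaming (≡-dec to ×-≡-dec)
open import Data.List using (List; []; _∷_; length; filter; map; concatMap; foldr)
open import Data.Bool.ListAction using (any)
open import Data.List.Membership.Propositional using (_∈_)
open import Data.List.Relation.Unary.Unique.Propositional using (Unique)
open import Data.Vec using (Vec; []; _∷_; zipWith)
open import Data.Vec.Properties using () renaming (≡-dec to vec-≡-dec)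
open import Relation.Nullary using (does)
open import Relation.Binary.PropositionalEquality using (_≡_; _≢_)
open import Relation.Binary.Definitions using (DecidableEquality)
open import Algebra.Structures using (IsCommutativeRing)

-- A finite field (with propositional equality), given together with an
-- exhaustive duplicate-free enumeration of its elements.  Its order is
-- q = length elems.  (Finite fields exist exactly for prime powers q.)

record FiniteField : Set₁ where
  infixl 6 _+_
  infixl 7 _*_
  field
    F                 : Set
    _+_ _*_           : F → F → F
    -_                : F → F
    0# 1#             : F
    _⁻¹               : F → F
    isCommutativeRing : IsCommutativeRing _≡_ _+_ _*_ -_ 0# 1#
    0≢1               : 0# ≢ 1#
    ⁻¹-inverse        : ∀ x → x ≢ 0# → x * (x ⁻¹) ≡ 1#
    _≟_               : DecidableEquality F
    elems             : List F
    elems-complete    : ∀ x → x ∈ elems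
    elems-unique      : Unique elems

  order : ℕ
  order = length elems

-- Vectors of F^{2n}.  A vector is written as (n-1) coordinate pairs
-- (x_{2i-1}, x_{2i}) followed by a final pair (x_{2n-1}, x_{2n}).

module _ (K : FiniteField) where
  open FiniteField K

  Pt : ℕ → Set
  Pt n = Vec (F × F) (n ∸ 1) × (F × F)

  Anisotropic : F → F → Set
  Anisotropic a b = ∀ u w → a * u * u + u * w + b * w * w ≡ 0# → (u ≡ 0#) × (w ≡ 0#)

  _==_ : F → F → Bool
  x == y = does (x ≟ y)


  private
    pairs : List (F × F)
    pairs = concatMap (λ x → map (λ y → (x , y)) elems) elems

    vecs : (k : ℕ) → List (Vec (F × F) k)
    vecs ℕ.zero = [] ∷ []
    vecs (suc k) = concatMap (λ c → map (c ∷_) (vecs k)) pairs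

  allPts : (n : ℕ) → List (Pt n)
  allPts n = concatMap (λ v → map (v ,_) pairs) (vecs (n ∸ 1))

  -- The scheme.  Π = p^⊥ is the hyperplane whose pole is ⟨p⟩, Q(p) ≠ 0.
  -- A point of Ω (a singular projective point not in Π) is represented by
  -- its unique representative x with Q(x) = 0 and B(x,p) = 1.

  module Scheme (n : ℕ) (a b : F) (p : Pt n) where

    hyp : ∀ {k} → Vec (F × F) k → F
    hyp [] = 0#
    hyp ((x , y) ∷ v) = x * y + hyp v

    -- the elliptic quadratic form on F^{2n}
    -- the elliptic quadratic form
    -- Q(x) = Σ_{i<n} x_{2i-1} x_{2i} + a x_{2n-1}^2 + x_{2n-1} x_{2n} + b x_{2n}^2
    -- which is nondegenerate of Witt index n-1 when
    -- a X^2 + X Y + b Y^2 is anisotropic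
    --; its zero set is Q^-(2n-1,q).
    Qf : F → F → Pt n → F
    Qf a b (v , (u , w)) = hyp v + (a * u * u + u * w + b * w * w)

    infixl 6 _⊕_
    _⊕_ : Pt n → Pt n → Pt n
    (v , (u , w)) ⊕ (v' , (u' , w')) =
      zipWith (λ { (x , y) (x' , y') → (x + x' , y + y') }) v v' , (u + u' , w + w')

    infixr 7 _·_
    _·_ : F → Pt n → Pt n
    s · (v , (u , w)) = Data.Vec.map (λ { (x , y) → (s * x , s * y) }) v , (s * u , s * w)

    Bf : F → F → Pt n → Pt n → F
    Bf a b x y = Qf a b (x ⊕ y) + - (Qf a b x) + - (Qf a b y)

    _≟P_ : DecidableEquality (Pt n)
    _≟P_ = ×-≡-dec (vec-≡-dec (×-≡-dec _≟_ _≟_)) (×-≡-dec _≟_ _≟_)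

    _==P_ : Pt n → Pt n → Bool
    x ==P y = does (x ≟P y)

    Q : Pt n → F
    Q = Qf a b

    B : Pt n → Pt n → F
    B = Bf a b

    inΩ : Pt n → Bool
    inΩ x = (Q x == 0#) ∧ (B x p == 1#)

    Ω : List (Pt n)
    Ω = filter (λ x → inΩ x ≡? true) (allPts n)
      where
        _≡?_ : (u v : Bool) → Relation.Nullary.Dec (u ≡ v)
        _≡?_ = Data.Bool._≟_

    -- X ~ Y : X ≠ Y and X, Y collinear on the quadric (X ⊥ Y)
    col : Pt n → Pt n → Bool
    col x y = not (x ==P y) ∧ (B x y == 0#)

    -- Z = Y^σ : Z ∈ Ω, Z ≠ Y, and Z lies on the line through Y and the pole
    sig : Pt n → Pt n → Bool
    sig y z = inΩ z ∧ not (z ==P y)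
              ∧ any (λ r → any (λ s → z ==P (r · y ⊕ s · p)) elems) elems

    colσ : Pt n → Pt n → Bool
    colσ x y = any (λ z → sig y z ∧ col x z) (allPts n)

    -- the relations R_0 .. R_4  (rel ℓ X Y  ⇔  (X,Y) ∈ R_ℓ);
    -- R_2 is the complement of the other four (the condition Y ≠ X and
    -- X ≠ Y^σ is implicit in the paper, as the R_ℓ partition Ω × Ω).
    rel : Fin 5 → Pt n → Pt n → Bool
    rel zero x y = x ==P y
    rel (suc zero) x y = not (col y x) ∧ colσ x y
    rel (suc (suc zero)) x y =
      not (x ==P y) ∧ not (sig y x) ∧ not (col y x) ∧ not (colσ x y)
    rel (suc (suc (suc zero))) x y = col y x ∧ not (colσ x y)
    rel (suc (suc (suc (suc zero)))) x y = sig y x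

    -- real (rational) vectors indexed by Ω are functions Pt n → ℚ whose
    -- values off Ω are ignored.
    sumΩ : (Pt n → ℚ) → ℚ
    sumΩ f = foldr (λ x acc → f x ℚ.+ acc) 0ℚ Ω

    mulA : Fin 5 → (Pt n → ℚ) → Pt n → ℚ
    mulA ℓ v y = sumΩ (λ x → if rel ℓ x y then v x else 0ℚ)

    qn2 qn1 : ℤ
    qn2 = + (order ℕ.^ (n ∸ 2))
    qn1 = + (order ℕ.^ (n ∸ 1))
    qm2 : ℤ
    qm2 = + order ℤ.- + 2

    Pℤ : Fin 5 → Fin 5 → ℤ
    Pℤ zero zero = + 1
    Pℤ zero (suc zero) = (qn2 ℤ.- + 1) ℤ.* (qn1 ℤ.+ + 1)
    Pℤ zero (suc (suc zero)) = qn2 ℤ.* qm2 ℤ.* (qn1 ℤ.+ + 1)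
    Pℤ zero (suc (suc (suc zero))) = (qn2 ℤ.- + 1) ℤ.* (qn1 ℤ.+ + 1)
    Pℤ zero (suc (suc (suc (suc zero)))) = + 1
    Pℤ (suc zero) zero = + 1
    Pℤ (suc zero) (suc zero) = qn1 ℤ.+ + 1
    Pℤ (suc zero) (suc (suc zero)) = + 0
    Pℤ (suc zero) (suc (suc (suc zero))) = ℤ.- (qn1 ℤ.+ + 1)
    Pℤ (suc zero) (suc (suc (suc (suc zero)))) = ℤ.- + 1
    Pℤ (suc (suc zero)) zero = + 1
    Pℤ (suc (suc zero)) (suc zero) = qn2 ℤ.- + 1
    Pℤ (suc (suc zero)) (suc (suc zero)) = ℤ.- (+ 2 ℤ.* qn2)
    Pℤ (suc (suc zero)) (suc (suc (suc zero))) = qn2 ℤ.- + 1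
    Pℤ (suc (suc zero)) (suc (suc (suc (suc zero)))) = + 1
    Pℤ (suc (suc (suc zero))) zero = + 1
    Pℤ (suc (suc (suc zero))) (suc zero) = ℤ.- (qn2 ℤ.- + 1)
    Pℤ (suc (suc (suc zero))) (suc (suc zero)) = + 0
    Pℤ (suc (suc (suc zero))) (suc (suc (suc zero))) = qn2 ℤ.- + 1
    Pℤ (suc (suc (suc zero))) (suc (suc (suc (suc zero)))) = ℤ.- + 1
    Pℤ (suc (suc (suc (suc zero)))) zero = + 1
    Pℤ (suc (suc (suc (suc zero)))) (suc zero) = ℤ.- (qn2 ℤ.* qm2) ℤ.- + 1
    Pℤ (suc (suc (suc (suc zero)))) (suc (suc zero)) = + 2 ℤ.* qn2 ℤ.* qm2
    Pℤ (suc (suc (suc (suc zero)))) (suc (suc (suc zero))) = ℤ.- (qn2 ℤ.* qm2) ℤ.- + 1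
    Pℤ (suc (suc (suc (suc zero)))) (suc (suc (suc (suc zero)))) = + 1

    Pmat : Fin 5 → Fin 5 → ℚ
    Pmat i ℓ = Pℤ i ℓ / 1

    InV : Fin 5 → (Pt n → ℚ) → Set
    InV i v = ∀ ℓ y → inΩ y ≡ true → mulA ℓ v y ≡ Pmat i ℓ ℚ.* v y

    InV2 : Fin 5 → Fin 5 → (Pt n → ℚ) → Set
    InV2 i j w = Σ[ u ∈ (Pt n → ℚ) ] Σ[ v ∈ (Pt n → ℚ) ]
      InV i u × InV j v × (∀ x → inΩ x ≡ true → w x ≡ u x ℚ.+ v x)

    InV3 : Fin 5 → Fin 5 → Fin 5 → (Pt n → ℚ) → Set
    InV3 i j k w = Σ[ u ∈ (Pt n → ℚ) ] Σ[ v ∈ (Pt n → ℚ) ] Σ[ t ∈ (Pt n → ℚ) ]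
      InV i u × InV j v × InV k t × (∀ x → inΩ x ≡ true → w x ≡ u x ℚ.+ v x ℚ.+ t x)

    -- subsets θ ⊆ Ω are given by Boolean predicates (values off Ω ignored)
    χ : (Pt n → Bool) → Pt n → ℚ
    χ θ x = if θ x then 1ℚ else 0ℚ

    card : (Pt n → Bool) → ℕ
    card θ = length (filter (λ x → θ x Data.Bool.≟ true) Ω)

    Nontrivial : (Pt n → Bool) → Set
    Nontrivial θ = (Σ[ x ∈ Pt n ] (inΩ x ≡ true × θ x ≡ true))
                 × (Σ[ x ∈ Pt n ] (inΩ x ≡ true × θ x ≡ false))

    cardΩ : ℕ
    cardΩ = length Ω

{-# OPTIONS --safe #-}

-- For y ∈ Ω the point y^σ is −y + p/Q(p), and the five relations partition Ω × Ω.
-- Hence A₀ + ⋯ + A₄ = J, so V₀ consists of the constants and the vectors of V₁, V₃, V₄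
-- have sum 0; if χ = c + ⋯, then |θ| = c |Ω|.
--
-- On V₁ and V₃ the involution σ acts as −1, so in the first three cases
-- χ(y) + χ(y^σ) = 2c, and nontriviality forces 2c = 1.
--
-- For n = 3 write χ = c + v + t with v ∈ V₁, t ∈ V₄.  As χ is 0-1 valued, comparing y
-- with y^σ gives v (2c + 2t − 1) = 0.  The Krein parameter q₁₁⁴ vanishes, which yields
-- ∑ v² t = 0 and therefore (1 − 2c) ∑ v² = 0.  Concretely, let
-- M = (q − 1)(A₀ − A₄) + A₁ − A₃.  Its rows sum to 0 on every line of the generalized
-- quadrangle, so M² = 2(q² + q) M; moreover Mv = 2(q² + q) v and (M ∘ M) t = 0.

module Submission where

open import Defs
open import Level using (0ℓ)
open import Algebra.Bundles using (CommutativeRing)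
open import Algebra.Structures using (IsCommutativeRing)
import Algebra.Properties.Ring
import Algebra.Properties.Semiring.Mult.TCOptimised
import Algebra.Solver.Ring
open import Algebra.Solver.Ring.AlmostCommutativeRing using (fromCommutativeRing; _-Raw-AlmostCommutative⟶_)
open import Data.Bool using (Bool; true; false; if_then_else_; _∧_; not)
open import Data.Bool.ListAction using (any)
open import Data.Empty using (⊥; ⊥-elim)
open import Data.Fin using (Fin; zero; suc)
open import Data.Fin.Patterns using (0F; 1F; 2F; 3F; 4F)
open import Data.Integer as ℤ using (ℤ; -[1+_]; _⊖_)
import Data.Integer.Properties as ℤₚ
open import Data.List using (List; []; _∷_; length; filter; map; foldr; concatMap; cartesianProductWith)
open import Data.List.Membership.Propositional using (_∈_)
open import Data.List.Membership.Propositional.Properties using (∈-filter⁻; ∈-filter⁺; ∈-cartesianProductWith⁺)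
open import Data.List.Relation.Unary.All as All using (All; []; _∷_)
open import Data.List.Relation.Unary.AllPairs using ([]; _∷_)
open import Data.List.Relation.Unary.Any using (here; there)
open import Data.List.Relation.Unary.Unique.Propositional using (Unique)
open import Data.List.Relation.Unary.Unique.Propositional.Properties using (cartesianProductWith⁺; filter⁺)
open import Data.Maybe using (Maybe; just; nothing)
open import Data.Nat as ℕ using (ℕ; zero; suc; _∸_)
import Data.Nat.Properties as ℕₚ
open import Data.Product using (_×_; _,_; proj₁; proj₂; ∃-syntax)
open import Data.Rational as ℚ using (ℚ; 0ℚ; 1ℚ; _/_)
import Data.Rational.Properties as ℚₚ
import Data.Rational.Unnormalised as ℚᵘ
import Data.Rational.Unnormalised.Properties as ℚᵘₚ
open import Data.Sum using (_⊎_; inj₁; inj₂; [_,_]′; reduce)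
open import Data.Unit using (⊤; tt)
open import Data.Vec as Vec using (Vec; []; _∷_; zipWith; replicate; lookup)
open import Data.Vec.Properties using (lookup-zipWith; lookup-map)
import Data.Vec.Relation.Binary.Pointwise.Extensional as Ext
open import Relation.Binary.Definitions using (DecidableEquality)
open import Relation.Binary.PropositionalEquality using (_≡_; _≢_; refl; sym; trans; cong; cong₂; subst; module ≡-Reasoning)
open import Relation.Nullary using (Dec; yes; no; does; ¬_)
open import Relation.Nullary.Decidable using (dec-true; dec-false)

-- Coefficients are taken in ℤ because equality of ring elements does not compute.

-- The predicate `InV i` consists of eigenvalue equations alone: orthogonality and completeness of
-- the eigenspaces are not among the data, nor is any valency. This shapes the proof in two ways.
-- Valencies are read off from a nonzero constant vector of V₀ (`valency`), not counted. And
-- although M is 2(q² + q) E₁, the relation M² = 2(q² + q) M has to be derived from line sums, which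
-- rest on the absence of totally singular planes. For general n the corresponding multiple of E₁ is
-- (qⁿ⁻² - 1)(A₀ - A₄) + A₁ - A₃. Its entrywise square acts on V₄ as 2(q²ⁿ⁻⁴ - qⁿ⁻¹), which is zero
-- exactly when 2n - 4 = n - 1. This is where n = 3 enters the last case.

module IntegerSolver {A : Set} {_+_ _*_ : A → A → A} { -_ : A → A} {0# 1# : A}
  (isCR : IsCommutativeRing _≡_ _+_ _*_ -_ 0# 1#) where

  private
    R : CommutativeRing 0ℓ 0ℓ
    R = record { isCommutativeRing = isCR }

    open IsCommutativeRing isCR using (+-identityˡ; +-identityʳ; +-assoc; +-comm; -‿inverseʳ)
    open Algebra.Properties.Ring (CommutativeRing.ring R) using (-‿distribˡ-*; -‿distribʳ-*; -‿involutive; -‿+-comm; -0#≈0#)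
    -- The optimised multiple has `1 ×′ 1#` equal to `1#` by computation, so that `con ℤ.1ℤ` denotes
    -- `1#` itself in every solver goal.
    open Algebra.Properties.Semiring.Mult.TCOptimised (CommutativeRing.semiring R) using (×-homo-+; ×1-homo-*; 1+×) renaming (_×_ to _×′_)

    fromℤ : ℤ → A
    fromℤ (ℤ.+ n)    = n ×′ 1#
    fromℤ -[1+ n ] = - (suc n ×′ 1#)

    fromℤ-neg : ∀ i → fromℤ (ℤ.- i) ≡ - fromℤ i
    fromℤ-neg (ℤ.+ zero)  = sym -0#≈0#
    fromℤ-neg (ℤ.+ suc n) = refl
    fromℤ-neg -[1+ n ]  = sym (-‿involutive _)

    fromℤ-⊖ : ∀ m n → fromℤ (m ⊖ n) ≡ (m ×′ 1#) + (- (n ×′ 1#))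
    fromℤ-⊖ m       zero    = sym (trans (cong ((m ×′ 1#) +_) -0#≈0#) (+-identityʳ _))
    fromℤ-⊖ zero    (suc n) = sym (+-identityˡ _)
    fromℤ-⊖ (suc m) (suc n) = begin
      fromℤ (suc m ⊖ suc n)                        ≡⟨ cong fromℤ (ℤₚ.[1+m]⊖[1+n]≡m⊖n m n) ⟩
      fromℤ (m ⊖ n)                                ≡⟨ fromℤ-⊖ m n ⟩
      x + (- y)                                    ≡⟨ sym (+-identityˡ _) ⟩
      0# + (x + (- y))                             ≡⟨ cong (_+ (x + (- y))) (sym (-‿inverseʳ 1#)) ⟩
      (1# + (- 1#)) + (x + (- y))                  ≡⟨ interchange 1# (- 1#) x (- y) ⟩
      (1# + x) + ((- 1#) + (- y))                  ≡⟨ cong₂ _+_ (sym (1+× m 1#)) (trans (-‿+-comm 1# y) (cong -_ (sym (1+× n 1#)))) ⟩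
      (suc m ×′ 1#) + (- (suc n ×′ 1#))              ∎
      where
      open ≡-Reasoning
      x = m ×′ 1#
      y = n ×′ 1#
      interchange : ∀ a b c d → (a + b) + (c + d) ≡ (a + c) + (b + d)
      interchange a b c d = begin
        (a + b) + (c + d) ≡⟨ +-assoc a b (c + d) ⟩
        a + (b + (c + d)) ≡⟨ cong (a +_) (sym (+-assoc b c d)) ⟩
        a + ((b + c) + d) ≡⟨ cong (λ z → a + (z + d)) (+-comm b c) ⟩
        a + ((c + b) + d) ≡⟨ cong (a +_) (+-assoc c b d) ⟩
        a + (c + (b + d)) ≡⟨ sym (+-assoc a c (b + d)) ⟩
        (a + c) + (b + d) ∎

    fromℤ-+ : ∀ i j → fromℤ (i ℤ.+ j) ≡ fromℤ i + fromℤ j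
    fromℤ-+ (ℤ.+ m)    (ℤ.+ n)    = ×-homo-+ 1# m n
    fromℤ-+ (ℤ.+ m)    -[1+ n ] = fromℤ-⊖ m (suc n)
    fromℤ-+ -[1+ m ] (ℤ.+ n)    = trans (fromℤ-⊖ n (suc m)) (+-comm _ _)
    fromℤ-+ -[1+ m ] -[1+ n ] = begin
      - (suc (suc (m ℕ.+ n)) ×′ 1#)             ≡⟨ cong (λ k → - (k ×′ 1#)) (cong suc (sym (ℕₚ.+-suc m n))) ⟩
      - ((suc m ℕ.+ suc n) ×′ 1#)               ≡⟨ cong -_ (×-homo-+ 1# (suc m) (suc n)) ⟩
      - ((suc m ×′ 1#) + (suc n ×′ 1#))          ≡⟨ sym (-‿+-comm _ _) ⟩
      (- (suc m ×′ 1#)) + (- (suc n ×′ 1#))      ∎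
      where
      open ≡-Reasoning

    fromℤ-*⁺ : ∀ m j → fromℤ (ℤ.+ m ℤ.* j) ≡ (m ×′ 1#) * fromℤ j
    fromℤ-*⁺ m (ℤ.+ n)    = trans (cong fromℤ (sym (ℤₚ.pos-* m n))) (×1-homo-* m n)
    fromℤ-*⁺ m -[1+ n ] = begin
      fromℤ (ℤ.+ m ℤ.* -[1+ n ])          ≡⟨ cong fromℤ (sym (ℤₚ.neg-distribʳ-* (ℤ.+ m) (ℤ.+ suc n))) ⟩
      fromℤ (ℤ.- (ℤ.+ m ℤ.* ℤ.+ suc n))     ≡⟨ fromℤ-neg (ℤ.+ m ℤ.* ℤ.+ suc n) ⟩
      - fromℤ (ℤ.+ m ℤ.* ℤ.+ suc n)         ≡⟨ cong -_ (fromℤ-*⁺ m (ℤ.+ suc n)) ⟩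
      - ((m ×′ 1#) * (suc n ×′ 1#))       ≡⟨ -‿distribʳ-* _ _ ⟩
      (m ×′ 1#) * (- (suc n ×′ 1#))       ∎
      where open ≡-Reasoning

    fromℤ-* : ∀ i j → fromℤ (i ℤ.* j) ≡ fromℤ i * fromℤ j
    fromℤ-* (ℤ.+ m)    j = fromℤ-*⁺ m j
    fromℤ-* -[1+ m ] j = begin
      fromℤ (-[1+ m ] ℤ.* j)         ≡⟨ cong fromℤ (sym (ℤₚ.neg-distribˡ-* (ℤ.+ suc m) j)) ⟩
      fromℤ (ℤ.- (ℤ.+ suc m ℤ.* j))    ≡⟨ fromℤ-neg (ℤ.+ suc m ℤ.* j) ⟩
      - fromℤ (ℤ.+ suc m ℤ.* j)        ≡⟨ cong -_ (fromℤ-*⁺ (suc m) j) ⟩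
      - ((suc m ×′ 1#) * fromℤ j)     ≡⟨ -‿distribˡ-* _ _ ⟩
      (- (suc m ×′ 1#)) * fromℤ j     ∎
      where open ≡-Reasoning

    morphism : CommutativeRing.rawRing ℤₚ.+-*-commutativeRing -Raw-AlmostCommutative⟶ fromCommutativeRing R
    morphism = record
      { ⟦_⟧    = fromℤ
      ; +-homo = fromℤ-+
      ; *-homo = fromℤ-*
      ; -‿homo = fromℤ-neg
      ; 0-homo = refl
      ; 1-homo = refl
      }

    coeff≟ : (i j : ℤ) → Maybe (fromℤ i ≡ fromℤ j)
    coeff≟ i j with i ℤₚ.≟ j
    ... | yes i≡j = just (cong fromℤ i≡j)
    ... | no  _   = nothing

  open Algebra.Solver.Ring _ (fromCommutativeRing R) morphism coeff≟ public

-- Proved for an abstract ring and used for ℚ, where the solver would unfold the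
-- normalising arithmetic.
module RingIdentities {A : Set} {_+_ _*_ : A → A → A} { -_ : A → A} {0# 1# : A}
  (isCR : IsCommutativeRing _≡_ _+_ _*_ -_ 0# 1#) where
  open IntegerSolver isCR

  +-interchange : ∀ a b c d → (a + b) + (c + d) ≡ (a + c) + (b + d)
  +-interchange = solve 4 (λ a b c d → a :+ b :+ (c :+ d) := a :+ c :+ (b :+ d)) refl

  ∸-interchange : ∀ a b c d → (a + (- b)) + (c + (- d)) ≡ (a + c) + (- (b + d))
  ∸-interchange = solve 4 (λ a b c d → a :- b :+ (c :- d) := a :+ c :- (b :+ d)) refl

  *-distribˡ-∸ : ∀ k x y → k * (x + (- y)) ≡ (k * x) + (- (k * y))
  *-distribˡ-∸ = solve 3 (λ k x y → k :* (x :- y) := k :* x :- k :* y) refl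

  x≡x-y+y : ∀ x y → x ≡ (x + (- y)) + y
  x≡x-y+y = solve 2 (λ x y → x := (x :- y) :+ y) refl

  x-y≡0⇒x≡y : ∀ {x y} → x + (- y) ≡ 0# → x ≡ y
  x-y≡0⇒x≡y {x} {y} e = trans (x≡x-y+y x y) (trans (cong (_+ y) e) (IsCommutativeRing.+-identityˡ isCR y))

  x≡y⇒x-y≡0 : ∀ {x y} → x ≡ y → x + (- y) ≡ 0#
  x≡y⇒x-y≡0 {x} refl = IsCommutativeRing.-‿inverseʳ isCR x

  c+n*c≡[1+n]*c : ∀ c n → c + (n * c) ≡ (1# + n) * c
  c+n*c≡[1+n]*c = solve 2 (λ c n → c :+ n :* c := (con ℤ.1ℤ :+ n) :* c) refl

  -1*x≡-x : ∀ x → (- 1#) * x ≡ - x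
  -1*x≡-x = solve 1 (λ x → (:- con ℤ.1ℤ) :* x := :- x) refl

  regroup₅ : ∀ p q t f g → ((p * q) * t) * (f * g) ≡ ((p * f) * t) * (q * g)
  regroup₅ = solve 5 (λ p q t f g → p :* q :* t :* (f :* g) := p :* f :* t :* (q :* g)) refl

  regroup₃ : ∀ p q t → (p * t) * q ≡ (p * q) * t
  regroup₃ = solve 3 (λ p q t → p :* t :* q := p :* q :* t) refl

  scale-square : ∀ k x t → ((k * x) * (k * x)) * t ≡ (k * k) * ((x * x) * t)
  scale-square = solve 3 (λ k x t → k :* x :* (k :* x) :* t := k :* k :* (x :* x :* t)) refl

  factor₅ : ∀ a b c d e f → (a * f) + ((b * f) + ((c * f) + ((d * f) + (e * f)))) ≡ (a + (b + (c + (d + e)))) * f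
  factor₅ = solve 6 (λ a b c d e f → a :* f :+ (b :* f :+ (c :* f :+ (d :* f :+ e :* f))) := (a :+ (b :+ (c :+ (d :+ e)))) :* f) refl

  u-w≡2u-[u+w] : ∀ u w → u + (- w) ≡ (u + u) + (- (u + w))
  u-w≡2u-[u+w] = solve 2 (λ u w → u :- w := u :+ u :- (u :+ w)) refl

  -- Here α, k and b stand for qⁿ⁻² - 1, q - 2 and qⁿ⁻¹; the right-hand side has no subtraction
  -- left, so it is visibly positive.
  rowSum₀ : ∀ α k b → let two = 1# + 1#; a-1 = (1# + α) + (- 1#) in
    1# + ((a-1 * (b + 1#)) + ((((1# + α) * k) * (b + 1#)) + ((a-1 * (b + 1#)) + 1#)))
      ≡ two + (((two * α) + ((1# + α) * k)) * (b + 1#))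
  rowSum₀ = solve 3 (λ α k b → let one = con ℤ.1ℤ; two = one :+ one; a-1 = (one :+ α) :- one in
    one :+ (a-1 :* (b :+ one) :+ ((one :+ α) :* k :* (b :+ one) :+ (a-1 :* (b :+ one) :+ one)))
      := two :+ (two :* α :+ (one :+ α) :* k) :* (b :+ one)) refl

  rowSum₁ : ∀ b → 1# + ((b + 1#) + (0# + ((- (b + 1#)) + (- 1#)))) ≡ 0#
  rowSum₁ = solve 1 (λ b → let one = con ℤ.1ℤ in
    one :+ ((b :+ one) :+ (con ℤ.0ℤ :+ ((:- (b :+ one)) :+ (:- one)))) := con ℤ.0ℤ) refl

  rowSum₃ : ∀ a → 1# + ((- (a + (- 1#))) + (0# + ((a + (- 1#)) + (- 1#)))) ≡ 0#
  rowSum₃ = solve 1 (λ a → let one = con ℤ.1ℤ in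
    one :+ ((:- (a :- one)) :+ (con ℤ.0ℤ :+ ((a :- one) :+ (:- one)))) := con ℤ.0ℤ) refl

  rowSum₄ : ∀ a k → let x = (- (a * k)) + (- 1#) in 1# + (x + ((((1# + 1#) * a) * k) + (x + 1#))) ≡ 0#
  rowSum₄ = solve 2 (λ a k → let one = con ℤ.1ℤ; x = (:- (a :* k)) :- one in
    one :+ (x :+ ((one :+ one) :* a :* k :+ (x :+ one))) := con ℤ.0ℤ) refl

  1*[x-y]+y≡x : ∀ x y → (1# * (x + (- y))) + y ≡ x
  1*[x-y]+y≡x = solve 2 (λ x y → con ℤ.1ℤ :* (x :- y) :+ y := x) refl

  0*x+y≡y : ∀ x y → (0# * x) + y ≡ y
  0*x+y≡y = solve 2 (λ x y → con ℤ.0ℤ :* x :+ y := y) refl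

  q*1-q≡0 : ∀ q → (q * 1#) + (- q) ≡ - 0#
  q*1-q≡0 = solve 1 (λ q → q :* con ℤ.1ℤ :- q := :- con ℤ.0ℤ) refl

  q*0-x≡-x : ∀ q x → (q * 0#) + (- x) ≡ - x
  q*0-x≡-x = solve 2 (λ q x → q :* con ℤ.0ℤ :- x := :- x) refl

  perp-solve : ∀ q x y → (q + (- 1#)) * y ≡ ((x + (- y)) + (q * y)) + (- x)
  perp-solve = solve 3 (λ q x y → (q :- con ℤ.1ℤ) :* y := x :- y :+ q :* y :- x) refl

  perp-value : ∀ q f → (q * f) + (- ((1# + ((q + (- 1#)) * ((q * q) + 1#))) * f)) ≡ (q + (- 1#)) * (- ((q * q) * f))
  perp-value = solve 2 (λ q f → q :* f :- (con ℤ.1ℤ :+ (q :- con ℤ.1ℤ) :* (q :* q :+ con ℤ.1ℤ)) :* f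
    := (q :- con ℤ.1ℤ) :* (:- (q :* q :* f))) refl

  g-expand : ∀ q d o f → ((q * d) + (- o)) * f ≡ (q * (d * f)) + (- (o * f))
  g-expand = solve 4 (λ q d o f → (q :* d :- o) :* f := q :* (d :* f) :- o :* f) refl

  g-value : ∀ q f → (q * f) + (- (- ((q * q) * f))) ≡ (q + (q * q)) * f
  g-value = solve 2 (λ q f → q :* f :- (:- (q :* q :* f)) := (q :+ q :* q) :* f) refl

  m-expand : ∀ g h f → f * (g + (- h)) ≡ (g * f) + (- (h * f))
  m-expand = solve 3 (λ g h f → f :* (g :- h) := g :* f :- h :* f) refl

  m-value : ∀ β f → (β * f) + (- (β * (- f))) ≡ (β + β) * f
  m-value = solve 2 (λ β f → β :* f :- β :* (:- f) := (β :+ β) :* f) refl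

  swap-minus : ∀ x y → x + (- y) ≡ - (y + (- x))
  swap-minus = solve 2 (λ x y → x :- y := :- (y :- x)) refl

  m-relations : ∀ q e s c d → ((q * e) + (- (e + c))) + (- ((q * s) + (- (s + d))))
    ≡ (((q + (- 1#)) * e) + (- c)) + (- (((q + (- 1#)) * s) + (- d)))
  m-relations = solve 5 (λ q e s c d → q :* e :- (e :+ c) :- (q :* s :- (s :+ d))
    := (q :- con ℤ.1ℤ) :* e :- c :- ((q :- con ℤ.1ℤ) :* s :- d)) refl

  combine₄ : ∀ k e s c d f → (((k * e) + (- c)) + (- ((k * s) + (- d)))) * f
    ≡ ((k * (e * f)) + (- (c * f))) + (- ((k * (s * f)) + (- (d * f))))
  combine₄ = solve 6 (λ k e s c d f → (k :* e :- c :- (k :* s :- d)) :* f := k :* (e :* f) :- c :* f :- (k :* (s :* f) :- d :* f)) refl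

  V₁-value : ∀ q v → let k = q + (- 1#); r = (q * q) + 1# in
    ((k * (1# * v)) + (- ((- r) * v))) + (- ((k * ((- 1#) * v)) + (- (r * v)))) ≡ ((q + (q * q)) + (q + (q * q))) * v
  V₁-value = solve 2 (λ q v → let one = con ℤ.1ℤ; k = q :- one; r = q :* q :+ one in
    k :* (one :* v) :- (:- r) :* v :- (k :* ((:- one) :* v) :- r :* v) := (q :+ q :* q :+ (q :+ q :* q)) :* v) refl

  square-combine : ∀ k e s c d f → ((k * (e + s)) + (c + d)) * f ≡ (k * ((e * f) + (s * f))) + ((c * f) + (d * f))
  square-combine = solve 6 (λ k e s c d f → (k :* (e :+ s) :+ (c :+ d)) :* f := k :* (e :* f :+ s :* f) :+ (c :* f :+ d :* f)) refl

  -- The Krein parameter q₁₁⁴ vanishes because q(q − 2) + 1 = (q − 1)².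
  V₄-value : ∀ q t → let k = q + (- 1#); r = (- (q * (q + (- (1# + 1#))))) + (- 1#) in
    ((k * k) * ((1# * t) + (1# * t))) + ((r * t) + (r * t)) ≡ 0#
  V₄-value = solve 2 (λ q t → let one = con ℤ.1ℤ; k = q :- one; r = (:- (q :* (q :- (one :+ one)))) :- one in
    k :* k :* (one :* t :+ one :* t) :+ (r :* t :+ r :* t) := con ℤ.0ℤ) refl

  square-first : ∀ k → let x = ((k * 1#) + (- 0#)) + (- ((k * 0#) + (- 0#))) in x * x ≡ ((k * k) * (1# + 0#)) + (0# + 0#)
  square-first = solve 1 (λ k → let i = con ℤ.1ℤ; o = con ℤ.0ℤ; x = k :* i :- o :- (k :* o :- o) in x :* x := k :* k :* (i :+ o) :+ (o :+ o)) refl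

  square-second : ∀ k → let x = ((k * 0#) + (- 0#)) + (- ((k * 1#) + (- 0#))) in x * x ≡ ((k * k) * (0# + 1#)) + (0# + 0#)
  square-second = solve 1 (λ k → let i = con ℤ.1ℤ; o = con ℤ.0ℤ; x = k :* o :- o :- (k :* i :- o) in x :* x := k :* k :* (o :+ i) :+ (o :+ o)) refl

  square-third : ∀ k → let x = ((k * 0#) + (- 1#)) + (- ((k * 0#) + (- 0#))) in x * x ≡ ((k * k) * (0# + 0#)) + (1# + 0#)
  square-third = solve 1 (λ k → let i = con ℤ.1ℤ; o = con ℤ.0ℤ; x = k :* o :- i :- (k :* o :- o) in x :* x := k :* k :* (o :+ o) :+ (i :+ o)) refl

  square-fourth : ∀ k → let x = ((k * 0#) + (- 0#)) + (- ((k * 0#) + (- 1#))) in x * x ≡ ((k * k) * (0# + 0#)) + (0# + 1#)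
  square-fourth = solve 1 (λ k → let i = con ℤ.1ℤ; o = con ℤ.0ℤ; x = k :* o :- o :- (k :* o :- i) in x :* x := k :* k :* (o :+ o) :+ (o :+ i)) refl

  square-none : ∀ k → let x = ((k * 0#) + (- 0#)) + (- ((k * 0#) + (- 0#))) in x * x ≡ ((k * k) * (0# + 0#)) + (0# + 0#)
  square-none = solve 1 (λ k → let o = con ℤ.0ℤ; x = k :* o :- o :- (k :* o :- o) in x :* x := k :* k :* (o :+ o) :+ (o :+ o)) refl

  -- The two values are those of χ at a point and at its σ-image; when both are 0 or 1 the
  -- right-hand side vanishes.
  idempotent-difference : ∀ c v t → let x = (c + v) + t; y = (c + (- v)) + t in
    (v + v) * ((((c + t) + (c + t))) + (- 1#)) ≡ ((x * x) + (- x)) + (- ((y * y) + (- y)))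
  idempotent-difference = solve 3 (λ c v t → let x = c :+ v :+ t; y = c :- v :+ t in
    (v :+ v) :* (c :+ t :+ (c :+ t) :- con ℤ.1ℤ) := x :* x :- x :- (y :* y :- y)) refl

  final-split : ∀ c v t → (v * v) * (1# + (- (c + c))) ≡ ((1# + 1#) * ((v * v) * t)) + (- (v * (v * (((c + t) + (c + t)) + (- 1#)))))
  final-split = solve 3 (λ c v t → v :* v :* (con ℤ.1ℤ :- (c :+ c)) :=
    (con ℤ.1ℤ :+ con ℤ.1ℤ) :* (v :* v :* t) :- v :* (v :* (c :+ t :+ (c :+ t) :- con ℤ.1ℤ))) refl

  q*[1+q] : ∀ q → q * (1# + q) ≡ q + (q * q)
  q*[1+q] = solve 1 (λ q → q :* (con ℤ.1ℤ :+ q) := q :+ q :* q) refl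

  2*x : ∀ x → (1# + 1#) * x ≡ x + x
  2*x = solve 1 (λ x → (con ℤ.1ℤ :+ con ℤ.1ℤ) :* x := x :+ x) refl

  2*[v*w] : ∀ v w → (1# + 1#) * (v * w) ≡ (v + v) * w
  2*[v*w] = solve 2 (λ v w → (con ℤ.1ℤ :+ con ℤ.1ℤ) :* (v :* w) := (v :+ v) :* w) refl

  x-y*0≡x : ∀ x y → x + (- (y * 0#)) ≡ x
  x-y*0≡x = solve 2 (λ x y → x :- y :* con ℤ.0ℤ := x) refl

-- Rational arithmetic and the embedding of the integers

private
  module Id = RingIdentities ℚₚ.+-*-isCommutativeRing
  module Idℤ = RingIdentities ℤₚ.+-*-isCommutativeRing

ι : ℤ → ℚ
ι i = i / 1

private
  toℚᵘ-ι : ∀ i → ℚ.toℚᵘ (ι i) ℚᵘ.≃ ℚᵘ.mkℚᵘ i 0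
  toℚᵘ-ι i = ℚₚ.toℚᵘ-fromℚᵘ (ℚᵘ.mkℚᵘ i 0)

-- `_/_` normalises by a gcd that is stuck on variables. The law is therefore checked on
-- unnormalised fractions with denominator 1 and pulled back along `ℚ.toℚᵘ`.
ι-+ : ∀ i j → ι (i ℤ.+ j) ≡ ι i ℚ.+ ι j
ι-+ i j = ℚₚ.toℚᵘ-injective (begin
  ℚ.toℚᵘ (ι (i ℤ.+ j))                   ≈⟨ toℚᵘ-ι (i ℤ.+ j) ⟩
  ℚᵘ.mkℚᵘ (i ℤ.+ j) 0                    ≈⟨ ℚᵘ.*≡* (cong (ℤ._* ℤ.+ 1) (sym (cong₂ ℤ._+_ (ℤₚ.*-identityʳ i) (ℤₚ.*-identityʳ j)))) ⟩
  ℚᵘ.mkℚᵘ i 0 ℚᵘ.+ ℚᵘ.mkℚᵘ j 0           ≈⟨ ℚᵘₚ.+-cong (ℚᵘₚ.≃-sym (toℚᵘ-ι i)) (ℚᵘₚ.≃-sym (toℚᵘ-ι j)) ⟩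
  ℚ.toℚᵘ (ι i) ℚᵘ.+ ℚ.toℚᵘ (ι j)         ≈⟨ ℚᵘₚ.≃-sym (ℚₚ.toℚᵘ-homo-+ (ι i) (ι j)) ⟩
  ℚ.toℚᵘ (ι i ℚ.+ ι j)                   ∎)
  where open ℚᵘₚ.≃-Reasoning

ι-* : ∀ i j → ι (i ℤ.* j) ≡ ι i ℚ.* ι j
ι-* i j = ℚₚ.toℚᵘ-injective (begin
  ℚ.toℚᵘ (ι (i ℤ.* j))                   ≈⟨ toℚᵘ-ι (i ℤ.* j) ⟩
  ℚᵘ.mkℚᵘ i 0 ℚᵘ.* ℚᵘ.mkℚᵘ j 0           ≈⟨ ℚᵘₚ.*-cong (ℚᵘₚ.≃-sym (toℚᵘ-ι i)) (ℚᵘₚ.≃-sym (toℚᵘ-ι j)) ⟩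
  ℚ.toℚᵘ (ι i) ℚᵘ.* ℚ.toℚᵘ (ι j)         ≈⟨ ℚᵘₚ.≃-sym (ℚₚ.toℚᵘ-homo-* (ι i) (ι j)) ⟩
  ℚ.toℚᵘ (ι i ℚ.* ι j)                   ∎)
  where open ℚᵘₚ.≃-Reasoning

ι-injective : ∀ {i j} → ι i ≡ ι j → i ≡ j
ι-injective {i} {j} eq with ℚᵘₚ.≃-trans (ℚᵘₚ.≃-sym (toℚᵘ-ι i)) (ℚᵘₚ.≃-trans (ℚᵘₚ.≃-reflexive (cong ℚ.toℚᵘ eq)) (toℚᵘ-ι j))
... | ℚᵘ.*≡* e = ℤₚ.*-cancelʳ-≡ i j (ℤ.+ 1) e

ι-neg : ∀ i → ι (ℤ.- i) ≡ ℚ.- ι i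
ι-neg i = begin
  ι (ℤ.- i)       ≡⟨ cong ι (sym (ℤₚ.-1*i≡-i i)) ⟩
  ι (ℤ.-1ℤ ℤ.* i) ≡⟨ ι-* ℤ.-1ℤ i ⟩
  ι ℤ.-1ℤ ℚ.* ι i ≡⟨ Id.-1*x≡-x (ι i) ⟩
  ℚ.- ι i         ∎
  where
  open ≡-Reasoning

x*y≡0⇒x≡0∨y≡0 : ∀ x y → x ℚ.* y ≡ 0ℚ → x ≡ 0ℚ ⊎ y ≡ 0ℚ
x*y≡0⇒x≡0∨y≡0 x y xy≡0 with x ℚₚ.≟ 0ℚ
... | yes x≡0 = inj₁ x≡0
... | no x≢0 = inj₂ (begin
  y                      ≡⟨ sym (ℚₚ.*-identityˡ y) ⟩
  1ℚ ℚ.* y               ≡⟨ cong (ℚ._* y) (sym (ℚₚ.*-inverseˡ x)) ⟩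
  ℚ.1/ x ℚ.* x ℚ.* y     ≡⟨ ℚₚ.*-assoc (ℚ.1/ x) x y ⟩
  ℚ.1/ x ℚ.* (x ℚ.* y)   ≡⟨ cong (ℚ.1/ x ℚ.*_) xy≡0 ⟩
  ℚ.1/ x ℚ.* 0ℚ          ≡⟨ ℚₚ.*-zeroʳ (ℚ.1/ x) ⟩
  0ℚ                     ∎)
  where
  open ≡-Reasoning
  instance _ = ℚ.≢-nonZero x≢0

*-cancelˡ : ∀ {k} x y → k ≢ 0ℚ → k ℚ.* x ≡ k ℚ.* y → x ≡ y
*-cancelˡ {k} x y k≢0 e = [ (λ k≡0 → ⊥-elim (k≢0 k≡0)) , Id.x-y≡0⇒x≡y ]′
  (x*y≡0⇒x≡0∨y≡0 k (x ℚ.- y) (trans (Id.*-distribˡ-∸ k x y)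
    (trans (cong (ℚ._- (k ℚ.* y)) e) (ℚₚ.+-inverseʳ (k ℚ.* y)))))

0≤x*x : ∀ x → 0ℚ ℚ.≤ x ℚ.* x
0≤x*x x with ℚₚ.≤-total 0ℚ x
... | inj₁ 0≤x = subst (ℚ._≤ x ℚ.* x) (ℚₚ.*-zeroʳ x) (ℚₚ.*-monoˡ-≤-nonNeg x 0≤x)
  where instance _ = ℚ.nonNegative 0≤x
... | inj₂ x≤0 = subst (ℚ._≤ x ℚ.* x) (ℚₚ.*-zeroʳ x) (ℚₚ.*-monoˡ-≤-nonPos x x≤0)
  where instance _ = ℚ.nonPositive x≤0

0≤x⇒0≤y⇒x+y≡0⇒x≡0 : ∀ {x y} → 0ℚ ℚ.≤ x → 0ℚ ℚ.≤ y → x ℚ.+ y ≡ 0ℚ → x ≡ 0ℚ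
0≤x⇒0≤y⇒x+y≡0⇒x≡0 {x} {y} 0≤x 0≤y e = ℚₚ.≤-antisym (begin
  x           ≡⟨ sym (ℚₚ.+-identityʳ x) ⟩
  x ℚ.+ 0ℚ    ≤⟨ ℚₚ.+-monoʳ-≤ x 0≤y ⟩
  x ℚ.+ y     ≡⟨ e ⟩
  0ℚ          ∎) 0≤x
  where open ℚₚ.≤-Reasoning

-- Finite sums of rationals

module _ {A : Set} where

  ∑ : List A → (A → ℚ) → ℚ
  ∑ []      f = 0ℚ
  ∑ (x ∷ L) f = f x ℚ.+ ∑ L f

  foldr≡∑ : ∀ L (f : A → ℚ) → foldr (λ x acc → f x ℚ.+ acc) 0ℚ L ≡ ∑ L f
  foldr≡∑ []      f = refl
  foldr≡∑ (x ∷ L) f = cong (f x ℚ.+_) (foldr≡∑ L f)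

  ∑-cong : ∀ L {f g : A → ℚ} → (∀ {x} → x ∈ L → f x ≡ g x) → ∑ L f ≡ ∑ L g
  ∑-cong []      e = refl
  ∑-cong (x ∷ L) e = cong₂ ℚ._+_ (e (here refl)) (∑-cong L (λ x∈L → e (there x∈L)))

  ∑-zero : ∀ L → ∑ L (λ _ → 0ℚ) ≡ 0ℚ
  ∑-zero []      = refl
  ∑-zero (x ∷ L) = trans (ℚₚ.+-identityˡ _) (∑-zero L)

  ∑-+ : ∀ L (f g : A → ℚ) → ∑ L (λ x → f x ℚ.+ g x) ≡ ∑ L f ℚ.+ ∑ L g
  ∑-+ []      f g = refl
  ∑-+ (x ∷ L) f g = trans (cong (f x ℚ.+ g x ℚ.+_) (∑-+ L f g))
    (Id.+-interchange (f x) (g x) (∑ L f) (∑ L g))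

  ∑-*ˡ : ∀ L c (f : A → ℚ) → ∑ L (λ x → c ℚ.* f x) ≡ c ℚ.* ∑ L f
  ∑-*ˡ []      c f = sym (ℚₚ.*-zeroʳ c)
  ∑-*ˡ (x ∷ L) c f = trans (cong (c ℚ.* f x ℚ.+_) (∑-*ˡ L c f)) (sym (ℚₚ.*-distribˡ-+ c (f x) (∑ L f)))

  ∑-*ʳ : ∀ L c (f : A → ℚ) → ∑ L (λ x → f x ℚ.* c) ≡ ∑ L f ℚ.* c
  ∑-*ʳ L c f = trans (∑-cong L (λ _ → ℚₚ.*-comm _ c)) (trans (∑-*ˡ L c f) (ℚₚ.*-comm c _))

  ∑-minus : ∀ L (f g : A → ℚ) → ∑ L (λ x → f x ℚ.- g x) ≡ ∑ L f ℚ.- ∑ L g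
  ∑-minus []      f g = refl
  ∑-minus (x ∷ L) f g = trans (cong (f x ℚ.- g x ℚ.+_) (∑-minus L f g))
    (Id.∸-interchange (f x) (g x) (∑ L f) (∑ L g))

  ∑-const : ∀ L c → ∑ L (λ _ → c) ≡ ι (ℤ.+ length L) ℚ.* c
  ∑-const []      c = sym (ℚₚ.*-zeroˡ c)
  ∑-const (x ∷ L) c = trans (cong (c ℚ.+_) (∑-const L c))
    (trans (Id.c+n*c≡[1+n]*c c (ι (ℤ.+ length L)))
           (cong (ℚ._* c) (sym (ι-+ (ℤ.+ 1) (ℤ.+ length L)))))

  ∑-nonNeg : ∀ L {f : A → ℚ} → (∀ x → 0ℚ ℚ.≤ f x) → 0ℚ ℚ.≤ ∑ L f
  ∑-nonNeg []      h = ℚₚ.≤-refl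
  ∑-nonNeg (x ∷ L) h = ℚₚ.+-mono-≤ (h x) (∑-nonNeg L h)

  ∑-nonNeg-zero : ∀ L {f : A → ℚ} → (∀ x → 0ℚ ℚ.≤ f x) → ∑ L f ≡ 0ℚ → ∀ {x} → x ∈ L → f x ≡ 0ℚ
  ∑-nonNeg-zero (x ∷ L) h e (here refl) = 0≤x⇒0≤y⇒x+y≡0⇒x≡0 (h x) (∑-nonNeg L h) e
  ∑-nonNeg-zero (x ∷ L) h e (there x∈L) = ∑-nonNeg-zero L h
    (0≤x⇒0≤y⇒x+y≡0⇒x≡0 (∑-nonNeg L h) (h x) (trans (ℚₚ.+-comm (∑ L _) _) e)) x∈L

  ∑-square-zero : ∀ L (f : A → ℚ) → ∑ L (λ x → f x ℚ.* f x) ≡ 0ℚ → ∀ {x} → x ∈ L → f x ≡ 0ℚ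
  ∑-square-zero L f e {x} x∈L = reduce (x*y≡0⇒x≡0∨y≡0 (f x) (f x) (∑-nonNeg-zero L (λ x → 0≤x*x (f x)) e x∈L))

∑-swap : ∀ {A B : Set} (L : List A) (M : List B) (f : A → B → ℚ) →
  ∑ L (λ x → ∑ M (f x)) ≡ ∑ M (λ y → ∑ L (λ x → f x y))
∑-swap []      M f = sym (∑-zero M)
∑-swap (x ∷ L) M f = trans (cong (∑ M (f x) ℚ.+_) (∑-swap L M f)) (sym (∑-+ M (f x) (λ y → ∑ L (λ x → f x y))))

𝟙 : Bool → ℚ
𝟙 b = if b then 1ℚ else 0ℚ

if≡𝟙* : ∀ b x → (if b then x else 0ℚ) ≡ 𝟙 b ℚ.* x
if≡𝟙* true  x = sym (ℚₚ.*-identityˡ x)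
if≡𝟙* false x = sym (ℚₚ.*-zeroˡ x)

𝟙-idem : ∀ b → 𝟙 b ℚ.* 𝟙 b ≡ 𝟙 b
𝟙-idem true  = refl
𝟙-idem false = refl

∑-𝟙 : ∀ {A : Set} (θ : A → Bool) L → ∑ L (λ x → 𝟙 (θ x)) ≡ ι (ℤ.+ length (filter (λ x → θ x Data.Bool.≟ true) L))
∑-𝟙 θ [] = refl
∑-𝟙 θ (x ∷ L) with θ x
... | true  = trans (cong (1ℚ ℚ.+_) (∑-𝟙 θ L)) (sym (ι-+ (ℤ.+ 1) (ℤ.+ length (filter (λ x → θ x Data.Bool.≟ true) L))))
... | false = trans (ℚₚ.+-identityˡ _) (∑-𝟙 θ L)

does-⇔ : ∀ {P R : Set} (p? : Dec P) (r? : Dec R) → (P → R) → (R → P) → does p? ≡ does r?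
does-⇔ p? (yes r) f g = dec-true p? (g r)
does-⇔ p? (no ¬r) f g = dec-false p? (λ p → ¬r (f p))

module _ {A : Set} (_≟_ : DecidableEquality A) where

  ∑-δ-∉ : ∀ L y (f : A → ℚ) → All (y ≢_) L → ∑ L (λ x → 𝟙 (does (x ≟ y)) ℚ.* f x) ≡ 0ℚ
  ∑-δ-∉ []      y f []          = refl
  ∑-δ-∉ (x ∷ L) y f (y≢x ∷ y∉L) rewrite dec-false (x ≟ y) (λ x≡y → y≢x (sym x≡y)) =
    trans (cong₂ ℚ._+_ (ℚₚ.*-zeroˡ (f x)) (∑-δ-∉ L y f y∉L)) (ℚₚ.+-identityˡ 0ℚ)

  ∑-δ : ∀ {L} → Unique L → ∀ {y} → y ∈ L → (f : A → ℚ) → ∑ L (λ x → 𝟙 (does (x ≟ y)) ℚ.* f x) ≡ f y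
  ∑-δ {x ∷ L} (x∉L ∷ uL) (here refl) f rewrite dec-true (x ≟ x) refl =
    trans (cong₂ ℚ._+_ (ℚₚ.*-identityˡ (f x)) (∑-δ-∉ L x f x∉L)) (ℚₚ.+-identityʳ (f x))
  ∑-δ {x ∷ L} (x∉L ∷ uL) {y} (there y∈L) f rewrite dec-false (x ≟ y) (λ x≡y → All.lookup x∉L y∈L x≡y) =
    trans (cong₂ ℚ._+_ (ℚₚ.*-zeroˡ (f x)) (∑-δ uL y∈L f)) (ℚₚ.+-identityˡ (f y))

  -- Each `f (φ x)` is spread into a sum over `y` of a delta at `φ x`; after exchanging the sums,
  -- the same delta is read as `x ≡ ψ y`. No permutation of the list has to be exhibited.
  ∑-reindex : ∀ {L} → Unique L → (φ ψ : A → A) →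
    (∀ {x} → x ∈ L → φ x ∈ L) → (∀ {x} → x ∈ L → ψ x ∈ L) →
    (∀ {x} → x ∈ L → ψ (φ x) ≡ x) → (∀ {x} → x ∈ L → φ (ψ x) ≡ x) →
    (f : A → ℚ) → ∑ L (λ x → f (φ x)) ≡ ∑ L f
  ∑-reindex {L} uL φ ψ φ∈ ψ∈ ψφ φψ f = begin
    ∑ L (λ x → f (φ x))
      ≡⟨ ∑-cong L (λ x∈L → sym (∑-δ uL (φ∈ x∈L) f)) ⟩
    ∑ L (λ x → ∑ L (λ y → 𝟙 (does (y ≟ φ x)) ℚ.* f y))
      ≡⟨ ∑-swap L L _ ⟩
    ∑ L (λ y → ∑ L (λ x → 𝟙 (does (y ≟ φ x)) ℚ.* f y))
      ≡⟨ ∑-cong L (λ {y} y∈L → ∑-cong L (λ {x} x∈L → cong (λ b → 𝟙 b ℚ.* f y)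
           (does-⇔ (y ≟ φ x) (x ≟ ψ y) (λ e → trans (sym (ψφ x∈L)) (cong ψ (sym e))) (λ e → trans (sym (φψ y∈L)) (cong φ (sym e)))))) ⟩
    ∑ L (λ y → ∑ L (λ x → 𝟙 (does (x ≟ ψ y)) ℚ.* f y))
      ≡⟨ ∑-cong L (λ {y} y∈L → ∑-δ uL (ψ∈ y∈L) (λ _ → f y)) ⟩
    ∑ L f ∎
    where open ≡-Reasoning

module _ {A : Set} {P : A → Set} (P? : ∀ x → Dec (P x)) where

  ∑-filter : ∀ L (f : A → ℚ) → ∑ (filter P? L) f ≡ ∑ L (λ x → 𝟙 (does (P? x)) ℚ.* f x)
  ∑-filter []      f = refl
  ∑-filter (x ∷ L) f with does (P? x)
  ... | true  = cong₂ ℚ._+_ (sym (ℚₚ.*-identityˡ (f x))) (∑-filter L f)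
  ... | false = trans (∑-filter L f) (sym (trans (cong (ℚ._+ ∑ L (λ x → 𝟙 (does (P? x)) ℚ.* f x)) (ℚₚ.*-zeroˡ (f x))) (ℚₚ.+-identityˡ _)))

  ∑-none : ∀ L → (∀ {x} → x ∈ L → P x → ⊥) → ∑ L (λ x → 𝟙 (does (P? x))) ≡ 0ℚ
  ∑-none L h = trans (∑-cong L (λ {x} x∈L → cong 𝟙 (dec-false (P? x) (h x∈L)))) (∑-zero L)

  ∑-all : ∀ L → (∀ {x} → x ∈ L → P x) → ∑ L (λ x → 𝟙 (does (P? x))) ≡ ι (ℤ.+ length L)
  ∑-all L h = trans (∑-cong L (λ {x} x∈L → cong 𝟙 (dec-true (P? x) (h x∈L)))) (trans (∑-const L 1ℚ) (ℚₚ.*-identityʳ _))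

  ∑-one : DecidableEquality A → ∀ {L} → Unique L → ∀ {y} → y ∈ L → P y → (∀ {x} → P x → x ≡ y) → ∑ L (λ x → 𝟙 (does (P? x))) ≡ 1ℚ
  ∑-one _≟_ {L} uL {y} y∈L Py Px⇒x≡y = trans
    (∑-cong L (λ {x} _ → trans (cong 𝟙 (does-⇔ (P? x) (x ≟ y) Px⇒x≡y (λ x≡y → subst P (sym x≡y) Py))) (sym (ℚₚ.*-identityʳ _))))
    (∑-δ _≟_ uL y∈L (λ _ → 1ℚ))

-- With Φ(a,b) = ∑ₓ m(x,a) m(x,b) t(x) one has ‖Φ‖² = α² ∑ₓ,ᵧ m(x,y)² t(x) t(y) = 0,
-- so Φ vanishes, and ∑ₐ,ᵦ Φ(a,b) v(a) v(b) = α² ∑ₓ v(x)² t(x).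
module _ {A : Set} (L : List A) (m : A → A → ℚ) (α : ℚ)
  (M² : ∀ {x y} → x ∈ L → y ∈ L → ∑ L (λ a → m x a ℚ.* m y a) ≡ α ℚ.* m x y)
  (t : A → ℚ) (M∘M-t : ∀ {y} → y ∈ L → ∑ L (λ x → m x y ℚ.* m x y ℚ.* t x) ≡ 0ℚ)
  where

  private
    Φ : A → A → ℚ
    Φ a b = ∑ L (λ x → m x a ℚ.* m x b ℚ.* t x)

    Φ-bilinear : ∀ (f g : A → ℚ) → ∑ L (λ a → ∑ L (λ b → Φ a b ℚ.* (f a ℚ.* g b)))
      ≡ ∑ L (λ x → ∑ L (λ a → m x a ℚ.* f a) ℚ.* ∑ L (λ b → m x b ℚ.* g b) ℚ.* t x)
    Φ-bilinear f g = begin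
      ∑ L (λ a → ∑ L (λ b → Φ a b ℚ.* (f a ℚ.* g b)))
        ≡⟨ ∑-cong L (λ {a} _ → ∑-cong L (λ {b} _ → trans
             (sym (∑-*ʳ L (f a ℚ.* g b) (λ x → m x a ℚ.* m x b ℚ.* t x)))
             (∑-cong L (λ {x} _ → Id.regroup₅ (m x a) (m x b) (t x) (f a) (g b))))) ⟩
      ∑ L (λ a → ∑ L (λ b → ∑ L (λ x → h x a ℚ.* (m x b ℚ.* g b))))
        ≡⟨ ∑-cong L (λ {a} _ → trans (∑-swap L L _)
             (∑-cong L (λ {x} _ → ∑-*ˡ L (h x a) (λ b → m x b ℚ.* g b)))) ⟩
      ∑ L (λ a → ∑ L (λ x → h x a ℚ.* G x))
        ≡⟨ ∑-swap L L _ ⟩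
      ∑ L (λ x → ∑ L (λ a → h x a ℚ.* G x))
        ≡⟨ ∑-cong L (λ {x} _ → trans (∑-*ʳ L (G x) (h x)) (trans
             (cong (ℚ._* G x) (∑-*ʳ L (t x) (λ a → m x a ℚ.* f a)))
             (Id.regroup₃ (∑ L (λ a → m x a ℚ.* f a)) (G x) (t x)))) ⟩
      ∑ L (λ x → ∑ L (λ a → m x a ℚ.* f a) ℚ.* G x ℚ.* t x) ∎
      where
      open ≡-Reasoning
      h : A → A → ℚ
      h x a = m x a ℚ.* f a ℚ.* t x
      G : A → ℚ
      G x = ∑ L (λ b → m x b ℚ.* g b)

    -- Serves both evaluations of Φ. With `f` a row of `m` the hypothesis is M² = αM and the
    -- right-hand side is α² times an entry of (M ∘ M)t; with `f` and `h` both equal to `v` the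
    -- hypothesis is Mv = αv.
    Φ-eigen : ∀ (f h : A → ℚ) → (∀ {x} → x ∈ L → ∑ L (λ a → m x a ℚ.* f a) ≡ α ℚ.* h x) →
      ∑ L (λ a → ∑ L (λ b → Φ a b ℚ.* (f a ℚ.* f b))) ≡ α ℚ.* α ℚ.* ∑ L (λ x → h x ℚ.* h x ℚ.* t x)
    Φ-eigen f h e = trans (Φ-bilinear f f) (trans
      (∑-cong L (λ {x} x∈L → trans (cong (λ z → z ℚ.* z ℚ.* t x) (e x∈L)) (Id.scale-square α (h x) (t x))))
      (∑-*ˡ L (α ℚ.* α) _))

    Φ-norm : ∑ L (λ a → ∑ L (λ b → Φ a b ℚ.* Φ a b)) ≡ 0ℚ
    Φ-norm = begin
      ∑ L (λ a → ∑ L (λ b → Φ a b ℚ.* Φ a b))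
        ≡⟨ ∑-cong L (λ {a} _ → trans
             (∑-cong L (λ {b} _ → trans (sym (∑-*ˡ L (Φ a b) _))
               (∑-cong L (λ {x} _ → sym (ℚₚ.*-assoc (Φ a b) (m x a ℚ.* m x b) (t x))))))
             (∑-swap L L _)) ⟩
      ∑ L (λ a → ∑ L (λ x → ∑ L (λ b → Φ a b ℚ.* (m x a ℚ.* m x b) ℚ.* t x)))
        ≡⟨ ∑-swap L L _ ⟩
      ∑ L (λ x → ∑ L (λ a → ∑ L (λ b → Φ a b ℚ.* (m x a ℚ.* m x b) ℚ.* t x)))
        ≡⟨ ∑-cong L (λ {x} _ → trans
             (∑-cong L (λ {a} _ → ∑-*ʳ L (t x) (λ b → Φ a b ℚ.* (m x a ℚ.* m x b))))
             (∑-*ʳ L (t x) (λ a → ∑ L (λ b → Φ a b ℚ.* (m x a ℚ.* m x b))))) ⟩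
      ∑ L (λ x → ∑ L (λ a → ∑ L (λ b → Φ a b ℚ.* (m x a ℚ.* m x b))) ℚ.* t x)
        ≡⟨ ∑-cong L (λ {x} x∈L → trans (cong (ℚ._* t x) (trans
             (Φ-eigen (m x) (λ y → m y x) (λ y∈L → M² y∈L x∈L))
             (trans (cong (α ℚ.* α ℚ.*_) (M∘M-t x∈L)) (ℚₚ.*-zeroʳ (α ℚ.* α))))) (ℚₚ.*-zeroˡ (t x))) ⟩
      ∑ L (λ _ → 0ℚ)
        ≡⟨ ∑-zero L ⟩
      0ℚ ∎
      where open ≡-Reasoning

    Φ-zero : ∀ {a b} → a ∈ L → b ∈ L → Φ a b ≡ 0ℚ
    Φ-zero {a} a∈L b∈L = ∑-square-zero L (Φ a)
      (∑-nonNeg-zero L (λ a → ∑-nonNeg L (λ b → 0≤x*x (Φ a b))) Φ-norm a∈L) b∈L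

  ∑v²t≡0 : α ≢ 0ℚ → ∀ (v : A → ℚ) → (∀ {x} → x ∈ L → ∑ L (λ a → m x a ℚ.* v a) ≡ α ℚ.* v x) →
    ∑ L (λ x → v x ℚ.* v x ℚ.* t x) ≡ 0ℚ
  ∑v²t≡0 α≢0 v Mv = [ (λ α²≡0 → ⊥-elim (α≢0 (reduce (x*y≡0⇒x≡0∨y≡0 α α α²≡0)))) , (λ e → e) ]′
    (x*y≡0⇒x≡0∨y≡0 (α ℚ.* α) _ (trans (sym (Φ-eigen v v Mv)) (trans
      (∑-cong L (λ {a} a∈L → trans
        (∑-cong L (λ {b} b∈L → trans (cong (ℚ._* (v a ℚ.* v b)) (Φ-zero a∈L b∈L)) (ℚₚ.*-zeroˡ (v a ℚ.* v b))))
        (∑-zero L)))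
      (∑-zero L))))

-- Linear algebra over the finite field

module FieldProperties (K : FiniteField) where
  open FiniteField K
  open IsCommutativeRing isCommutativeRing using (+-identityˡ; +-identityʳ; *-identityˡ; zeroˡ; zeroʳ; -‿inverseʳ)
  open IntegerSolver isCommutativeRing
  open RingIdentities isCommutativeRing using (x-y≡0⇒x≡y; x≡y⇒x-y≡0) public

  x*y≡0⇒y≡0 : ∀ {x y} → x ≢ 0# → x * y ≡ 0# → y ≡ 0#
  x*y≡0⇒y≡0 {x} {y} x≢0 xy≡0 = begin
    y                ≡⟨ sym (*-identityˡ y) ⟩
    1# * y           ≡⟨ cong (_* y) (sym (⁻¹-inverse x x≢0)) ⟩
    x * x ⁻¹ * y     ≡⟨ solve 3 (λ x x′ y → x :* x′ :* y := x′ :* (x :* y)) refl x (x ⁻¹) y ⟩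
    x ⁻¹ * (x * y)   ≡⟨ cong (x ⁻¹ *_) xy≡0 ⟩
    x ⁻¹ * 0#        ≡⟨ zeroʳ (x ⁻¹) ⟩
    0#               ∎
    where open ≡-Reasoning

  -- Linear functionals on Fᵐ

  infixl 6 _⊞_
  infixr 7 _⊛_
  _⊞_ : ∀ {m} → Vec F m → Vec F m → Vec F m
  _⊞_ = zipWith _+_

  _⊛_ : ∀ {m} → F → Vec F m → Vec F m
  s ⊛ c = Vec.map (s *_) c

  𝟎 : ∀ {m} → Vec F m
  𝟎 {m} = replicate m 0#

  ⊛𝟎⊞ : ∀ {m} s (c : Vec F m) → s ⊛ 𝟎 ⊞ c ≡ c
  ⊛𝟎⊞ s []      = refl
  ⊛𝟎⊞ s (x ∷ c) = cong₂ _∷_ (trans (cong (_+ x) (zeroʳ s)) (+-identityˡ x)) (⊛𝟎⊞ s c)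

  record Functional (m : ℕ) : Set where
    field
      app    : Vec F m → F
      linear : ∀ s c d → app (s ⊛ c ⊞ d) ≡ s * app c + app d

    app-𝟎 : app 𝟎 ≡ 0#
    app-𝟎 = begin
      app 𝟎                          ≡⟨ solve 1 (λ x → x := con ℤ.1ℤ :* x :+ x :- x) refl (app 𝟎) ⟩
      1# * app 𝟎 + app 𝟎 + - app 𝟎   ≡⟨ cong (_+ - app 𝟎) (sym (linear 1# 𝟎 𝟎)) ⟩
      app (1# ⊛ 𝟎 ⊞ 𝟎) + - app 𝟎     ≡⟨ cong (λ c → app c + - app 𝟎) (⊛𝟎⊞ 1# 𝟎) ⟩
      app 𝟎 + - app 𝟎                ≡⟨ -‿inverseʳ (app 𝟎) ⟩
      0#                             ∎
      where open ≡-Reasoning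

  open Functional

  tailF : ∀ {m} → Functional (suc m) → Functional m
  tailF ℓ .app c = app ℓ (0# ∷ c)
  tailF ℓ .linear s c d = trans
    (cong (λ z → app ℓ (z ∷ (s ⊛ c ⊞ d))) (sym (trans (cong (_+ 0#) (zeroʳ s)) (+-identityˡ 0#))))
    (linear ℓ s (0# ∷ c) (0# ∷ d))

  head-coeff : ∀ {m} → Functional (suc m) → F
  head-coeff ℓ = app ℓ (1# ∷ 𝟎)

  app-∷ : ∀ {m} (ℓ : Functional (suc m)) x c → app ℓ (x ∷ c) ≡ x * head-coeff ℓ + app (tailF ℓ) c
  app-∷ ℓ x c = trans
    (cong (app ℓ) (cong₂ _∷_ (solve 1 (λ x → x := x :* con ℤ.1ℤ :+ con ℤ.0ℤ) refl x) (sym (⊛𝟎⊞ x c))))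
    (linear ℓ x (1# ∷ 𝟎) (0# ∷ c))

  nonzero-or-zero : ∀ {m} (ℓ : Functional m) → (∃[ d ] app ℓ d ≢ 0#) ⊎ (∀ c → app ℓ c ≡ 0#)
  nonzero-or-zero {zero}  ℓ = inj₂ λ { [] → app-𝟎 ℓ }
  nonzero-or-zero {suc m} ℓ with head-coeff ℓ ≟ 0#
  ... | no  h≢0 = inj₁ (1# ∷ 𝟎 , h≢0)
  ... | yes h≡0 with nonzero-or-zero (tailF ℓ)
  ...   | inj₁ (d , ℓd≢0) = inj₁ (0# ∷ d , ℓd≢0)
  ...   | inj₂ ℓ≡0 = inj₂ λ { (x ∷ c) → trans (app-∷ ℓ x c)
            (trans (cong₂ _+_ (trans (cong (x *_) h≡0) (zeroʳ x)) (ℓ≡0 c)) (+-identityʳ 0#)) }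

  -- The kernel is presented through an injective linear map from Fᵐ, so that restricted functionals
  -- are again functionals on a coordinate space and an induction on the dimension can continue. For
  -- a zero functional any hyperplane will do.
  record Hyperplane {m} (ℓ : Functional (suc m)) : Set where
    field
      embed           : Vec F m → Vec F (suc m)
      embed-linear    : ∀ s c d → embed (s ⊛ c ⊞ d) ≡ s ⊛ embed c ⊞ embed d
      embed-kernel    : ∀ c → app ℓ (embed c) ≡ 0#
      embed-injective : ∀ c → embed c ≡ 𝟎 → c ≡ 𝟎

    restrict : Functional (suc m) → Functional m
    restrict f .app c = app f (embed c)
    restrict f .linear s c d = trans (cong (app f) (embed-linear s c d)) (linear f s (embed c) (embed d))

  open Hyperplane

  -- If the first coefficient is invertible, the first coordinate is solved for in terms of the
  -- others; if it is 0, that coordinate is free and the tail is treated recursively.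
  hyperplane : ∀ {m} (ℓ : Functional (suc m)) → Hyperplane ℓ
  hyperplane {m} ℓ with head-coeff ℓ ≟ 0#
  hyperplane {m} ℓ | no h≢0 = record
    { embed           = λ c → g c ∷ c
    ; embed-linear    = λ s c d → cong (_∷ (s ⊛ c ⊞ d)) (trans (cong (λ z → - (h ⁻¹) * z) (linear (tailF ℓ) s c d))
        (solve 4 (λ k s x y → (:- k) :* (s :* x :+ y) := s :* ((:- k) :* x) :+ (:- k) :* y) refl (h ⁻¹) s (app (tailF ℓ) c) (app (tailF ℓ) d)))
    ; embed-kernel    = λ c → begin
        app ℓ (g c ∷ c)                                                  ≡⟨ app-∷ ℓ (g c) c ⟩
        g c * h + app (tailF ℓ) c                                        ≡⟨ solve 3 (λ k x h → (:- k) :* x :* h :+ x := x :- (h :* k) :* x) refl (h ⁻¹) (app (tailF ℓ) c) h ⟩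
        app (tailF ℓ) c + - (h * h ⁻¹ * app (tailF ℓ) c)                 ≡⟨ cong (λ z → app (tailF ℓ) c + - (z * app (tailF ℓ) c)) (⁻¹-inverse h h≢0) ⟩
        app (tailF ℓ) c + - (1# * app (tailF ℓ) c)                       ≡⟨ solve 1 (λ x → x :- con ℤ.1ℤ :* x := con ℤ.0ℤ) refl (app (tailF ℓ) c) ⟩
        0#                                                               ∎
    ; embed-injective = λ c e → cong Vec.tail e
    }
    where
    open ≡-Reasoning
    h = head-coeff ℓ
    g : Vec F m → F
    g c = - (h ⁻¹) * app (tailF ℓ) c
  hyperplane {zero} ℓ | yes h≡0 = record
    { embed           = λ _ → 𝟎
    ; embed-linear    = λ s _ _ → sym (⊛𝟎⊞ s 𝟎)
    ; embed-kernel    = λ _ → app-𝟎 ℓ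
    ; embed-injective = λ { [] _ → refl }
    }
  hyperplane {suc m} ℓ | yes h≡0 = record
    { embed           = λ { (x ∷ c) → x ∷ embed H c }
    ; embed-linear    = λ { s (x ∷ c) (y ∷ d) → cong (s * x + y ∷_) (embed-linear H s c d) }
    ; embed-kernel    = λ { (x ∷ c) → trans (app-∷ ℓ x (embed H c))
        (trans (cong₂ _+_ (trans (cong (x *_) h≡0) (zeroʳ x)) (embed-kernel H c)) (+-identityʳ 0#)) }
    ; embed-injective = λ { (x ∷ c) e → cong₂ _∷_ (cong Vec.head e) (embed-injective H c (cong Vec.tail e)) }
    }
    where H = hyperplane (tailF ℓ)

  -- The Witt index of the elliptic form

  -- The hyperbolic part of the quadratic form pulled back to a space of coefficients: each
  -- coordinate of a linear combination is a functional of its coefficient vector.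
  hypF : ∀ {m k} → Vec (Functional m × Functional m) k → Vec F m → F
  hypF []            c = 0#
  hypF ((f , g) ∷ L) c = app f c * app g c + hypF L c

  Vanish : ∀ {m k} → Vec (Functional m × Functional m) k → Vec F m → Set
  Vanish []            c = ⊤
  Vanish ((f , g) ∷ L) c = app f c ≡ 0# × app g c ≡ 0# × Vanish L c

  module _ {m} {ℓ : Functional (suc m)} (H : Hyperplane ℓ) where

    restrict-all : ∀ {k} → Vec (Functional (suc m) × Functional (suc m)) k → Vec (Functional m × Functional m) k
    restrict-all = Vec.map (λ fg → restrict H (proj₁ fg) , restrict H (proj₂ fg))

    hypF-restrict : ∀ {k} (L : Vec (Functional (suc m) × Functional (suc m)) k) c → hypF (restrict-all L) c ≡ hypF L (embed H c)
    hypF-restrict []      c = refl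
    hypF-restrict (_ ∷ L) c = cong (_ +_) (hypF-restrict L c)

    Vanish-restrict : ∀ {k} (L : Vec (Functional (suc m) × Functional (suc m)) k) c → Vanish (restrict-all L) c → Vanish L (embed H c)
    Vanish-restrict []      c v             = tt
    Vanish-restrict (_ ∷ L) c (f0 , g0 , v) = f0 , g0 , Vanish-restrict L c v

  app-shift : ∀ {m} (f : Functional m) {c} d → app f c ≡ 0# → app f (1# ⊛ c ⊞ d) ≡ app f d
  app-shift f {c} d e = trans (linear f 1# c d) (trans (cong (λ z → 1# * z + app f d) e)
    (solve 1 (λ x → con ℤ.1ℤ :* con ℤ.0ℤ :+ x := x) refl (app f d)))

  hypF-shift : ∀ {m k} (L : Vec (Functional m × Functional m) k) {c} d → Vanish L c → hypF L (1# ⊛ c ⊞ d) ≡ hypF L d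
  hypF-shift []            d v             = refl
  hypF-shift ((f , g) ∷ L) d (f0 , g0 , v) = cong₂ _+_ (cong₂ _*_ (app-shift f d f0) (app-shift g d g0)) (hypF-shift L d v)

  module _ (a b : F) (aniso : Anisotropic K a b) where

    private
      N : F → F → F
      N u w = a * u * u + u * w + b * w * w

    -- A form made of k hyperbolic pairs and one anisotropic pair has Witt index k, so k + 1 vectors
    -- spanning a totally singular subspace are dependent; `c` holds the coefficients of the
    -- dependency. The induction passes to the kernel of `f`, or of `g` when `f` is zero, losing one
    -- dimension and one hyperbolic pair. Anisotropy settles k = 0.
    totally-singular⇒dependent : ∀ {k} (L : Vec (Functional (suc k) × Functional (suc k)) k) (u w : Functional (suc k)) →
      (∀ c → hypF L c + N (app u c) (app w c) ≡ 0#) →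
      ∃[ c ] (c ≢ 𝟎 × Vanish L c × app u c ≡ 0# × app w c ≡ 0#)
    totally-singular⇒dependent [] u w sing =
      𝟙⃗ , (λ e → 0≢1 (sym (cong Vec.head e))) , tt , aniso _ _ (trans (sym (+-identityˡ _)) (sing 𝟙⃗))
      where 𝟙⃗ = 1# ∷ []
    totally-singular⇒dependent {suc k} ((f , g) ∷ L) u w sing = [ nonzero , allzero ]′ (nonzero-or-zero f)
      where
      rest : Vec F (suc (suc k)) → F
      rest c = hypF L c + N (app u c) (app w c)

      split : ∀ c → app f c * app g c + rest c ≡ 0#
      split c = trans (solve 3 (λ x y z → x :+ (y :+ z) := x :+ y :+ z) refl (app f c * app g c) (hypF L c) (N (app u c) (app w c))) (sing c)

      Claim = ∃[ c ] (c ≢ 𝟎 × Vanish ((f , g) ∷ L) c × app u c ≡ 0# × app w c ≡ 0#)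

      descend : ∀ {ℓ} (H : Hyperplane ℓ) → (∀ c → app f (embed H c) * app g (embed H c) ≡ 0#) →
        ∃[ c ] (embed H c ≢ 𝟎 × Vanish L (embed H c) × app u (embed H c) ≡ 0# × app w (embed H c) ≡ 0#)
      descend H fg≡0 = lift (totally-singular⇒dependent (restrict-all H L) (restrict H u) (restrict H w)
        (λ c → trans (cong (_+ _) (hypF-restrict H L c)) (trans (sym (+-identityˡ _)) (trans (cong (_+ rest (embed H c)) (sym (fg≡0 c))) (split (embed H c))))))
        where
        lift : ∃[ c ] (c ≢ 𝟎 × Vanish (restrict-all H L) c × app (restrict H u) c ≡ 0# × app (restrict H w) c ≡ 0#) → _
        lift (c , c≢0 , v , u0 , w0) = c , (λ e → c≢0 (embed-injective H c e)) , Vanish-restrict H L c v , u0 , w0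

      -- Every coordinate but g vanishes at e, so singularity at d and at e + d gives f(d) g(e) = 0.
      nonzero : ∃[ d ] app f d ≢ 0# → Claim
      nonzero (d , fd≢0) = finish (descend H (λ c → trans (cong (_* app g (embed H c)) (embed-kernel H c)) (zeroˡ _)))
        where
        H = hyperplane f
        finish : ∃[ c ] (embed H c ≢ 𝟎 × Vanish L (embed H c) × app u (embed H c) ≡ 0# × app w (embed H c) ≡ 0#) → Claim
        finish (c , e≢0 , v , u0 , w0) = e , e≢0 , (embed-kernel H c , x*y≡0⇒y≡0 fd≢0 fd*ge≡0 , v) , u0 , w0
          where
          e = embed H c
          open ≡-Reasoning
          fd*ge≡0 : app f d * app g e ≡ 0#
          fd*ge≡0 = begin
            app f d * app g e
              ≡⟨ solve 4 (λ x y z r → x :* y := x :* (con ℤ.1ℤ :* y :+ z) :+ r :- (x :* z :+ r)) refl (app f d) (app g e) (app g d) (rest d) ⟩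
            app f d * (1# * app g e + app g d) + rest d + - (app f d * app g d + rest d)
              ≡⟨ cong₂ (λ x y → x + - y)
                   (cong₂ _+_ (cong₂ _*_ (sym (app-shift f d (embed-kernel H c))) (sym (linear g 1# e d)))
                     (sym (cong₂ _+_ (hypF-shift L d v) (cong₂ N (app-shift u d u0) (app-shift w d w0)))))
                   (split d) ⟩
            app f (1# ⊛ e ⊞ d) * app g (1# ⊛ e ⊞ d) + rest (1# ⊛ e ⊞ d) + - 0#
              ≡⟨ cong (_+ - 0#) (split (1# ⊛ e ⊞ d)) ⟩
            0# + - 0#
              ≡⟨ -‿inverseʳ 0# ⟩
            0# ∎

      allzero : (∀ c → app f c ≡ 0#) → Claim
      allzero f≡0 = finish (descend H (λ c → trans (cong (_* app g (embed H c)) (f≡0 (embed H c))) (zeroˡ _)))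
        where
        H = hyperplane g
        finish : ∃[ c ] (embed H c ≢ 𝟎 × Vanish L (embed H c) × app u (embed H c) ≡ 0# × app w (embed H c) ≡ 0#) → Claim
        finish (c , e≢0 , v , u0 , w0) = embed H c , e≢0 , (f≡0 (embed H c) , embed-kernel H c , v) , u0 , w0

-- Reading Boolean tests as propositions

does-sound : ∀ {P : Set} (p? : Dec P) → does p? ≡ true → P
does-sound (yes p) _ = p

∧-true : ∀ b {c} → b ∧ c ≡ true → b ≡ true × c ≡ true
∧-true true e = refl , e

not-does-sound : ∀ {P : Set} (p? : Dec P) → not (does p?) ≡ true → ¬ P
not-does-sound (no ¬p) _ = ¬p

any-sound : ∀ {A : Set} (f : A → Bool) L → any f L ≡ true → ∃[ x ] (x ∈ L × f x ≡ true)
any-sound f (x ∷ L) e with f x in fx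
... | true  = x , here refl , fx
... | false with any-sound f L e
...   | y , y∈L , fy = y , there y∈L , fy

any-complete : ∀ {A : Set} (f : A → Bool) {L x} → x ∈ L → f x ≡ true → any f L ≡ true
any-complete f (here refl) fx rewrite fx = refl
any-complete f {y ∷ L} (there x∈L) fx with f y
... | true  = refl
... | false = any-complete f x∈L fx

-- The quadratic form and its polar form in coordinates

module Form (K : FiniteField) (n : ℕ) (a b : FiniteField.F K) (p : Pt K n) where
  open FiniteField K
  open IsCommutativeRing isCommutativeRing using (+-identityˡ; zeroʳ; +-comm)
  open IntegerSolver isCommutativeRing
  open Scheme K n a b p

  private
    hypB : ∀ {k} → Vec (F × F) k → Vec (F × F) k → F
    hypB []            []              = 0#
    hypB ((x , y) ∷ v) ((x′ , y′) ∷ v′) = x * y′ + x′ * y + hypB v v′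

    -- The polar form written out, which makes the bilinearity of `B` a polynomial identity. There
    -- is no division by 2, so even characteristic needs no separate treatment.
    β : Pt K n → Pt K n → F
    β (v , (u , w)) (v′ , (u′ , w′)) =
      hypB v v′ + (a * u * u′ + a * u′ * u + (u * w′ + u′ * w) + (b * w * w′ + b * w′ * w))

    -- The pattern-matching lambdas inside `_⊕_` and `_·_` have no name and cannot be restated, so
    -- they enter as variables `f` and `g` together with their defining equations.
    module _ (f : F × F → F × F → F × F) (f-+ : ∀ x y x′ y′ → f (x , y) (x′ , y′) ≡ (x + x′ , y + y′)) where

      hyp-zipWith : ∀ {k} (v v′ : Vec (F × F) k) → hyp (zipWith f v v′) ≡ hyp v + hyp v′ + hypB v v′
      hyp-zipWith []            []              = solve 0 (con ℤ.0ℤ := con ℤ.0ℤ :+ con ℤ.0ℤ :+ con ℤ.0ℤ) refl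
      hyp-zipWith ((x , y) ∷ v) ((x′ , y′) ∷ v′) rewrite f-+ x y x′ y′ | hyp-zipWith v v′ =
        solve 7 (λ x y x′ y′ h h′ b → (x :+ x′) :* (y :+ y′) :+ (h :+ h′ :+ b)
                   := x :* y :+ h :+ (x′ :* y′ :+ h′) :+ (x :* y′ :+ x′ :* y :+ b))
          refl x y x′ y′ (hyp v) (hyp v′) (hypB v v′)

      hypB-zipWith : ∀ {k} (v v′ w : Vec (F × F) k) → hypB (zipWith f v v′) w ≡ hypB v w + hypB v′ w
      hypB-zipWith []            []              []              = solve 0 (con ℤ.0ℤ := con ℤ.0ℤ :+ con ℤ.0ℤ) refl
      hypB-zipWith ((x , y) ∷ v) ((x′ , y′) ∷ v′) ((z , t) ∷ w) rewrite f-+ x y x′ y′ | hypB-zipWith v v′ w =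
        solve 8 (λ x y x′ y′ z t c d → (x :+ x′) :* t :+ z :* (y :+ y′) :+ (c :+ d)
                   := x :* t :+ z :* y :+ c :+ (x′ :* t :+ z :* y′ :+ d))
          refl x y x′ y′ z t (hypB v w) (hypB v′ w)

    module _ (s : F) (g : F × F → F × F) (g-* : ∀ x y → g (x , y) ≡ (s * x , s * y)) where

      hyp-map : ∀ {k} (v : Vec (F × F) k) → hyp (Vec.map g v) ≡ s * s * hyp v
      hyp-map []            = sym (zeroʳ (s * s))
      hyp-map ((x , y) ∷ v) rewrite g-* x y | hyp-map v =
        solve 4 (λ s x y h → s :* x :* (s :* y) :+ s :* s :* h := s :* s :* (x :* y :+ h)) refl s x y (hyp v)

      hypB-map : ∀ {k} (v w : Vec (F × F) k) → hypB (Vec.map g v) w ≡ s * hypB v w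
      hypB-map []            []            = sym (zeroʳ s)
      hypB-map ((x , y) ∷ v) ((z , t) ∷ w) rewrite g-* x y | hypB-map v w =
        solve 6 (λ s x y z t h → s :* x :* t :+ z :* (s :* y) :+ s :* h := s :* (x :* t :+ z :* y :+ h)) refl s x y z t (hypB v w)

    hypB-comm : ∀ {k} (v w : Vec (F × F) k) → hypB v w ≡ hypB w v
    hypB-comm []            []            = refl
    hypB-comm ((x , y) ∷ v) ((z , t) ∷ w) = cong₂ _+_ (+-comm (x * t) (z * y)) (hypB-comm v w)

    hypB-self : ∀ {k} (v : Vec (F × F) k) → hypB v v ≡ hyp v + hyp v
    hypB-self []            = sym (+-identityˡ 0#)
    hypB-self ((x , y) ∷ v) rewrite hypB-self v =
      solve 3 (λ x y h → x :* y :+ x :* y :+ (h :+ h) := x :* y :+ h :+ (x :* y :+ h)) refl x y (hyp v)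

    Q-⊕ : ∀ x y → Q (x ⊕ y) ≡ Q x + Q y + β x y
    Q-⊕ (v , (u , w)) (v′ , (u′ , w′)) = trans
      (cong (_+ (a * (u + u′) * (u + u′) + (u + u′) * (w + w′) + b * (w + w′) * (w + w′))) (hyp-zipWith _ (λ _ _ _ _ → refl) v v′))
      (solve 9 (λ a b u w u′ w′ h h′ c →
         h :+ h′ :+ c :+ (a :* (u :+ u′) :* (u :+ u′) :+ (u :+ u′) :* (w :+ w′) :+ b :* (w :+ w′) :* (w :+ w′))
         := h :+ (a :* u :* u :+ u :* w :+ b :* w :* w) :+ (h′ :+ (a :* u′ :* u′ :+ u′ :* w′ :+ b :* w′ :* w′))
            :+ (c :+ (a :* u :* u′ :+ a :* u′ :* u :+ (u :* w′ :+ u′ :* w) :+ (b :* w :* w′ :+ b :* w′ :* w))))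
        refl a b u w u′ w′ (hyp v) (hyp v′) (hypB v v′))

    Q-· : ∀ s x → Q (s · x) ≡ s * s * Q x
    Q-· s (v , (u , w)) = trans
      (cong (_+ (a * (s * u) * (s * u) + s * u * (s * w) + b * (s * w) * (s * w))) (hyp-map s _ (λ _ _ → refl) v))
      (solve 6 (λ a b u w s h → s :* s :* h :+ (a :* (s :* u) :* (s :* u) :+ s :* u :* (s :* w) :+ b :* (s :* w) :* (s :* w))
         := s :* s :* (h :+ (a :* u :* u :+ u :* w :+ b :* w :* w))) refl a b u w s (hyp v))

    β-⊕ : ∀ x y z → β (x ⊕ y) z ≡ β x z + β y z
    β-⊕ (v , (u , w)) (v′ , (u′ , w′)) (v″ , (c , d)) = trans
      (cong (_+ (a * (u + u′) * c + a * c * (u + u′) + ((u + u′) * d + c * (w + w′)) + (b * (w + w′) * d + b * d * (w + w′))))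
        (hypB-zipWith _ (λ _ _ _ _ → refl) v v′ v″))
      (solve 10 (λ a b u w u′ w′ c d h h′ →
        h :+ h′ :+ (a :* (u :+ u′) :* c :+ a :* c :* (u :+ u′) :+ ((u :+ u′) :* d :+ c :* (w :+ w′)) :+ (b :* (w :+ w′) :* d :+ b :* d :* (w :+ w′)))
        := h :+ (a :* u :* c :+ a :* c :* u :+ (u :* d :+ c :* w) :+ (b :* w :* d :+ b :* d :* w))
           :+ (h′ :+ (a :* u′ :* c :+ a :* c :* u′ :+ (u′ :* d :+ c :* w′) :+ (b :* w′ :* d :+ b :* d :* w′))))
        refl a b u w u′ w′ c d (hypB v v″) (hypB v′ v″))

    β-· : ∀ s x z → β (s · x) z ≡ s * β x z
    β-· s (v , (u , w)) (v″ , (c , d)) = trans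
      (cong (_+ (a * (s * u) * c + a * c * (s * u) + (s * u * d + c * (s * w)) + (b * (s * w) * d + b * d * (s * w))))
        (hypB-map s _ (λ _ _ → refl) v v″))
      (solve 8 (λ a b u w c d s h →
        s :* h :+ (a :* (s :* u) :* c :+ a :* c :* (s :* u) :+ (s :* u :* d :+ c :* (s :* w)) :+ (b :* (s :* w) :* d :+ b :* d :* (s :* w)))
        := s :* (h :+ (a :* u :* c :+ a :* c :* u :+ (u :* d :+ c :* w) :+ (b :* w :* d :+ b :* d :* w))))
        refl a b u w c d s (hypB v v″))

    β-comm : ∀ x y → β x y ≡ β y x
    β-comm (v , (u , w)) (v′ , (u′ , w′)) = cong₂ _+_ (hypB-comm v v′)
      (cong₂ _+_ (cong₂ _+_ (+-comm _ _) (+-comm _ _)) (+-comm _ _))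

    β-self : ∀ x → β x x ≡ Q x + Q x
    β-self (v , (u , w)) = trans (cong (_+ _) (hypB-self v))
      (solve 5 (λ a b u w h → h :+ h :+ (a :* u :* u :+ a :* u :* u :+ (u :* w :+ u :* w) :+ (b :* w :* w :+ b :* w :* w))
        := h :+ (a :* u :* u :+ u :* w :+ b :* w :* w) :+ (h :+ (a :* u :* u :+ u :* w :+ b :* w :* w))) refl a b u w (hyp v))

    B≡β : ∀ x y → B x y ≡ β x y
    B≡β x y = trans (cong (λ z → z + - Q x + - Q y) (Q-⊕ x y))
      (solve 3 (λ x y b → x :+ y :+ b :- x :- y := b) refl (Q x) (Q y) (β x y))

  B-comm : ∀ x y → B x y ≡ B y x
  B-comm x y = trans (B≡β x y) (trans (β-comm x y) (sym (B≡β y x)))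

  B-self : ∀ x → B x x ≡ Q x + Q x
  B-self x = trans (B≡β x x) (β-self x)

  B-lc : ∀ r x s y z → B (r · x ⊕ s · y) z ≡ r * B x z + s * B y z
  B-lc r x s y z = trans (B≡β (r · x ⊕ s · y) z) (trans (β-⊕ (r · x) (s · y) z)
    (cong₂ _+_ (trans (β-· r x z) (cong (r *_) (sym (B≡β x z)))) (trans (β-· s y z) (cong (s *_) (sym (B≡β y z))))))

  Q-lc : ∀ r x s y → Q (r · x ⊕ s · y) ≡ r * r * Q x + s * s * Q y + r * s * B x y
  Q-lc r x s y = trans (Q-⊕ (r · x) (s · y)) (cong₂ _+_ (cong₂ _+_ (Q-· r x) (Q-· s y)) (begin
    β (r · x) (s · y)     ≡⟨ β-· r x (s · y) ⟩
    r * β x (s · y)       ≡⟨ cong (r *_) (trans (β-comm x (s · y)) (trans (β-· s y x) (cong (s *_) (trans (β-comm y x) (sym (B≡β x y)))))) ⟩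
    r * (s * B x y)       ≡⟨ solve 3 (λ r s b → r :* (s :* b) := r :* s :* b) refl r s (B x y) ⟩
    r * s * B x y         ∎))
    where open ≡-Reasoning

  -- Labels for the 2n coordinates. An equality of points is reduced to its coordinates by
  -- `coord-ext` and `coord-lc`, where it becomes a field identity within reach of the solver.
  Index : Set
  Index = (Fin (n ∸ 1) × Bool) ⊎ Bool

  coord : Index → Pt K n → F
  coord (inj₁ (i , false)) (v , _)       = proj₁ (lookup v i)
  coord (inj₁ (i , true))  (v , _)       = proj₂ (lookup v i)
  coord (inj₂ false)       (_ , (u , w)) = u
  coord (inj₂ true)        (_ , (u , w)) = w

  private
    lookup-lc : ∀ {k} r s (f : F × F → F × F → F × F) (g h : F × F → F × F) →
      (∀ c d → f (g c) (h d) ≡ (r * proj₁ c + s * proj₁ d , r * proj₂ c + s * proj₂ d)) →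
      (v v′ : Vec (F × F) k) (i : Fin k) → lookup (zipWith f (Vec.map g v) (Vec.map h v′)) i
        ≡ (r * proj₁ (lookup v i) + s * proj₁ (lookup v′ i) , r * proj₂ (lookup v i) + s * proj₂ (lookup v′ i))
    lookup-lc r s f g h e v v′ i = trans (lookup-zipWith f i (Vec.map g v) (Vec.map h v′))
      (trans (cong₂ f (lookup-map i g v) (lookup-map i h v′)) (e (lookup v i) (lookup v′ i)))

  coord-lc : ∀ i r x s y → coord i (r · x ⊕ s · y) ≡ r * coord i x + s * coord i y
  coord-lc (inj₁ (i , false)) r (v , _) s (v′ , _) = cong proj₁ (lookup-lc r s _ _ _ (λ _ _ → refl) v v′ i)
  coord-lc (inj₁ (i , true))  r (v , _) s (v′ , _) = cong proj₂ (lookup-lc r s _ _ _ (λ _ _ → refl) v v′ i)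
  coord-lc (inj₂ false)       r x s y = refl
  coord-lc (inj₂ true)        r x s y = refl

  coord-ext : ∀ {x y} → (∀ i → coord i x ≡ coord i y) → x ≡ y
  coord-ext {v , _} {v′ , _} h = cong₂ _,_
    (Ext.Pointwise-≡⇒≡ (Ext.ext (λ i → cong₂ _,_ (h (inj₁ (i , false))) (h (inj₁ (i , true))))))
    (cong₂ _,_ (h (inj₂ false)) (h (inj₂ true)))

-- The four flags are x = y, x = y^σ, x ~ y and x ~ y^σ.
data AtMostOne : Bool → Bool → Bool → Bool → Set where
  first  : AtMostOne true  false false false
  second : AtMostOne false true  false false
  third  : AtMostOne false false true  false
  fourth : AtMostOne false false false true
  none   : AtMostOne false false false false

atMostOne : ∀ e s c d → (e ≡ true → s ≡ true → ⊥) → (e ≡ true → c ≡ true → ⊥) → (e ≡ true → d ≡ true → ⊥) →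
  (s ≡ true → c ≡ true → ⊥) → (s ≡ true → d ≡ true → ⊥) → (c ≡ true → d ≡ true → ⊥) → AtMostOne e s c d
atMostOne true  true  c     d     es ec ed sc sd cd = ⊥-elim (es refl refl)
atMostOne true  false true  d     es ec ed sc sd cd = ⊥-elim (ec refl refl)
atMostOne true  false false true  es ec ed sc sd cd = ⊥-elim (ed refl refl)
atMostOne true  false false false es ec ed sc sd cd = first
atMostOne false true  true  d     es ec ed sc sd cd = ⊥-elim (sc refl refl)
atMostOne false true  false true  es ec ed sc sd cd = ⊥-elim (sd refl refl)
atMostOne false true  false false es ec ed sc sd cd = second
atMostOne false false true  true  es ec ed sc sd cd = ⊥-elim (cd refl refl)
atMostOne false false true  false es ec ed sc sd cd = third
atMostOne false false false true  es ec ed sc sd cd = fourth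
atMostOne false false false false es ec ed sc sd cd = none

𝟙-partition : ∀ {e s c d} → AtMostOne e s c d →
  𝟙 e ℚ.+ (𝟙 (not c ∧ d) ℚ.+ (𝟙 (not e ∧ not s ∧ not c ∧ not d) ℚ.+ (𝟙 (c ∧ not d) ℚ.+ 𝟙 s))) ≡ 1ℚ
𝟙-partition first  = refl
𝟙-partition second = refl
𝟙-partition third  = refl
𝟙-partition fourth = refl
𝟙-partition none   = refl

-- The involution σ and the partition of Ω × Ω

module Geometry (K : FiniteField) (n : ℕ) (a b : FiniteField.F K) (p : Pt K n)
  (Qp≢0 : Scheme.Q K n a b p p ≢ FiniteField.0# K) where
  open FiniteField K
  open IsCommutativeRing isCommutativeRing using (+-identityˡ; *-identityˡ; *-identityʳ; zeroʳ)
  open IntegerSolver isCommutativeRing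
  open FieldProperties K
  open Scheme K n a b p public
  open Form K n a b p public

  κ : F
  κ = Q p ⁻¹

  Qpκ≡1 : Q p * κ ≡ 1#
  Qpκ≡1 = ⁻¹-inverse (Q p) Qp≢0

  κ≢0 : κ ≢ 0#
  κ≢0 κ≡0 = 0≢1 (trans (sym (zeroʳ (Q p))) (trans (cong (Q p *_) (sym κ≡0)) Qpκ≡1))

  -- As a record type it determines `x`, so points can remain implicit arguments.
  record InΩ (x : Pt K n) : Set where
    constructor _,_
    field
      Q≡0  : Q x ≡ 0#
      Bp≡1 : B x p ≡ 1#

  inΩ-sound : ∀ x → inΩ x ≡ true → InΩ x
  inΩ-sound x e with ∧-true (does (Q x ≟ 0#)) e
  ... | e₁ , e₂ = does-sound (Q x ≟ 0#) e₁ , does-sound (B x p ≟ 1#) e₂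

  inΩ-complete : ∀ {x} → InΩ x → inΩ x ≡ true
  inΩ-complete {x} (e₁ , e₂) = cong₂ _∧_ (dec-true (Q x ≟ 0#) e₁) (dec-true (B x p ≟ 1#) e₂)

  ∈Ω⇒inΩ : ∀ {x} → x ∈ Ω → inΩ x ≡ true
  ∈Ω⇒inΩ {x} x∈Ω = proj₂ (∈-filter⁻ _ {v = x} {xs = allPts K n} x∈Ω)

  ∈Ω⇒InΩ : ∀ {x} → x ∈ Ω → InΩ x
  ∈Ω⇒InΩ x∈Ω = inΩ-sound _ (∈Ω⇒inΩ x∈Ω)

  B-self≡0 : ∀ {x} → InΩ x → B x x ≡ 0#
  B-self≡0 {x} (Qx≡0 , _) = trans (B-self x) (trans (cong₂ _+_ Qx≡0 Qx≡0) (+-identityˡ 0#))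

  -- The negative of the reflection y - (B(y,p)/Q(p)) p. The reflection sends B(y,p) = 1 to -1, and
  -- the sign restores the chosen representative.
  σ : Pt K n → Pt K n
  σ y = (- 1#) · y ⊕ κ · p

  B-σ : ∀ y {w} → InΩ w → B (σ y) w ≡ κ + - B y w
  B-σ y {w} (_ , Bwp≡1) = begin
    B (σ y) w                     ≡⟨ B-lc (- 1#) y κ p w ⟩
    (- 1#) * B y w + κ * B p w    ≡⟨ cong (λ z → (- 1#) * B y w + κ * z) (trans (B-comm p w) Bwp≡1) ⟩
    (- 1#) * B y w + κ * 1#       ≡⟨ solve 2 (λ k x → (:- con ℤ.1ℤ) :* x :+ k :* con ℤ.1ℤ := k :- x) refl κ (B y w) ⟩
    κ + - B y w                   ∎
    where open ≡-Reasoning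

  σ-InΩ : ∀ {y} → InΩ y → InΩ (σ y)
  σ-InΩ {y} (Qy≡0 , Byp≡1) = (begin
    Q (σ y)
      ≡⟨ Q-lc (- 1#) y κ p ⟩
    (- 1#) * (- 1#) * Q y + κ * κ * Q p + (- 1#) * κ * B y p
      ≡⟨ cong₂ (λ x z → (- 1#) * (- 1#) * x + κ * κ * Q p + (- 1#) * κ * z) Qy≡0 Byp≡1 ⟩
    (- 1#) * (- 1#) * 0# + κ * κ * Q p + (- 1#) * κ * 1#
      ≡⟨ solve 2 (λ k q → (:- con ℤ.1ℤ) :* (:- con ℤ.1ℤ) :* con ℤ.0ℤ :+ k :* k :* q :+ (:- con ℤ.1ℤ) :* k :* con ℤ.1ℤ
           := k :* (q :* k) :- k) refl κ (Q p) ⟩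
    κ * (Q p * κ) + - κ
      ≡⟨ cong (λ z → κ * z + - κ) Qpκ≡1 ⟩
    κ * 1# + - κ
      ≡⟨ solve 1 (λ k → k :* con ℤ.1ℤ :- k := con ℤ.0ℤ) refl κ ⟩
    0# ∎) , (begin
    B (σ y) p
      ≡⟨ B-lc (- 1#) y κ p p ⟩
    (- 1#) * B y p + κ * B p p
      ≡⟨ cong₂ (λ x z → (- 1#) * x + κ * z) Byp≡1 (B-self p) ⟩
    (- 1#) * 1# + κ * (Q p + Q p)
      ≡⟨ solve 2 (λ k q → (:- con ℤ.1ℤ) :* con ℤ.1ℤ :+ k :* (q :+ q) := (:- con ℤ.1ℤ) :+ q :* k :+ q :* k) refl κ (Q p) ⟩
    - 1# + Q p * κ + Q p * κ
      ≡⟨ cong (λ z → - 1# + z + z) Qpκ≡1 ⟩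
    - 1# + 1# + 1#
      ≡⟨ solve 0 ((:- con ℤ.1ℤ) :+ con ℤ.1ℤ :+ con ℤ.1ℤ := con ℤ.1ℤ) refl ⟩
    1# ∎)
    where open ≡-Reasoning

  B-σ-self : ∀ {y} → InΩ y → B (σ y) y ≡ κ
  B-σ-self {y} y∈ = trans (B-σ y y∈) (trans (cong (λ z → κ + - z) (B-self≡0 y∈))
    (solve 1 (λ k → k :- con ℤ.0ℤ := k) refl κ))

  σ≢ : ∀ {y} → InΩ y → σ y ≢ y
  σ≢ {y} y∈ σy≡y = κ≢0 (trans (sym (B-σ-self y∈)) (trans (cong (λ z → B z y) σy≡y) (B-self≡0 y∈)))

  σ-involutive : ∀ y → σ (σ y) ≡ y
  σ-involutive y = coord-ext λ i → trans (coord-lc i (- 1#) (σ y) κ p)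
    (trans (cong (λ z → (- 1#) * z + κ * coord i p) (coord-lc i (- 1#) y κ p))
      (solve 3 (λ k x z → (:- con ℤ.1ℤ) :* ((:- con ℤ.1ℤ) :* x :+ k :* z) :+ k :* z := x) refl κ (coord i y) (coord i p)))

  1·y⊕0·z≡y : ∀ y z → 1# · y ⊕ 0# · z ≡ y
  1·y⊕0·z≡y y z = coord-ext λ i → trans (coord-lc i 1# y 0# z)
    (solve 2 (λ x z → con ℤ.1ℤ :* x :+ con ℤ.0ℤ :* z := x) refl (coord i y) (coord i z))

  -- For z = ry + sp the two conditions read s(sQ(p) + r) = 0 and r + 2sQ(p) = 1. Either s = 0 and
  -- then r = 1, which is y itself, or subtracting sQ(p) + r = 0 from the second gives sQ(p) = 1 and
  -- r = -1, in any characteristic.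
  pole-line : ∀ {y} → InΩ y → ∀ r s → InΩ (r · y ⊕ s · p) → r · y ⊕ s · p ≢ y → r · y ⊕ s · p ≡ σ y
  pole-line {y} (Qy≡0 , Byp≡1) r s (Qz≡0 , Bzp≡1) z≢y with s ≟ 0#
  ... | yes s≡0 = ⊥-elim (z≢y (trans (cong₂ (λ r s → r · y ⊕ s · p) r≡1 s≡0) (1·y⊕0·z≡y y p)))
    where
    open ≡-Reasoning
    r≡1 : r ≡ 1#
    r≡1 = begin
      r                         ≡⟨ solve 2 (λ r b → r := r :* con ℤ.1ℤ :+ con ℤ.0ℤ :* b) refl r (B p p) ⟩
      r * 1# + 0# * B p p       ≡⟨ cong₂ (λ z s → r * z + s * B p p) (sym Byp≡1) (sym s≡0) ⟩
      r * B y p + s * B p p     ≡⟨ sym (B-lc r y s p p) ⟩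
      B (r · y ⊕ s · p) p       ≡⟨ Bzp≡1 ⟩
      1#                        ∎
  ... | no s≢0 = cong₂ (λ r s → r · y ⊕ s · p) r≡-1 s≡κ
    where
    open ≡-Reasoning
    sQp+r≡0 : s * Q p + r ≡ 0#
    sQp+r≡0 = x*y≡0⇒y≡0 s≢0 (begin
      s * (s * Q p + r)                               ≡⟨ solve 3 (λ r s q → s :* (s :* q :+ r) := r :* r :* con ℤ.0ℤ :+ s :* s :* q :+ r :* s :* con ℤ.1ℤ) refl r s (Q p) ⟩
      r * r * 0# + s * s * Q p + r * s * 1#           ≡⟨ cong₂ (λ x z → r * r * x + s * s * Q p + r * s * z) (sym Qy≡0) (sym Byp≡1) ⟩
      r * r * Q y + s * s * Q p + r * s * B y p       ≡⟨ sym (Q-lc r y s p) ⟩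
      Q (r · y ⊕ s · p)                               ≡⟨ Qz≡0 ⟩
      0#                                              ∎)
    sQp≡1 : s * Q p ≡ 1#
    sQp≡1 = begin
      s * Q p                                         ≡⟨ solve 3 (λ r s q → s :* q := r :* con ℤ.1ℤ :+ s :* (q :+ q) :- (s :* q :+ r)) refl r s (Q p) ⟩
      r * 1# + s * (Q p + Q p) + - (s * Q p + r)      ≡⟨ cong₂ (λ x z → r * x + s * z + - (s * Q p + r)) (sym Byp≡1) (sym (B-self p)) ⟩
      r * B y p + s * B p p + - (s * Q p + r)         ≡⟨ cong₂ (λ x z → x + - z) (trans (sym (B-lc r y s p p)) Bzp≡1) sQp+r≡0 ⟩
      1# + - 0#                                       ≡⟨ solve 0 (con ℤ.1ℤ :- con ℤ.0ℤ := con ℤ.1ℤ) refl ⟩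
      1#                                              ∎
    r≡-1 : r ≡ - 1#
    r≡-1 = begin
      r                          ≡⟨ solve 2 (λ r t → r := t :+ r :- t) refl r (s * Q p) ⟩
      s * Q p + r + - (s * Q p)  ≡⟨ cong₂ (λ x z → x + - z) sQp+r≡0 sQp≡1 ⟩
      0# + - 1#                  ≡⟨ +-identityˡ (- 1#) ⟩
      - 1#                       ∎
    s≡κ : s ≡ κ
    s≡κ = begin
      s                ≡⟨ sym (*-identityʳ s) ⟩
      s * 1#           ≡⟨ cong (s *_) (sym Qpκ≡1) ⟩
      s * (Q p * κ)    ≡⟨ solve 3 (λ s q k → s :* (q :* k) := s :* q :* k) refl s (Q p) κ ⟩
      s * Q p * κ      ≡⟨ cong (_* κ) sQp≡1 ⟩
      1# * κ           ≡⟨ *-identityˡ κ ⟩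
      κ                ∎

  sig-sound : ∀ {y} z → InΩ y → sig y z ≡ true → z ≡ σ y
  sig-sound {y} z y∈ e with ∧-true (inΩ z) e
  ... | z∈ , e′ with ∧-true (not (z ==P y)) e′
  ...   | z≢y , e″ with any-sound _ elems e″
  ...     | r , _ , er with any-sound _ elems er
  ...       | s , _ , es = trans z≡ (pole-line y∈ r s (subst InΩ z≡ (inΩ-sound z z∈))
                (λ w → not-does-sound (z ≟P y) z≢y (trans z≡ w)))
    where
    z≡ : z ≡ r · y ⊕ s · p
    z≡ = does-sound (z ≟P (r · y ⊕ s · p)) es

  sig-complete : ∀ {y} → InΩ y → sig y (σ y) ≡ true
  sig-complete {y} y∈ = cong₂ _∧_ (inΩ-complete (σ-InΩ y∈)) (cong₂ _∧_ (cong not (dec-false (σ y ≟P y) (σ≢ y∈)))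
    (any-complete _ (elems-complete (- 1#)) (any-complete _ (elems-complete κ) (dec-true (σ y ≟P σ y) refl))))

  sig≡ : ∀ {y} z → InΩ y → sig y z ≡ does (z ≟P σ y)
  sig≡ {y} z y∈ with z ≟P σ y
  ... | yes refl = sig-complete y∈
  ... | no  z≢   with sig y z in eq
  ...   | true  = ⊥-elim (z≢ (sig-sound z y∈ eq))
  ...   | false = refl

  col-sound : ∀ x y → col x y ≡ true → x ≢ y × B x y ≡ 0#
  col-sound x y e with ∧-true (not (x ==P y)) e
  ... | e₁ , e₂ = not-does-sound (x ≟P y) e₁ , does-sound (B x y ≟ 0#) e₂

  colσ-sound : ∀ x {y} → InΩ y → colσ x y ≡ true → col x (σ y) ≡ true
  colσ-sound x {y} y∈ e with any-sound _ (allPts K n) e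
  ... | z , _ , ez with ∧-true (sig y z) ez
  ...   | e₁ , e₂ = subst (λ z → col x z ≡ true) (sig-sound z y∈ e₁) e₂

  -- B(y,x) and B(σ(y),x) add up to κ ≠ 0, so they cannot both vanish.
  col-colσ-disjoint : ∀ {x y} → InΩ x → InΩ y → col y x ≡ true → colσ x y ≡ true → ⊥
  col-colσ-disjoint {x} {y} x∈ y∈ c d = κ≢0 (begin
    κ            ≡⟨ solve 1 (λ k → k := k :- con ℤ.0ℤ) refl κ ⟩
    κ + - 0#     ≡⟨ cong (λ z → κ + - z) (sym (proj₂ (col-sound y x c))) ⟩
    κ + - B y x  ≡⟨ sym (B-σ y x∈) ⟩
    B (σ y) x    ≡⟨ B-comm (σ y) x ⟩
    B x (σ y)    ≡⟨ proj₂ (col-sound x (σ y) (colσ-sound x y∈ d)) ⟩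
    0#           ∎)
    where open ≡-Reasoning

  -- A flag for y and a flag for σ(y) exclude each other because B(σ(y),y) = κ ≠ 0 and every point
  -- of Ω is perpendicular to itself. The two exclusions of equality against collinearity are built
  -- into `col`.
  relations-exclusive : ∀ {x y} → InΩ x → InΩ y → AtMostOne (x ==P y) (sig y x) (col y x) (colσ x y)
  relations-exclusive {x} {y} x∈ y∈ = atMostOne (x ==P y) (sig y x) (col y x) (colσ x y)
    (λ e s → σ≢ y∈ (trans (sym (sig-sound x y∈ s)) (does-sound (x ≟P y) e)))
    (λ e c → proj₁ (col-sound y x c) (sym (does-sound (x ≟P y) e)))
    (λ e d → κ≢0 (trans (sym (B-σ-self y∈)) (trans (B-comm (σ y) y)
       (subst (λ w → B w (σ y) ≡ 0#) (does-sound (x ≟P y) e) (proj₂ (col-sound x (σ y) (colσ-sound x y∈ d)))))))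
    (λ s c → κ≢0 (trans (sym (B-σ-self y∈)) (trans (B-comm (σ y) y)
       (subst (λ w → B y w ≡ 0#) (sig-sound x y∈ s) (proj₂ (col-sound y x c))))))
    (λ s d → proj₁ (col-sound x (σ y) (colσ-sound x y∈ d)) (sig-sound x y∈ s))
    (col-colσ-disjoint x∈ y∈)

-- Sums of eigenvectors, valencies, and the cases where σ acts as -1

0≤𝟙 : ∀ b → 0ℚ ℚ.≤ 𝟙 b
0≤𝟙 b = subst (0ℚ ℚ.≤_) (𝟙-idem b) (0≤x*x (𝟙 b))

0≤x-y⇒y≤x : ∀ x y → 0ℚ ℚ.≤ x ℚ.- y → y ℚ.≤ x
0≤x-y⇒y≤x x y h = begin
  y               ≡⟨ sym (ℚₚ.+-identityˡ y) ⟩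
  0ℚ ℚ.+ y        ≤⟨ ℚₚ.+-monoˡ-≤ y h ⟩
  x ℚ.- y ℚ.+ y   ≡⟨ sym (Id.x≡x-y+y x y) ⟩
  x               ∎
  where open ℚₚ.≤-Reasoning

0≤1-𝟙 : ∀ b → 0ℚ ℚ.≤ 1ℚ ℚ.- 𝟙 b
0≤1-𝟙 true  = ℚₚ.≤-refl
0≤1-𝟙 false = 0≤𝟙 true

0≤x⇒0≤y⇒0≤x*y : ∀ {x y} → 0ℚ ℚ.≤ x → 0ℚ ℚ.≤ y → 0ℚ ℚ.≤ x ℚ.* y
0≤x⇒0≤y⇒0≤x*y {x} {y} 0≤x 0≤y = subst (ℚ._≤ x ℚ.* y) (ℚₚ.*-zeroʳ x) (ℚₚ.*-monoˡ-≤-nonNeg x 0≤y)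
  where instance _ = ℚ.nonNegative 0≤x

1≰0 : ¬ (1ℚ ℚ.≤ 0ℚ)
1≰0 (ℚ.*≤* (ℤ.+≤+ ()))

module Eigen (K : FiniteField) (2<q : 2 ℕ.< FiniteField.order K) (n : ℕ) (a b : FiniteField.F K) (p : Pt K n)
  (Qp≢0 : Scheme.Q K n a b p p ≢ FiniteField.0# K) where
  open FiniteField K using (order)
  open Geometry K n a b p Qp≢0

  A : Fin 5 → (Pt K n → ℚ) → Pt K n → ℚ
  A ℓ f y = ∑ Ω (λ x → 𝟙 (rel ℓ x y) ℚ.* f x)

  mulA≡A : ∀ ℓ f y → mulA ℓ f y ≡ A ℓ f y
  mulA≡A ℓ f y = trans (foldr≡∑ Ω _) (∑-cong Ω (λ {x} _ → if≡𝟙* (rel ℓ x y) (f x)))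

  A-eigen : ∀ i {v} → InV i v → ∀ ℓ {y} → InΩ y → A ℓ v y ≡ Pmat i ℓ ℚ.* v y
  A-eigen i {v} v∈ ℓ {y} y∈ = trans (sym (mulA≡A ℓ v y)) (v∈ ℓ y (inΩ-complete y∈))

  A-cong : ∀ ℓ {f g : Pt K n → ℚ} → (∀ {x} → InΩ x → f x ≡ g x) → ∀ y → A ℓ f y ≡ A ℓ g y
  A-cong ℓ h y = ∑-cong Ω (λ {x} x∈ → cong (𝟙 (rel ℓ x y) ℚ.*_) (h (∈Ω⇒InΩ x∈)))

  A-+ : ∀ ℓ (f g : Pt K n → ℚ) y → A ℓ (λ x → f x ℚ.+ g x) y ≡ A ℓ f y ℚ.+ A ℓ g y
  A-+ ℓ f g y = trans (∑-cong Ω (λ {x} _ → ℚₚ.*-distribˡ-+ (𝟙 (rel ℓ x y)) (f x) (g x))) (∑-+ Ω _ _)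

  ∑A≡∑ : ∀ (f : Pt K n → ℚ) {y} → InΩ y → A 0F f y ℚ.+ (A 1F f y ℚ.+ (A 2F f y ℚ.+ (A 3F f y ℚ.+ A 4F f y))) ≡ ∑ Ω f
  ∑A≡∑ f {y} y∈ = begin
    A 0F f y ℚ.+ (A 1F f y ℚ.+ (A 2F f y ℚ.+ (A 3F f y ℚ.+ A 4F f y)))
      ≡⟨ cong (λ z → A 0F f y ℚ.+ (A 1F f y ℚ.+ (A 2F f y ℚ.+ z))) (sym (∑-+ Ω (g 3F) (g 4F))) ⟩
    A 0F f y ℚ.+ (A 1F f y ℚ.+ (A 2F f y ℚ.+ ∑ Ω (λ x → g 3F x ℚ.+ g 4F x)))
      ≡⟨ cong (λ z → A 0F f y ℚ.+ (A 1F f y ℚ.+ z)) (sym (∑-+ Ω (g 2F) _)) ⟩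
    A 0F f y ℚ.+ (A 1F f y ℚ.+ ∑ Ω (λ x → g 2F x ℚ.+ (g 3F x ℚ.+ g 4F x)))
      ≡⟨ cong (A 0F f y ℚ.+_) (sym (∑-+ Ω (g 1F) _)) ⟩
    A 0F f y ℚ.+ ∑ Ω (λ x → g 1F x ℚ.+ (g 2F x ℚ.+ (g 3F x ℚ.+ g 4F x)))
      ≡⟨ sym (∑-+ Ω (g 0F) _) ⟩
    ∑ Ω (λ x → g 0F x ℚ.+ (g 1F x ℚ.+ (g 2F x ℚ.+ (g 3F x ℚ.+ g 4F x))))
      ≡⟨ ∑-cong Ω (λ {x} x∈ → trans
           (Id.factor₅ (𝟙 (rel 0F x y)) (𝟙 (rel 1F x y)) (𝟙 (rel 2F x y)) (𝟙 (rel 3F x y)) (𝟙 (rel 4F x y)) (f x))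
           (trans (cong (ℚ._* f x) (𝟙-partition (relations-exclusive (∈Ω⇒InΩ x∈) y∈))) (ℚₚ.*-identityˡ (f x)))) ⟩
    ∑ Ω f ∎
    where
    open ≡-Reasoning
    g : Fin 5 → Pt K n → ℚ
    g ℓ x = 𝟙 (rel ℓ x y) ℚ.* f x

  rowSum : Fin 5 → ℤ
  rowSum i = Pℤ i 0F ℤ.+ (Pℤ i 1F ℤ.+ (Pℤ i 2F ℤ.+ (Pℤ i 3F ℤ.+ Pℤ i 4F)))

  ι-rowSum : ∀ i → Pmat i 0F ℚ.+ (Pmat i 1F ℚ.+ (Pmat i 2F ℚ.+ (Pmat i 3F ℚ.+ Pmat i 4F))) ≡ ι (rowSum i)
  ι-rowSum i = sym (trans (ι-+ (P 0F) _) (cong (ι (P 0F) ℚ.+_) (trans (ι-+ (P 1F) _) (cong (ι (P 1F) ℚ.+_)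
    (trans (ι-+ (P 2F) _) (cong (ι (P 2F) ℚ.+_) (ι-+ (P 3F) (P 4F))))))))
    where
    P : Fin 5 → ℤ
    P = Pℤ i

  ∑-eigen : ∀ i {v} → InV i v → ∀ {y} → InΩ y → ∑ Ω v ≡ ι (rowSum i) ℚ.* v y
  ∑-eigen i {v} v∈ {y} y∈ = begin
    ∑ Ω v
      ≡⟨ sym (∑A≡∑ v y∈) ⟩
    A 0F v y ℚ.+ (A 1F v y ℚ.+ (A 2F v y ℚ.+ (A 3F v y ℚ.+ A 4F v y)))
      ≡⟨ cong₂ ℚ._+_ (A-eigen i v∈ 0F y∈) (cong₂ ℚ._+_ (A-eigen i v∈ 1F y∈) (cong₂ ℚ._+_ (A-eigen i v∈ 2F y∈)
           (cong₂ ℚ._+_ (A-eigen i v∈ 3F y∈) (A-eigen i v∈ 4F y∈)))) ⟩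
    Pmat i 0F ℚ.* v y ℚ.+ (Pmat i 1F ℚ.* v y ℚ.+ (Pmat i 2F ℚ.* v y ℚ.+ (Pmat i 3F ℚ.* v y ℚ.+ Pmat i 4F ℚ.* v y)))
      ≡⟨ Id.factor₅ (Pmat i 0F) (Pmat i 1F) (Pmat i 2F) (Pmat i 3F) (Pmat i 4F) (v y) ⟩
    (Pmat i 0F ℚ.+ (Pmat i 1F ℚ.+ (Pmat i 2F ℚ.+ (Pmat i 3F ℚ.+ Pmat i 4F)))) ℚ.* v y
      ≡⟨ cong (ℚ._* v y) (ι-rowSum i) ⟩
    ι (rowSum i) ℚ.* v y ∎
    where open ≡-Reasoning

  ∑-eigen-zero : ∀ i {v} → rowSum i ≡ ℤ.0ℤ → InV i v → ∀ {y} → InΩ y → ∑ Ω v ≡ 0ℚ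
  ∑-eigen-zero i {v} r≡0 v∈ {y} y∈ = trans (∑-eigen i v∈ y∈) (trans (cong (λ r → ι r ℚ.* v y) r≡0) (ℚₚ.*-zeroˡ (v y)))

  rowSum₁≡0 : rowSum 1F ≡ ℤ.0ℤ
  rowSum₁≡0 = Idℤ.rowSum₁ qn1

  rowSum₃≡0 : rowSum 3F ≡ ℤ.0ℤ
  rowSum₃≡0 = Idℤ.rowSum₃ qn2

  rowSum₄≡0 : rowSum 4F ≡ ℤ.0ℤ
  rowSum₄≡0 = Idℤ.rowSum₄ qn2 qm2

  private
    q≡2+k : ∃[ k ] order ≡ 2 ℕ.+ k
    q≡2+k = order ∸ 2 , sym (ℕₚ.m+[n∸m]≡n (ℕₚ.<⇒≤ 2<q))

    qm2≡ : qm2 ≡ ℤ.+ proj₁ q≡2+k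
    qm2≡ = trans (cong (λ m → ℤ.+ m ℤ.- ℤ.+ 2) (proj₂ q≡2+k)) refl

    qn2≡ : ∃[ α ] qn2 ≡ ℤ.1ℤ ℤ.+ ℤ.+ α
    qn2≡ = (order ℕ.^ (n ∸ 2)) ∸ 1 , cong (λ m → ℤ.+ m) (sym (ℕₚ.m+[n∸m]≡n (ℕₚ.m^n>0 order (n ∸ 2))))
      where instance _ = ℕ.>-nonZero (ℕₚ.≤-trans (ℕ.s≤s ℕ.z≤n) 2<q)

  -- Writing qⁿ⁻² as 1 + α and q - 2 as k with natural α and k turns the sum into 2 plus a natural
  -- number, and the absurd pattern then sees a successor.
  rowSum₀≢0 : rowSum 0F ≢ ℤ.0ℤ
  rowSum₀≢0 e with trans (sym (begin
    rowSum 0F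
      ≡⟨ cong₂ (λ x k → ℤ.1ℤ ℤ.+ ((x ℤ.- ℤ.1ℤ) ℤ.* (qn1 ℤ.+ ℤ.1ℤ) ℤ.+ (x ℤ.* k ℤ.* (qn1 ℤ.+ ℤ.1ℤ) ℤ.+ ((x ℤ.- ℤ.1ℤ) ℤ.* (qn1 ℤ.+ ℤ.1ℤ) ℤ.+ ℤ.1ℤ))))
           (proj₂ qn2≡) qm2≡ ⟩
    _
      ≡⟨ Idℤ.rowSum₀ (ℤ.+ α) (ℤ.+ k) qn1 ⟩
    ℤ.+ 2 ℤ.+ (ℤ.+ 2 ℤ.* ℤ.+ α ℤ.+ ℤ.+ suc α ℤ.* ℤ.+ k) ℤ.* ℤ.+ (qn ℕ.+ 1)
      ≡⟨ cong (λ z → ℤ.+ 2 ℤ.+ z ℤ.* ℤ.+ (qn ℕ.+ 1)) (cong₂ ℤ._+_ (sym (ℤₚ.pos-* 2 α)) (sym (ℤₚ.pos-* (suc α) k))) ⟩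
    ℤ.+ 2 ℤ.+ ℤ.+ (2 ℕ.* α ℕ.+ suc α ℕ.* k) ℤ.* ℤ.+ (qn ℕ.+ 1)
      ≡⟨ cong (λ z → ℤ.+ 2 ℤ.+ z) (sym (ℤₚ.pos-* (2 ℕ.* α ℕ.+ suc α ℕ.* k) (qn ℕ.+ 1))) ⟩
    ℤ.+ (2 ℕ.+ (2 ℕ.* α ℕ.+ suc α ℕ.* k) ℕ.* (qn ℕ.+ 1)) ∎)) e
    where
    open ≡-Reasoning
    α = proj₁ qn2≡
    k = proj₁ q≡2+k
    qn = order ℕ.^ (n ∸ 1)
  ... | ()

  -- Both values, multiplied by the same nonzero row sum, give the total ∑ u.
  V₀-constant : ∀ {u} → InV 0F u → ∀ {x y} → InΩ x → InΩ y → u x ≡ u y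
  V₀-constant {u} u∈ {x} {y} x∈ y∈ = *-cancelˡ (u x) (u y) (λ e → rowSum₀≢0 (ι-injective e))
    (trans (sym (∑-eigen 0F u∈ x∈)) (∑-eigen 0F u∈ y∈))

  ∑-V₀ : ∀ {u} → InV 0F u → ∀ {y} → InΩ y → ∑ Ω u ≡ ι (ℤ.+ cardΩ) ℚ.* u y
  ∑-V₀ {u} u∈ {y} y∈ = trans (∑-cong Ω (λ x∈ → V₀-constant u∈ (∈Ω⇒InΩ x∈) y∈)) (∑-const Ω (u y))

  -- A vector of V₀ is constant, so if it is nonzero its eigenvalue equations state the row sums of
  -- the adjacency matrices. This takes the place of counting points on the quadric.
  valency : ∀ {u} → InV 0F u → ∀ {y} → InΩ y → u y ≢ 0ℚ → ∀ ℓ → A ℓ (λ _ → 1ℚ) y ≡ Pmat 0F ℓ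
  valency {u} u∈ {y} y∈ uy≢0 ℓ = *-cancelˡ _ (Pmat 0F ℓ) uy≢0 (begin
    u y ℚ.* A ℓ (λ _ → 1ℚ) y                       ≡⟨ sym (∑-*ˡ Ω (u y) _) ⟩
    ∑ Ω (λ x → u y ℚ.* (𝟙 (rel ℓ x y) ℚ.* 1ℚ))     ≡⟨ ∑-cong Ω (λ {x} x∈ → trans (cong (u y ℚ.*_) (ℚₚ.*-identityʳ (𝟙 (rel ℓ x y))))
                                                        (trans (ℚₚ.*-comm (u y) (𝟙 (rel ℓ x y)))
                                                          (cong (𝟙 (rel ℓ x y) ℚ.*_) (V₀-constant u∈ y∈ (∈Ω⇒InΩ x∈))))) ⟩
    A ℓ u y                                        ≡⟨ A-eigen 0F u∈ ℓ y∈ ⟩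
    Pmat 0F ℓ ℚ.* u y                              ≡⟨ ℚₚ.*-comm (Pmat 0F ℓ) (u y) ⟩
    u y ℚ.* Pmat 0F ℓ                              ∎)
    where open ≡-Reasoning

  mean-half : ∀ θ {c} → c ℚ.+ c ≡ 1ℚ → ∑ Ω (χ θ) ≡ ι (ℤ.+ cardΩ) ℚ.* c → 2 ℕ.* card θ ≡ cardΩ
  mean-half θ {c} 2c≡1 e = ℤₚ.+-injective (ι-injective (begin
    ι (ℤ.+ (2 ℕ.* card θ))                      ≡⟨ cong (λ m → ι (ℤ.+ (card θ ℕ.+ m))) (ℕₚ.+-identityʳ (card θ)) ⟩
    ι (ℤ.+ card θ ℤ.+ ℤ.+ card θ)               ≡⟨ ι-+ (ℤ.+ card θ) (ℤ.+ card θ) ⟩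
    ι (ℤ.+ card θ) ℚ.+ ι (ℤ.+ card θ)           ≡⟨ cong (λ z → z ℚ.+ z) (trans (sym (∑-𝟙 θ Ω)) e) ⟩
    N ℚ.* c ℚ.+ N ℚ.* c                         ≡⟨ sym (ℚₚ.*-distribˡ-+ N c c) ⟩
    N ℚ.* (c ℚ.+ c)                             ≡⟨ cong (N ℚ.*_) 2c≡1 ⟩
    N ℚ.* 1ℚ                                    ≡⟨ ℚₚ.*-identityʳ N ⟩
    N                                           ∎))
    where
    open ≡-Reasoning
    N = ι (ℤ.+ cardΩ)

  -- u is a constant c, and A₄χ = 2c − χ takes values
  -- between 0 and the valency 1 of R₄, so nontriviality forces 2c = 1.
  half : ∀ θ → Nontrivial θ → ∀ u w → InV 0F u → (∀ {y} → InΩ y → A 4F w y ≡ ℚ.- w y) → ∑ Ω w ≡ 0ℚ →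
    (∀ {x} → InΩ x → χ θ x ≡ u x ℚ.+ w x) → 2 ℕ.* card θ ≡ cardΩ
  half θ ((y₁ , y₁∈′ , θy₁) , (y₀ , y₀∈′ , θy₀)) u w u∈ A₄w ∑w χ≡ = mean-half θ (ℚₚ.≤-antisym 2c≤1 1≤2c) (begin
      ∑ Ω (χ θ)                  ≡⟨ ∑-cong Ω (λ x∈ → χ≡ (∈Ω⇒InΩ x∈)) ⟩
      ∑ Ω (λ x → u x ℚ.+ w x)    ≡⟨ ∑-+ Ω u w ⟩
      ∑ Ω u ℚ.+ ∑ Ω w            ≡⟨ cong₂ ℚ._+_ (∑-V₀ u∈ y₁∈) ∑w ⟩
      ι (ℤ.+ cardΩ) ℚ.* c ℚ.+ 0ℚ ≡⟨ ℚₚ.+-identityʳ _ ⟩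
      ι (ℤ.+ cardΩ) ℚ.* c        ∎)
    where
    open ≡-Reasoning
    y₁∈ : InΩ y₁
    y₁∈ = inΩ-sound y₁ y₁∈′
    y₀∈ : InΩ y₀
    y₀∈ = inΩ-sound y₀ y₀∈′
    c = u y₁

    A₄χ : ∀ {y} → InΩ y → A 4F (χ θ) y ≡ c ℚ.+ c ℚ.- χ θ y
    A₄χ {y} y∈ = begin
      A 4F (χ θ) y                         ≡⟨ A-cong 4F χ≡ y ⟩
      A 4F (λ x → u x ℚ.+ w x) y           ≡⟨ A-+ 4F u w y ⟩
      A 4F u y ℚ.+ A 4F w y                ≡⟨ cong₂ ℚ._+_ (trans (A-eigen 0F u∈ 4F y∈) (ℚₚ.*-identityˡ (u y))) (A₄w y∈) ⟩
      u y ℚ.- w y                          ≡⟨ Id.u-w≡2u-[u+w] (u y) (w y) ⟩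
      u y ℚ.+ u y ℚ.- (u y ℚ.+ w y)        ≡⟨ cong₂ (λ x z → x ℚ.+ x ℚ.- z) (V₀-constant u∈ y∈ y₁∈) (sym (χ≡ y∈)) ⟩
      c ℚ.+ c ℚ.- χ θ y                    ∎

    1≤2c : 1ℚ ℚ.≤ c ℚ.+ c
    1≤2c = 0≤x-y⇒y≤x (c ℚ.+ c) 1ℚ (subst (0ℚ ℚ.≤_) (trans (A₄χ y₁∈) (cong (λ t → c ℚ.+ c ℚ.- 𝟙 t) θy₁))
      (∑-nonNeg Ω (λ x → 0≤x⇒0≤y⇒0≤x*y (0≤𝟙 (rel 4F x y₁)) (0≤𝟙 (θ x)))))

    -- The lower bound comes first because it makes c nonzero, as `valency` requires for the upper
    -- bound.
    c≢0 : c ≢ 0ℚ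
    c≢0 c≡0 = 1≰0 (subst (1ℚ ℚ.≤_) (trans (cong₂ ℚ._+_ c≡0 c≡0) (ℚₚ.+-identityˡ 0ℚ)) 1≤2c)

    valency₄ : A 4F (λ _ → 1ℚ) y₀ ≡ 1ℚ
    valency₄ = valency u∈ y₀∈ (λ e → c≢0 (trans (V₀-constant u∈ y₁∈ y₀∈) e)) 4F

    A₄χy₀ : A 4F (χ θ) y₀ ≡ c ℚ.+ c
    A₄χy₀ = trans (A₄χ y₀∈) (trans (cong (λ t → c ℚ.+ c ℚ.- 𝟙 t) θy₀) (ℚₚ.+-identityʳ (c ℚ.+ c)))

    2c≤1 : c ℚ.+ c ℚ.≤ 1ℚ
    2c≤1 = 0≤x-y⇒y≤x 1ℚ (c ℚ.+ c) (subst (0ℚ ℚ.≤_)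
      (trans (∑-minus Ω _ _) (cong₂ ℚ._-_ valency₄ A₄χy₀))
      (∑-nonNeg Ω (λ x → subst (0ℚ ℚ.≤_) (Id.*-distribˡ-∸ (𝟙 (rel 4F x y₀)) 1ℚ (𝟙 (θ x)))
        (0≤x⇒0≤y⇒0≤x*y (0≤𝟙 (rel 4F x y₀)) (0≤1-𝟙 (θ x))))))

  A₄-antisymmetric : ∀ i → Pmat i 4F ≡ ℚ.- 1ℚ → ∀ {v} → InV i v → ∀ {y} → InΩ y → A 4F v y ≡ ℚ.- v y
  A₄-antisymmetric i P≡-1 {v} v∈ {y} y∈ = trans (A-eigen i v∈ 4F y∈) (trans (cong (ℚ._* v y) P≡-1) (Id.-1*x≡-x (v y)))

  half₂ : ∀ i → rowSum i ≡ ℤ.0ℤ → Pmat i 4F ≡ ℚ.- 1ℚ → ∀ θ → Nontrivial θ → InV2 0F i (χ θ) → 2 ℕ.* card θ ≡ cardΩ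
  half₂ i sum≡0 P≡-1 θ nt@((y , y∈ , _) , _) (u , v , u∈ , v∈ , χ≡) = half θ nt u v u∈ (A₄-antisymmetric i P≡-1 v∈)
    (∑-eigen-zero i sum≡0 v∈ (inΩ-sound y y∈)) (λ {x} x∈ → χ≡ x (inΩ-complete x∈))

  half₃ : ∀ θ → Nontrivial θ → InV3 0F 1F 3F (χ θ) → 2 ℕ.* card θ ≡ cardΩ
  half₃ θ nt@((y , y∈′ , _) , _) (u , v , t , u∈ , v∈ , t∈ , χ≡) = half θ nt u (λ x → v x ℚ.+ t x) u∈
    (λ {z} z∈ → trans (A-+ 4F v t z) (trans (cong₂ ℚ._+_ (A₄-antisymmetric 1F refl v∈ z∈) (A₄-antisymmetric 3F refl t∈ z∈))
      (sym (ℚₚ.neg-distrib-+ (v z) (t z)))))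
    (trans (∑-+ Ω v t) (cong₂ ℚ._+_ (∑-eigen-zero 1F rowSum₁≡0 v∈ y∈) (∑-eigen-zero 3F rowSum₃≡0 t∈ y∈)))
    (λ {x} x∈ → trans (χ≡ x (inΩ-complete x∈)) (ℚₚ.+-assoc (u x) (v x) (t x)))
    where
    y∈ : InΩ y
    y∈ = inΩ-sound y y∈′

-- Points and lines for n = 3

concatMap-map : ∀ {A B C : Set} (g : A → B → C) L M → concatMap (λ x → map (g x) M) L ≡ cartesianProductWith g L M
concatMap-map g []      M = refl
concatMap-map g (x ∷ L) M = cong (map (g x) M Data.List.++_) (concatMap-map g L M)

∈-concatMap-map : ∀ {A B C : Set} (g : A → B → C) {L M x y} → x ∈ L → y ∈ M → g x y ∈ concatMap (λ x → map (g x) M) L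
∈-concatMap-map g {L} {M} x∈ y∈ = subst (_ ∈_) (sym (concatMap-map g L M)) (∈-cartesianProductWith⁺ g x∈ y∈)

unique-concatMap-map : ∀ {A B C : Set} (g : A → B → C) → (∀ {w x y z} → g w y ≡ g x z → w ≡ x × y ≡ z) →
  ∀ {L M} → Unique L → Unique M → Unique (concatMap (λ x → map (g x) M) L)
unique-concatMap-map g inj {L} {M} uL uM = subst Unique (sym (concatMap-map g L M)) (cartesianProductWith⁺ g inj uL uM)

module Lines (K : FiniteField) (a b : FiniteField.F K) (aniso : Anisotropic K a b) (p : Pt K 3)
  (Qp≢0 : Scheme.Q K 3 a b p p ≢ FiniteField.0# K) where
  open FiniteField K
  open IntegerSolver isCommutativeRing
  open FieldProperties K
  open Geometry K 3 a b p Qp≢0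

  -- The auxiliary enumerations behind allPts are private; for n = 3 they unfold to these.
  private
    pairs : List (F × F)
    pairs = concatMap (λ x → map (λ y → Data.Product._,_ x y) elems) elems

    vecs₁ : List (Vec (F × F) 1)
    vecs₁ = concatMap (λ c → map (c ∷_) ([] ∷ [])) pairs

    vecs₂ : List (Vec (F × F) 2)
    vecs₂ = concatMap (λ c → map (c ∷_) vecs₁) pairs

    ∈-pairs : ∀ c → c ∈ pairs
    ∈-pairs (x , y) = ∈-concatMap-map Data.Product._,_ (elems-complete x) (elems-complete y)

    unique-pairs : Unique pairs
    unique-pairs = unique-concatMap-map Data.Product._,_ (λ { refl → refl , refl }) elems-unique elems-unique

    ∷-inj : ∀ {A : Set} {k} {w x : A} {y z : Vec A k} → w ∷ y ≡ x ∷ z → w ≡ x × y ≡ z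
    ∷-inj refl = refl , refl

    unique-vecs₂ : Unique vecs₂
    unique-vecs₂ = unique-concatMap-map _∷_ ∷-inj {pairs} {vecs₁} unique-pairs
      (unique-concatMap-map _∷_ ∷-inj {pairs} {[] ∷ []} unique-pairs ([] ∷ []))

  ∈-allPts : ∀ x → x ∈ allPts K 3
  ∈-allPts (c ∷ d ∷ [] , e) = ∈-concatMap-map Data.Product._,_ {vecs₂} {pairs}
    (∈-concatMap-map _∷_ {pairs} {vecs₁} (∈-pairs c) (∈-concatMap-map _∷_ {pairs} {[] ∷ []} (∈-pairs d) (here refl))) (∈-pairs e)

  unique-allPts : Unique (allPts K 3)
  unique-allPts = unique-concatMap-map Data.Product._,_ (λ { refl → refl , refl }) {vecs₂} {pairs} unique-vecs₂ unique-pairs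

  unique-Ω : Unique Ω
  unique-Ω = filter⁺ _ unique-allPts

  InΩ⇒∈Ω : ∀ {x} → InΩ x → x ∈ Ω
  InΩ⇒∈Ω {x} x∈ = ∈-filter⁺ _ (∈-allPts x) (inΩ-complete x∈)

  -- Coefficients with sum 1 preserve B(·,p) = 1. For distinct perpendicular y and z in Ω this lists
  -- the q points of their line outside Π; the remaining point is spanned by z - y and lies in Π.
  line : Pt K 3 → Pt K 3 → F → Pt K 3
  line y z s = (1# + - s) · y ⊕ s · z

  coord-line : ∀ i y z s → coord i (line y z s) ≡ (1# + - s) * coord i y + s * coord i z
  coord-line i y z s = coord-lc i (1# + - s) y s z

  line-self : ∀ y s → line y y s ≡ y
  line-self y s = coord-ext λ i → trans (coord-line i y y s)
    (solve 2 (λ s y → (con ℤ.1ℤ :- s) :* y :+ s :* y := y) refl s (coord i y))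

  line-0 : ∀ y z → line y z 0# ≡ y
  line-0 y z = coord-ext λ i → trans (coord-line i y z 0#)
    (solve 2 (λ y z → (con ℤ.1ℤ :- con ℤ.0ℤ) :* y :+ con ℤ.0ℤ :* z := y) refl (coord i y) (coord i z))

  line-line : ∀ y z s t → s * t ≡ 1# → line y (line y z s) t ≡ z
  line-line y z s t st≡1 = coord-ext λ i → begin
    coord i (line y (line y z s) t)
      ≡⟨ coord-line i y (line y z s) t ⟩
    (1# + - t) * coord i y + t * coord i (line y z s)
      ≡⟨ cong (λ w → (1# + - t) * coord i y + t * w) (coord-line i y z s) ⟩
    (1# + - t) * coord i y + t * ((1# + - s) * coord i y + s * coord i z)
      ≡⟨ solve 4 (λ s t y z → (con ℤ.1ℤ :- t) :* y :+ t :* ((con ℤ.1ℤ :- s) :* y :+ s :* z) := (con ℤ.1ℤ :- s :* t) :* y :+ s :* t :* z) refl s t (coord i y) (coord i z) ⟩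
    (1# + - (s * t)) * coord i y + s * t * coord i z
      ≡⟨ cong (λ w → (1# + - w) * coord i y + w * coord i z) st≡1 ⟩
    (1# + - 1#) * coord i y + 1# * coord i z
      ≡⟨ solve 2 (λ y z → (con ℤ.1ℤ :- con ℤ.1ℤ) :* y :+ con ℤ.1ℤ :* z := z) refl (coord i y) (coord i z) ⟩
    coord i z ∎
    where open ≡-Reasoning

  B-line : ∀ x y z s → B x (line y z s) ≡ (1# + - s) * B x y + s * B x z
  B-line x y z s = trans (B-comm x (line y z s)) (trans (B-lc (1# + - s) y s z x)
    (cong₂ (λ r t → (1# + - s) * r + s * t) (B-comm y x) (B-comm z x)))

  line-InΩ : ∀ {y z} → InΩ y → InΩ z → B y z ≡ 0# → ∀ s → InΩ (line y z s)
  line-InΩ {y} {z} (Qy , Byp) (Qz , Bzp) Byz s =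
    trans (Q-lc (1# + - s) y s z) (trans
      (cong₂ _+_ (cong₂ (λ r t → (1# + - s) * (1# + - s) * r + s * s * t) Qy Qz) (cong ((1# + - s) * s *_) Byz))
      (solve 1 (λ s → let r = con ℤ.1ℤ :- s; o = con ℤ.0ℤ in r :* r :* o :+ s :* s :* o :+ r :* s :* o := o) refl s)) ,
    trans (B-lc (1# + - s) y s z p) (trans (cong₂ (λ r t → (1# + - s) * r + s * t) Byp Bzp)
      (solve 1 (λ s → (con ℤ.1ℤ :- s) :* con ℤ.1ℤ :+ s :* con ℤ.1ℤ := con ℤ.1ℤ) refl s))

  -- The factor 1# makes this an iterated r · x ⊕ s · y.
  combination : F → Pt K 3 → F → Pt K 3 → F → Pt K 3 → Pt K 3
  combination c₀ x c₁ y c₂ z = 1# · (c₀ · x ⊕ c₁ · y) ⊕ c₂ · z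

  private
    functional : F → F → F → Functional 3
    functional x y z = record
      { app    = λ { (c₀ ∷ c₁ ∷ c₂ ∷ []) → 1# * (c₀ * x + c₁ * y) + c₂ * z }
      ; linear = λ { s (c₀ ∷ c₁ ∷ c₂ ∷ []) (d₀ ∷ d₁ ∷ d₂ ∷ []) →
          solve 10 (λ s x y z c₀ c₁ c₂ d₀ d₁ d₂ → con ℤ.1ℤ :* ((s :* c₀ :+ d₀) :* x :+ (s :* c₁ :+ d₁) :* y) :+ (s :* c₂ :+ d₂) :* z
            := s :* (con ℤ.1ℤ :* (c₀ :* x :+ c₁ :* y) :+ c₂ :* z) :+ (con ℤ.1ℤ :* (d₀ :* x :+ d₁ :* y) :+ d₂ :* z))
          refl s x y z c₀ c₁ c₂ d₀ d₁ d₂ }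
      }

  -- The form has Witt index 2: the six coordinates of the combination, as functionals of (c₀, c₁,
  -- c₂), form two hyperbolic pairs and one anisotropic pair on a space of dimension 3.
  dependent : ∀ x y z → (∀ c₀ c₁ c₂ → Q (combination c₀ x c₁ y c₂ z) ≡ 0#) →
    ∃[ c₀ ] ∃[ c₁ ] ∃[ c₂ ] ((c₀ ≡ 0# → c₁ ≡ 0# → c₂ ≡ 0# → ⊥) ×
      (∀ i → 1# * (c₀ * coord i x + c₁ * coord i y) + c₂ * coord i z ≡ 0#))
  dependent ((x₁ , x₂) ∷ (x₃ , x₄) ∷ [] , (x₅ , x₆)) ((y₁ , y₂) ∷ (y₃ , y₄) ∷ [] , (y₅ , y₆)) ((z₁ , z₂) ∷ (z₃ , z₄) ∷ [] , (z₅ , z₆)) sing =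
    -- The pulled-back form unfolds to `Q` of the combination, so `sing` fits as it stands.
    coefficients (totally-singular⇒dependent a b aniso L f₅ f₆ (λ { (c₀ ∷ c₁ ∷ c₂ ∷ []) → sing c₀ c₁ c₂ }))
    where
    f₅ f₆ : Functional 3
    f₅ = functional x₅ y₅ z₅
    f₆ = functional x₆ y₆ z₆
    L : Vec (Functional 3 × Functional 3) 2
    L = (functional x₁ y₁ z₁ , functional x₂ y₂ z₂) ∷ (functional x₃ y₃ z₃ , functional x₄ y₄ z₄) ∷ []
    coefficients : ∃[ c ] (c ≢ 𝟎 × Vanish L c × Functional.app f₅ c ≡ 0# × Functional.app f₆ c ≡ 0#) → _
    coefficients ((c₀ ∷ c₁ ∷ c₂ ∷ []) , c≢0 , (e₁ , e₂ , e₃ , e₄ , _) , e₅ , e₆) =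
      c₀ , c₁ , c₂ , (λ { refl refl refl → c≢0 refl }) , λ where
        (inj₁ (0F , false)) → e₁
        (inj₁ (0F , true))  → e₂
        (inj₁ (1F , false)) → e₃
        (inj₁ (1F , true))  → e₄
        (inj₂ false)        → e₅
        (inj₂ true)         → e₆

  line-injective : ∀ {y z} → y ≢ z → ∀ {s t} → line y z s ≡ line y z t → s ≡ t
  line-injective {y} {z} y≢z {s} {t} e with s ≟ t
  ... | yes s≡t = s≡t
  ... | no  s≢t = ⊥-elim (y≢z (coord-ext λ i → sym (x-y≡0⇒x≡y (x*y≡0⇒y≡0 (λ d → s≢t (x-y≡0⇒x≡y d)) (begin
    (s + - t) * (coord i z + - coord i y)
      ≡⟨ solve 4 (λ s t y z → (s :- t) :* (z :- y) := (con ℤ.1ℤ :- s) :* y :+ s :* z :- ((con ℤ.1ℤ :- t) :* y :+ t :* z)) refl s t (coord i y) (coord i z) ⟩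
    (1# + - s) * coord i y + s * coord i z + - ((1# + - t) * coord i y + t * coord i z)
      ≡⟨ cong₂ (λ u w → u + - w) (sym (coord-line i y z s)) (sym (coord-line i y z t)) ⟩
    coord i (line y z s) + - coord i (line y z t)
      ≡⟨ x≡y⇒x-y≡0 (cong (coord i) e) ⟩
    0# ∎)))))
    where open ≡-Reasoning

  -- Three pairwise perpendicular singular vectors span a totally singular subspace and are
  -- therefore dependent. Geometrically, the generalized quadrangle has no triangles.
  on-line : ∀ {x y z} → InΩ x → InΩ y → InΩ z → y ≢ z → B y z ≡ 0# → B x y ≡ 0# → B x z ≡ 0# → ∃[ s ] line y z s ≡ x
  on-line {x} {y} {z} (Qx , Bxp) (Qy , Byp) (Qz , Bzp) y≢z Byz Bxy Bxz = solution (dependent x y z singular)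
    where
    open ≡-Reasoning
    singular : ∀ c₀ c₁ c₂ → Q (combination c₀ x c₁ y c₂ z) ≡ 0#
    singular c₀ c₁ c₂ = trans (Q-lc 1# (c₀ · x ⊕ c₁ · y) c₂ z) (trans
      (cong₂ _+_ (cong₂ (λ r t → 1# * 1# * r + c₂ * c₂ * t) (Q-lc c₀ x c₁ y) Qz) (cong (1# * c₂ *_) (B-lc c₀ x c₁ y z)))
      (trans (cong₂ (λ r t → 1# * 1# * r + c₂ * c₂ * 0# + 1# * c₂ * t)
        (cong₂ _+_ (cong₂ (λ r t → c₀ * c₀ * r + c₁ * c₁ * t) Qx Qy) (cong (c₀ * c₁ *_) Bxy))
        (cong₂ (λ r t → c₀ * r + c₁ * t) Bxz Byz))
      (solve 3 (λ c₀ c₁ c₂ → let o = con ℤ.0ℤ; i = con ℤ.1ℤ in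
        i :* i :* (c₀ :* c₀ :* o :+ c₁ :* c₁ :* o :+ c₀ :* c₁ :* o) :+ c₂ :* c₂ :* o :+ i :* c₂ :* (c₀ :* o :+ c₁ :* o) := o) refl c₀ c₁ c₂)))

    solution : ∃[ c₀ ] ∃[ c₁ ] ∃[ c₂ ] ((c₀ ≡ 0# → c₁ ≡ 0# → c₂ ≡ 0# → ⊥) ×
      (∀ i → 1# * (c₀ * coord i x + c₁ * coord i y) + c₂ * coord i z ≡ 0#)) → ∃[ s ] line y z s ≡ x
    solution (c₀ , c₁ , c₂ , nontrivial , vanish) = s , coord-ext line≡
      where
      -- Apply B(·,p) to the dependency: all three points have value 1.
      sum≡0 : c₀ + c₁ + c₂ ≡ 0#
      sum≡0 = begin
        c₀ + c₁ + c₂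
          ≡⟨ solve 3 (λ c₀ c₁ c₂ → let i = con ℤ.1ℤ in c₀ :+ c₁ :+ c₂ := i :* (c₀ :* i :+ c₁ :* i) :+ c₂ :* i) refl c₀ c₁ c₂ ⟩
        1# * (c₀ * 1# + c₁ * 1#) + c₂ * 1#
          ≡⟨ cong₂ (λ r t → 1# * r + c₂ * t) (trans (cong₂ (λ r t → c₀ * r + c₁ * t) (sym Bxp) (sym Byp)) (sym (B-lc c₀ x c₁ y p))) (sym Bzp) ⟩
        1# * B (c₀ · x ⊕ c₁ · y) p + c₂ * B z p
          ≡⟨ sym (B-lc 1# (c₀ · x ⊕ c₁ · y) c₂ z p) ⟩
        B (combination c₀ x c₁ y c₂ z) p
          ≡⟨ cong (λ w → B w p) (coord-ext {combination c₀ x c₁ y c₂ z} {0# · p ⊕ 0# · p} λ i → begin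
               coord i (combination c₀ x c₁ y c₂ z)
                 ≡⟨ trans (coord-lc i 1# (c₀ · x ⊕ c₁ · y) c₂ z) (cong (λ r → 1# * r + c₂ * coord i z) (coord-lc i c₀ x c₁ y)) ⟩
               1# * (c₀ * coord i x + c₁ * coord i y) + c₂ * coord i z
                 ≡⟨ vanish i ⟩
               0#
                 ≡⟨ solve 1 (λ x → con ℤ.0ℤ := con ℤ.0ℤ :* x :+ con ℤ.0ℤ :* x) refl (coord i p) ⟩
               0# * coord i p + 0# * coord i p
                 ≡⟨ sym (coord-lc i 0# p 0# p) ⟩
               coord i (0# · p ⊕ 0# · p) ∎) ⟩
        B (0# · p ⊕ 0# · p) p
          ≡⟨ B-lc 0# p 0# p p ⟩
        0# * B p p + 0# * B p p
          ≡⟨ solve 1 (λ x → con ℤ.0ℤ :* x :+ con ℤ.0ℤ :* x := con ℤ.0ℤ) refl (B p p) ⟩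
        0# ∎

      -- If c₀ = 0 then c₂ = -c₁, and the dependency becomes c₁(y - z) = 0 with c₁ ≠ 0.
      c₀≢0 : c₀ ≢ 0#
      c₀≢0 c₀≡0 = y≢z (coord-ext λ i → x-y≡0⇒x≡y (x*y≡0⇒y≡0 c₁≢0 (begin
        c₁ * (coord i y + - coord i z)
          ≡⟨ solve 6 (λ c₀ c₁ c₂ x y z → c₁ :* (y :- z) := con ℤ.1ℤ :* (c₀ :* x :+ c₁ :* y) :+ c₂ :* z :- (c₀ :+ c₁ :+ c₂) :* z :+ c₀ :* (z :- x))
               refl c₀ c₁ c₂ (coord i x) (coord i y) (coord i z) ⟩
        1# * (c₀ * coord i x + c₁ * coord i y) + c₂ * coord i z + - ((c₀ + c₁ + c₂) * coord i z) + c₀ * (coord i z + - coord i x)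
          ≡⟨ cong₂ _+_ (cong₂ (λ r t → r + - (t * coord i z)) (vanish i) sum≡0) (cong (_* (coord i z + - coord i x)) c₀≡0) ⟩
        0# + - (0# * coord i z) + 0# * (coord i z + - coord i x)
          ≡⟨ solve 2 (λ x z → con ℤ.0ℤ :- con ℤ.0ℤ :* z :+ con ℤ.0ℤ :* (z :- x) := con ℤ.0ℤ) refl (coord i x) (coord i z) ⟩
        0# ∎)))
        where
        c₁≢0 : c₁ ≢ 0#
        c₁≢0 c₁≡0 = nontrivial c₀≡0 c₁≡0 (begin
          c₂                             ≡⟨ solve 3 (λ c₀ c₁ c₂ → c₂ := c₀ :+ c₁ :+ c₂ :- c₀ :- c₁) refl c₀ c₁ c₂ ⟩
          c₀ + c₁ + c₂ + - c₀ + - c₁     ≡⟨ cong₂ (λ r t → r + - t) (cong₂ (λ r t → r + - t) sum≡0 c₀≡0) c₁≡0 ⟩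
          0# + - 0# + - 0#               ≡⟨ solve 0 (con ℤ.0ℤ :- con ℤ.0ℤ :- con ℤ.0ℤ := con ℤ.0ℤ) refl ⟩
          0#                             ∎)

      -- From c₀x = -c₁y - c₂z; the coefficient of y is 1 - s because -c₁ = c₀ + c₂.
      s : F
      s = - c₂ * c₀ ⁻¹

      line≡ : ∀ i → coord i (line y z s) ≡ coord i x
      line≡ i = trans (coord-line i y z s) (x-y≡0⇒x≡y (x*y≡0⇒y≡0 c₀≢0 (begin
        c₀ * ((1# + - s) * Y + s * Z + - X)
          ≡⟨ solve 6 (λ c₀ k c₂ X Y Z → let s = (:- c₂) :* k in
               c₀ :* ((con ℤ.1ℤ :- s) :* Y :+ s :* Z :- X) := c₀ :* Y :+ (c₀ :* k) :* (c₂ :* (Y :- Z)) :- c₀ :* X)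
               refl c₀ (c₀ ⁻¹) c₂ X Y Z ⟩
        c₀ * Y + c₀ * c₀ ⁻¹ * (c₂ * (Y + - Z)) + - (c₀ * X)
          ≡⟨ cong (λ r → c₀ * Y + r * (c₂ * (Y + - Z)) + - (c₀ * X)) (⁻¹-inverse c₀ c₀≢0) ⟩
        c₀ * Y + 1# * (c₂ * (Y + - Z)) + - (c₀ * X)
          ≡⟨ solve 6 (λ c₀ c₁ c₂ X Y Z → c₀ :* Y :+ con ℤ.1ℤ :* (c₂ :* (Y :- Z)) :- c₀ :* X
               := (c₀ :+ c₁ :+ c₂) :* Y :- (con ℤ.1ℤ :* (c₀ :* X :+ c₁ :* Y) :+ c₂ :* Z)) refl c₀ c₁ c₂ X Y Z ⟩
        (c₀ + c₁ + c₂) * Y + - (1# * (c₀ * X + c₁ * Y) + c₂ * Z)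
          ≡⟨ cong₂ (λ r t → r * Y + - t) sum≡0 (vanish i) ⟩
        0# * Y + - 0#
          ≡⟨ solve 1 (λ Y → con ℤ.0ℤ :* Y :- con ℤ.0ℤ := con ℤ.0ℤ) refl Y ⟩
        0# ∎)))
        where
        X = coord i x
        Y = coord i y
        Z = coord i z

-- The matrix M on the generalized quadrangle

𝟙-square : ∀ k {e s c d} → AtMostOne e s c d →
  let x = k ℚ.* 𝟙 e ℚ.- 𝟙 (c ∧ not d) ℚ.- (k ℚ.* 𝟙 s ℚ.- 𝟙 (not c ∧ d)) in
  x ℚ.* x ≡ k ℚ.* k ℚ.* (𝟙 e ℚ.+ 𝟙 s) ℚ.+ (𝟙 (c ∧ not d) ℚ.+ 𝟙 (not c ∧ d))
𝟙-square k first  = Id.square-first k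
𝟙-square k second = Id.square-second k
𝟙-square k third  = Id.square-third k
𝟙-square k fourth = Id.square-fourth k
𝟙-square k none   = Id.square-none k

-- Perpendicularity splits into equality and collinearity; the clause `not d` in R₃ removes nothing,
-- since the two collinearities exclude each other.
𝟙-col : ∀ e e′ b d → (e ≡ true → b ≡ true) → e′ ≡ e → (not e′ ∧ b ≡ true → d ≡ true → ⊥) →
  𝟙 b ≡ 𝟙 e ℚ.+ 𝟙 ((not e′ ∧ b) ∧ not d)
𝟙-col true  .true  b     d     e⇒b refl cd rewrite e⇒b refl = refl
𝟙-col false .false true  true  e⇒b refl cd = ⊥-elim (cd refl refl)
𝟙-col false .false true  false e⇒b refl cd = refl
𝟙-col false .false false d     e⇒b refl cd = refl

𝟙-colσ : ∀ e b c d → (e ≡ true → b ≡ true) → d ≡ not e ∧ b → (c ≡ true → d ≡ true → ⊥) →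
  𝟙 b ≡ 𝟙 e ℚ.+ 𝟙 (not c ∧ d)
𝟙-colσ true  b     true  .false e⇒b refl cd rewrite e⇒b refl = refl
𝟙-colσ true  b     false .false e⇒b refl cd rewrite e⇒b refl = refl
𝟙-colσ false true  true  .true  e⇒b refl cd = ⊥-elim (cd refl refl)
𝟙-colσ false true  false .true  e⇒b refl cd = refl
𝟙-colσ false false true  .false e⇒b refl cd = refl
𝟙-colσ false false false .false e⇒b refl cd = refl

bool-ext : ∀ {b c} → (b ≡ true → c ≡ true) → (c ≡ true → b ≡ true) → b ≡ c
bool-ext {true}  {c}     f g = sym (f refl)
bool-ext {false} {true}  f g = g refl
bool-ext {false} {false} f g = refl

module GQ (K : FiniteField) (2<q : 2 ℕ.< FiniteField.order K) (a b : FiniteField.F K) (aniso : Anisotropic K a b) (p : Pt K 3)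
  (Qp≢0 : Scheme.Q K 3 a b p p ≢ FiniteField.0# K) where
  open FiniteField K
  open IntegerSolver isCommutativeRing
  open FieldProperties K
  open Geometry K 3 a b p Qp≢0
  open Eigen K 2<q 3 a b p Qp≢0
  open Lines K a b aniso p Qp≢0

  q̂ : ℚ
  q̂ = ι (ℤ.+ order)

  -- An entry of G = qI - N, where N is perpendicularity on Ω with each point counted as
  -- perpendicular to itself. Its sums along lines are easier to find than those of M.
  g : Pt K 3 → Pt K 3 → ℚ
  g x w = q̂ ℚ.* 𝟙 (does (w ≟P x)) ℚ.- 𝟙 (does (B x w ≟ 0#))

  -- The matrix M, written as a difference of rows of G so that it is odd under σ; `m-rel` recovers
  -- its expression in the adjacency matrices.
  m : Pt K 3 → Pt K 3 → ℚ
  m x w = g x w ℚ.- g (σ x) w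

  g-cong : ∀ {x w x′ w′} → does (w ≟P x) ≡ does (w′ ≟P x′) → does (B x w ≟ 0#) ≡ does (B x′ w′ ≟ 0#) → g x w ≡ g x′ w′
  g-cong e₁ e₂ = cong₂ (λ b c → q̂ ℚ.* 𝟙 b ℚ.- 𝟙 c) e₁ e₂

  g-comm : ∀ x w → g x w ≡ g w x
  g-comm x w = g-cong {x} {w} {w} {x} (does-⇔ (w ≟P x) (x ≟P w) sym sym) (cong (λ z → does (z ≟ 0#)) (B-comm x w))

  B-σ-comm : ∀ {x w} → InΩ x → InΩ w → B (σ x) w ≡ B (σ w) x
  B-σ-comm {x} {w} x∈ w∈ = trans (B-σ x w∈) (trans (cong (λ z → κ + - z) (B-comm x w)) (sym (B-σ w x∈)))

  g-σ-comm : ∀ {x w} → InΩ x → InΩ w → g (σ x) w ≡ g (σ w) x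
  g-σ-comm {x} {w} x∈ w∈ = g-cong {σ x} {w} {σ w} {x}
    (does-⇔ (w ≟P σ x) (x ≟P σ w)
      (λ e → trans (sym (σ-involutive x)) (cong σ (sym e))) (λ e → trans (sym (σ-involutive w)) (cong σ (sym e))))
    (cong (λ z → does (z ≟ 0#)) (B-σ-comm x∈ w∈))

  m-comm : ∀ {x w} → InΩ x → InΩ w → m x w ≡ m w x
  m-comm {x} {w} x∈ w∈ = cong₂ ℚ._-_ (g-comm x w) (g-σ-comm x∈ w∈)

  m-σ : ∀ {x w} → InΩ x → InΩ w → m x (σ w) ≡ ℚ.- m x w
  m-σ {x} {w} x∈ w∈ = begin
    g x (σ w) ℚ.- g (σ x) (σ w)    ≡⟨ cong₂ ℚ._-_ (trans (g-comm x (σ w)) (g-σ-comm w∈ x∈))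
                                        (trans (g-comm (σ x) (σ w)) (trans (g-σ-comm w∈ (σ-InΩ x∈)) (cong (λ z → g z w) (σ-involutive x)))) ⟩
    g (σ x) w ℚ.- g x w            ≡⟨ Id.swap-minus (g (σ x) w) (g x w) ⟩
    ℚ.- (g x w ℚ.- g (σ x) w)      ∎
    where open ≡-Reasoning

  module _ {x y z : Pt K 3} (x∈ : InΩ x) (y∈ : InΩ y) (z∈ : InΩ z) (y≢z : y ≢ z) (Byz≡0 : B y z ≡ 0#) where

    private
      Bzy≡0 : B z y ≡ 0#
      Bzy≡0 = trans (B-comm z y) Byz≡0

      through⇒perp : ∀ {s} → line y z s ≡ x → B x y ≡ 0# × B x z ≡ 0#
      through⇒perp {s} e =
        trans (cong (λ w → B w y) (sym e)) (trans (B-lc (1# + - s) y s z y)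
          (trans (cong₂ (λ r t → (1# + - s) * r + s * t) (B-self≡0 y∈) Bzy≡0) zero-lc)) ,
        trans (cong (λ w → B w z) (sym e)) (trans (B-lc (1# + - s) y s z z)
          (trans (cong₂ (λ r t → (1# + - s) * r + s * t) Byz≡0 (B-self≡0 z∈)) zero-lc))
        where
        zero-lc : (1# + - s) * 0# + s * 0# ≡ 0#
        zero-lc = solve 1 (λ s → (con ℤ.1ℤ :- s) :* con ℤ.0ℤ :+ s :* con ℤ.0ℤ := con ℤ.0ℤ) refl s

      through? : ∀ s → Dec (line y z s ≡ x)
      through? s = line y z s ≟P x

      perp? : ∀ s → Dec (B x (line y z s) ≡ 0#)
      perp? s = B x (line y z s) ≟ 0#

      ∑g : ∀ {d o} → ∑ elems (λ s → 𝟙 (does (through? s))) ≡ d → ∑ elems (λ s → 𝟙 (does (perp? s))) ≡ o →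
        ∑ elems (λ s → g x (line y z s)) ≡ q̂ ℚ.* d ℚ.- o
      ∑g ed eo = trans (∑-minus elems _ _) (cong₂ ℚ._-_ (trans (∑-*ˡ elems q̂ _) (cong (q̂ ℚ.*_) ed)) eo)

      B-line-const : B x y ≡ B x z → ∀ s → B x (line y z s) ≡ B x y
      B-line-const e s = trans (B-line x y z s) (trans (cong (λ t → (1# + - s) * B x y + s * t) (sym e))
        (solve 2 (λ s t → (con ℤ.1ℤ :- s) :* t :+ s :* t := t) refl s (B x y)))

      one-perp : B x y ≢ B x z → ∑ elems (λ s → 𝟙 (does (perp? s))) ≡ 1ℚ
      one-perp β≢γ = ∑-one perp? _≟_ elems-unique (elems-complete s₀) root unique-root
        where
        open ≡-Reasoning
        β = B x y
        γ = B x z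
        δ = β + - γ
        δ≢0 : δ ≢ 0#
        δ≢0 e = β≢γ (x-y≡0⇒x≡y e)
        -- The zero of the nonconstant affine function s ↦ (1 - s)β + sγ.
        s₀ = β * δ ⁻¹
        root : B x (line y z s₀) ≡ 0#
        root = begin
          B x (line y z s₀)             ≡⟨ B-line x y z s₀ ⟩
          (1# + - s₀) * β + s₀ * γ      ≡⟨ solve 3 (λ β γ k → let s = β :* k in (con ℤ.1ℤ :- s) :* β :+ s :* γ := β :- β :* ((β :- γ) :* k)) refl β γ (δ ⁻¹) ⟩
          β + - (β * (δ * δ ⁻¹))        ≡⟨ cong (λ r → β + - (β * r)) (⁻¹-inverse δ δ≢0) ⟩
          β + - (β * 1#)                ≡⟨ solve 1 (λ β → β :- β :* con ℤ.1ℤ := con ℤ.0ℤ) refl β ⟩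
          0#                            ∎
        unique-root : ∀ {s} → B x (line y z s) ≡ 0# → s ≡ s₀
        unique-root {s} e = begin
          s                                               ≡⟨ solve 1 (λ s → s := s :* con ℤ.1ℤ) refl s ⟩
          s * 1#                                          ≡⟨ cong (s *_) (sym (⁻¹-inverse δ δ≢0)) ⟩
          s * (δ * δ ⁻¹)                                  ≡⟨ solve 4 (λ s β γ k → s :* ((β :- γ) :* k) := β :* k :- ((con ℤ.1ℤ :- s) :* β :+ s :* γ) :* k) refl s β γ (δ ⁻¹) ⟩
          s₀ + - (((1# + - s) * β + s * γ) * δ ⁻¹)        ≡⟨ cong (λ r → s₀ + - (r * δ ⁻¹)) (trans (sym (B-line x y z s)) e) ⟩
          s₀ + - (0# * δ ⁻¹)                              ≡⟨ solve 2 (λ s k → s :- con ℤ.0ℤ :* k := s) refl s₀ (δ ⁻¹) ⟩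
          s₀                                              ∎

      cases : (β≟γ : Dec (B x y ≡ B x z)) → Dec (B x y ≡ 0#) →
        ∑ elems (λ s → g x (line y z s)) ≡ ℚ.- 𝟙 (not (does β≟γ))
      cases (no β≢γ) _ = trans
        (∑g (∑-none through? elems (λ _ e → β≢γ (trans (proj₁ (through⇒perp e)) (sym (proj₂ (through⇒perp e)))))) (one-perp β≢γ))
        (Id.q*0-x≡-x q̂ 1ℚ)
      cases (yes β≡γ) (no β≢0) = trans
        (∑g (∑-none through? elems (λ _ e → β≢0 (proj₁ (through⇒perp e))))
            (∑-none perp? elems (λ {s} _ e → β≢0 (trans (sym (B-line-const β≡γ s)) e))))
        (Id.q*0-x≡-x q̂ 0ℚ)
      -- All q listed points are perpendicular to x and exactly one of them is x, so the sum is q ·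
      -- 1 - q.
      cases (yes β≡γ) (yes β≡0) = trans
        (∑g (∑-one through? _≟_ elems-unique (elems-complete (proj₁ s₀)) (proj₂ s₀)
              (λ e → line-injective y≢z (trans e (sym (proj₂ s₀)))))
            (∑-all perp? elems (λ {s} _ → trans (B-line-const β≡γ s) β≡0)))
        (Id.q*1-q≡0 q̂)
        where
        s₀ : ∃[ s ] line y z s ≡ x
        s₀ = on-line x∈ y∈ z∈ y≢z Byz≡0 β≡0 (trans (sym β≡γ) β≡0)

    -- The line meets x^⊥ in one point, or misses x^⊥, or lies in x^⊥ and then
    -- passes through x, as there are no totally singular planes.
    ∑g-line : ∑ elems (λ s → g x (line y z s)) ≡ ℚ.- 𝟙 (not (does (B x y ≟ B x z)))
    ∑g-line = cases (B x y ≟ B x z) (B x y ≟ 0#)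

  -- Since B(σ(x),·) = κ - B(x,·) on Ω, the form B(x,·) agrees at y and z exactly when B(σ(x),·)
  -- does. The rows `g x` and `g (σ x)` thus have the same sum on the line, and it cancels in `m`.
  ∑m-line : ∀ {x y z} → InΩ x → InΩ y → InΩ z → y ≢ z → B y z ≡ 0# → ∑ elems (λ s → m x (line y z s)) ≡ 0ℚ
  ∑m-line {x} {y} {z} x∈ y∈ z∈ y≢z Byz≡0 = begin
    ∑ elems (λ s → m x (line y z s))
      ≡⟨ ∑-minus elems _ _ ⟩
    ∑ elems (λ s → g x (line y z s)) ℚ.- ∑ elems (λ s → g (σ x) (line y z s))
      ≡⟨ cong₂ ℚ._-_ (∑g-line x∈ y∈ z∈ y≢z Byz≡0) (∑g-line (σ-InΩ x∈) y∈ z∈ y≢z Byz≡0) ⟩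
    ℚ.- 𝟙 (not (does (B x y ≟ B x z))) ℚ.- (ℚ.- 𝟙 (not (does (B (σ x) y ≟ B (σ x) z))))
      ≡⟨ cong (λ b → ℚ.- 𝟙 (not (does (B x y ≟ B x z))) ℚ.- (ℚ.- 𝟙 (not b))) (does-⇔ (B (σ x) y ≟ B (σ x) z) (B x y ≟ B x z)
           (λ e → trans (back y) (trans (cong (λ t → κ + - t) (trans (sym (B-σ x y∈)) (trans e (B-σ x z∈)))) (sym (back z))))
           (λ e → trans (B-σ x y∈) (trans (cong (λ t → κ + - t) e) (sym (B-σ x z∈))))) ⟩
    ℚ.- 𝟙 (not (does (B x y ≟ B x z))) ℚ.- (ℚ.- 𝟙 (not (does (B x y ≟ B x z))))
      ≡⟨ ℚₚ.+-inverseʳ (ℚ.- 𝟙 (not (does (B x y ≟ B x z)))) ⟩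
    0ℚ ∎
    where
    open ≡-Reasoning
    back : ∀ w → B x w ≡ κ + - (κ + - B x w)
    back w = solve 2 (λ k t → t := k :- (k :- t)) refl κ (B x w)

  perp : Pt K 3 → List (Pt K 3)
  perp y = filter (λ z → B y z ≟ 0#) Ω

  -- Sum f (line y z s) over all s and all z ∈ y^⊥: for s ≢ 0# the homothety
  -- z ↦ line y z s permutes y^⊥.
  module _ {y : Pt K 3} (y∈ : InΩ y) (f : Pt K 3 → ℚ)
    (line-zero : ∀ {z} → InΩ z → y ≢ z → B y z ≡ 0# → ∑ elems (λ s → f (line y z s)) ≡ 0ℚ) where

    private
      L = perp y
      X = ι (ℤ.+ length L) ℚ.* f y
      Y = ∑ L f

      ∈L⁻ : ∀ {z} → z ∈ L → InΩ z × B y z ≡ 0#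
      ∈L⁻ {z} z∈L with ∈-filter⁻ (λ z → B y z ≟ 0#) {v = z} {xs = Ω} z∈L
      ... | z∈Ω , Byz = ∈Ω⇒InΩ z∈Ω , Byz

      ∈L⁺ : ∀ {z} → InΩ z → B y z ≡ 0# → z ∈ L
      ∈L⁺ z∈ Byz = ∈-filter⁺ (λ z → B y z ≟ 0#) (InΩ⇒∈Ω z∈) Byz

      unique-L : Unique L
      unique-L = filter⁺ (λ z → B y z ≟ 0#) unique-Ω

      line∈L : ∀ s {z} → z ∈ L → line y z s ∈ L
      line∈L s {z} z∈L = ∈L⁺ (line-InΩ y∈ (proj₁ (∈L⁻ z∈L)) (proj₂ (∈L⁻ z∈L)) s)
        (trans (B-line y y z s) (trans (cong₂ (λ r t → (1# + - s) * r + s * t) (B-self≡0 y∈) (proj₂ (∈L⁻ z∈L)))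
          (solve 1 (λ s → (con ℤ.1ℤ :- s) :* con ℤ.0ℤ :+ s :* con ℤ.0ℤ := con ℤ.0ℤ) refl s)))

      by-points : ∀ {z} → z ∈ L → Dec (z ≡ y) → ∑ elems (λ s → f (line y z s)) ≡ 𝟙 (does (z ≟P y)) ℚ.* (q̂ ℚ.* f y)
      by-points z∈L (yes refl) = trans (∑-cong elems (λ {s} _ → cong f (line-self y s)))
        (trans (∑-const elems (f y)) (sym (trans (cong (λ b → 𝟙 b ℚ.* (q̂ ℚ.* f y)) (dec-true (y ≟P y) refl)) (ℚₚ.*-identityˡ (q̂ ℚ.* f y)))))
      by-points {z} z∈L (no z≢y) = trans (line-zero (proj₁ (∈L⁻ z∈L)) (λ e → z≢y (sym e)) (proj₂ (∈L⁻ z∈L)))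
        (sym (trans (cong (λ b → 𝟙 b ℚ.* (q̂ ℚ.* f y)) (dec-false (z ≟P y) z≢y)) (ℚₚ.*-zeroˡ (q̂ ℚ.* f y))))

      by-scalars : ∀ s → Dec (s ≡ 0#) → ∑ L (λ z → f (line y z s)) ≡ 𝟙 (does (s ≟ 0#)) ℚ.* (X ℚ.- Y) ℚ.+ Y
      by-scalars s (yes refl) = trans (∑-cong L (λ {z} _ → cong f (line-0 y z))) (trans (∑-const L (f y))
        (sym (trans (cong (λ b → 𝟙 b ℚ.* (X ℚ.- Y) ℚ.+ Y) (dec-true (0# ≟ 0#) refl)) (Id.1*[x-y]+y≡x X Y))))
      by-scalars s (no s≢0) = trans
        (∑-reindex _≟P_ unique-L (λ z → line y z s) (λ z → line y z (s ⁻¹)) (line∈L s) (line∈L (s ⁻¹))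
          (λ {z} _ → line-line y z s (s ⁻¹) (⁻¹-inverse s s≢0))
          (λ {z} _ → line-line y z (s ⁻¹) s (trans (solve 2 (λ x y → x :* y := y :* x) refl (s ⁻¹) s) (⁻¹-inverse s s≢0))) f)
        (sym (trans (cong (λ b → 𝟙 b ℚ.* (X ℚ.- Y) ℚ.+ Y) (dec-false (s ≟ 0#) s≢0)) (Id.0*x+y≡y (X ℚ.- Y) Y)))

    -- Grouped by scalars, s = 0 contributes X and each of the other q - 1 scalars contributes Y;
    -- grouped by points, only z = y contributes. Double counting spares a choice of representatives
    -- for the lines through y.
    ∑-perp : X ℚ.- Y ℚ.+ q̂ ℚ.* Y ≡ q̂ ℚ.* f y
    ∑-perp = begin
      X ℚ.- Y ℚ.+ q̂ ℚ.* Y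
        ≡⟨ cong₂ ℚ._+_ (sym (∑-δ _≟_ elems-unique (elems-complete 0#) (λ _ → X ℚ.- Y))) (sym (∑-const elems Y)) ⟩
      ∑ elems (λ s → 𝟙 (does (s ≟ 0#)) ℚ.* (X ℚ.- Y)) ℚ.+ ∑ elems (λ _ → Y)
        ≡⟨ sym (∑-+ elems _ _) ⟩
      ∑ elems (λ s → 𝟙 (does (s ≟ 0#)) ℚ.* (X ℚ.- Y) ℚ.+ Y)
        ≡⟨ ∑-cong elems (λ {s} _ → sym (by-scalars s (s ≟ 0#))) ⟩
      ∑ elems (λ s → ∑ L (λ z → f (line y z s)))
        ≡⟨ ∑-swap elems L _ ⟩
      ∑ L (λ z → ∑ elems (λ s → f (line y z s)))
        ≡⟨ ∑-cong L (λ {z} z∈L → by-points z∈L (z ≟P y)) ⟩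
      ∑ L (λ z → 𝟙 (does (z ≟P y)) ℚ.* (q̂ ℚ.* f y))
        ≡⟨ ∑-δ _≟P_ unique-L (∈L⁺ y∈ (B-self≡0 y∈)) (λ _ → q̂ ℚ.* f y) ⟩
      q̂ ℚ.* f y ∎
      where open ≡-Reasoning

  𝟙-perp : ∀ {x y} → InΩ x → InΩ y → 𝟙 (does (B y x ≟ 0#)) ≡ 𝟙 (does (x ≟P y)) ℚ.+ 𝟙 (rel 3F x y)
  𝟙-perp {x} {y} x∈ y∈ = 𝟙-col (does (x ≟P y)) (does (y ≟P x)) (does (B y x ≟ 0#)) (colσ x y)
    (λ e → dec-true (B y x ≟ 0#) (subst (λ w → B y w ≡ 0#) (sym (does-sound (x ≟P y) e)) (B-self≡0 y∈)))
    (does-⇔ (y ≟P x) (x ≟P y) sym sym)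
    (col-colσ-disjoint x∈ y∈)

  colσ≡ : ∀ {x y} → InΩ y → colσ x y ≡ col x (σ y)
  colσ≡ {x} {y} y∈ = bool-ext (colσ-sound x y∈) (λ e → any-complete _ (∈-allPts (σ y)) (cong₂ _∧_ (sig-complete y∈) e))

  𝟙-perpσ : ∀ {x y} → InΩ x → InΩ y → 𝟙 (does (B (σ y) x ≟ 0#)) ≡ 𝟙 (does (x ≟P σ y)) ℚ.+ 𝟙 (rel 1F x y)
  𝟙-perpσ {x} {y} x∈ y∈ = 𝟙-colσ (does (x ≟P σ y)) (does (B (σ y) x ≟ 0#)) (col y x) (colσ x y)
    (λ e → dec-true (B (σ y) x ≟ 0#) (subst (λ w → B (σ y) w ≡ 0#) (sym (does-sound (x ≟P σ y) e)) (B-self≡0 (σ-InΩ y∈))))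
    (trans (colσ≡ {x} y∈) (cong (λ z → not (does (x ≟P σ y)) ∧ does (z ≟ 0#)) (B-comm x (σ y))))
    (col-colσ-disjoint x∈ y∈)

  -- The diagonal of N lowers the coefficient q of the identity to q - 1, and likewise that of σ.
  m-rel : ∀ {x y} → InΩ x → InΩ y → m y x ≡ (q̂ ℚ.- 1ℚ) ℚ.* 𝟙 (rel 0F x y) ℚ.- 𝟙 (rel 3F x y)
    ℚ.- ((q̂ ℚ.- 1ℚ) ℚ.* 𝟙 (rel 4F x y) ℚ.- 𝟙 (rel 1F x y))
  m-rel {x} {y} x∈ y∈ = begin
    m y x
      ≡⟨ cong₂ (λ r t → q̂ ℚ.* 𝟙 (does (x ≟P y)) ℚ.- r ℚ.- (q̂ ℚ.* 𝟙 (does (x ≟P σ y)) ℚ.- t)) (𝟙-perp x∈ y∈) (𝟙-perpσ x∈ y∈) ⟩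
    q̂ ℚ.* E ℚ.- (E ℚ.+ R₃) ℚ.- (q̂ ℚ.* S ℚ.- (S ℚ.+ R₁))
      ≡⟨ Id.m-relations q̂ E S R₃ R₁ ⟩
    (q̂ ℚ.- 1ℚ) ℚ.* E ℚ.- R₃ ℚ.- ((q̂ ℚ.- 1ℚ) ℚ.* S ℚ.- R₁)
      ≡⟨ cong (λ b → (q̂ ℚ.- 1ℚ) ℚ.* E ℚ.- R₃ ℚ.- ((q̂ ℚ.- 1ℚ) ℚ.* 𝟙 b ℚ.- R₁)) (sym (sig≡ x y∈)) ⟩
    (q̂ ℚ.- 1ℚ) ℚ.* E ℚ.- R₃ ℚ.- ((q̂ ℚ.- 1ℚ) ℚ.* 𝟙 (rel 4F x y) ℚ.- R₁) ∎
    where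
    open ≡-Reasoning
    E = 𝟙 (does (x ≟P y))
    S = 𝟙 (does (x ≟P σ y))
    R₃ = 𝟙 (rel 3F x y)
    R₁ = 𝟙 (rel 1F x y)

  ι-qn2 : ι qn2 ≡ q̂
  ι-qn2 = cong (λ k → ι (ℤ.+ k)) (ℕₚ.*-identityʳ order)

  ι-qn1 : ι qn1 ≡ q̂ ℚ.* q̂
  ι-qn1 = trans (cong (λ k → ι (ℤ.+ (order ℕ.* k))) (ℕₚ.*-identityʳ order))
    (trans (cong ι (ℤₚ.pos-* order order)) (ι-* (ℤ.+ order) (ℤ.+ order)))

  ι-qm2 : ι qm2 ≡ q̂ ℚ.- (1ℚ ℚ.+ 1ℚ)
  ι-qm2 = ι-+ (ℤ.+ order) (ℤ.- ℤ.+ 2)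

  r : ℚ
  r = q̂ ℚ.* q̂ ℚ.+ 1ℚ

  ι-qn1+1 : ι (qn1 ℤ.+ ℤ.1ℤ) ≡ r
  ι-qn1+1 = trans (ι-+ qn1 ℤ.1ℤ) (cong (ℚ._+ 1ℚ) ι-qn1)

  P₀₃ : Pmat 0F 3F ≡ (q̂ ℚ.- 1ℚ) ℚ.* r
  P₀₃ = trans (ι-* (qn2 ℤ.- ℤ.1ℤ) (qn1 ℤ.+ ℤ.1ℤ))
    (cong₂ ℚ._*_ (trans (ι-+ qn2 (ℤ.- ℤ.1ℤ)) (cong (ℚ._- 1ℚ) ι-qn2)) ι-qn1+1)

  P₁₃ : Pmat 1F 3F ≡ ℚ.- r
  P₁₃ = trans (ι-neg (qn1 ℤ.+ ℤ.1ℤ)) (cong ℚ.-_ ι-qn1+1)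

  P₄₁ : Pmat 4F 1F ≡ ℚ.- (q̂ ℚ.* (q̂ ℚ.- (1ℚ ℚ.+ 1ℚ))) ℚ.- 1ℚ
  P₄₁ = trans (ι-+ (ℤ.- (qn2 ℤ.* qm2)) (ℤ.- ℤ.1ℤ)) (cong (ℚ._- 1ℚ)
    (trans (ι-neg (qn2 ℤ.* qm2)) (cong ℚ.-_ (trans (ι-* qn2 qm2) (cong₂ ℚ._*_ ι-qn2 ι-qm2)))))

  q̂-1≢0 : q̂ ℚ.- 1ℚ ≢ 0ℚ
  q̂-1≢0 e = ℕₚ.<-irrefl (sym (ℤₚ.+-injective (ι-injective {ℤ.+ order} {ℤ.+ 1} (Id.x-y≡0⇒x≡y e)))) (ℕₚ.<-trans (ℕ.s≤s (ℕ.s≤s ℕ.z≤n)) 2<q)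

  β α : ℚ
  β = q̂ ℚ.+ q̂ ℚ.* q̂
  α = β ℚ.+ β

  α≢0 : α ≢ 0ℚ
  α≢0 e = [ (λ ()) , (λ q+q²≡0 → [ (λ q≡0 → q≢0 (ι-injective {ℤ.+ order} {ℤ.+ 0} q≡0)) , q+1≢0 ]′
      (x*y≡0⇒x≡0∨y≡0 q̂ (1ℚ ℚ.+ q̂) (trans (Id.q*[1+q] q̂) q+q²≡0))) ]′
    (x*y≡0⇒x≡0∨y≡0 (1ℚ ℚ.+ 1ℚ) β (trans (Id.2*x β) e))
    where
    q≢0 : ℤ.+ order ≢ ℤ.+ 0
    q≢0 e = ℕₚ.<-irrefl (sym (ℤₚ.+-injective e)) (ℕₚ.<-trans (ℕ.s≤s ℕ.z≤n) 2<q)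
    q+1≢0 : 1ℚ ℚ.+ q̂ ≢ 0ℚ
    q+1≢0 e with ℤₚ.+-injective (ι-injective {ℤ.+ suc order} {ℤ.+ 0} (trans (ι-+ (ℤ.+ 1) (ℤ.+ order)) e))
    ... | ()

  -- The valency of R₃ is a hypothesis here; `valency` supplies it once the constant part of χ is
  -- known to be nonzero.
  module _ (val₃ : ∀ {y} → InΩ y → A 3F (λ _ → 1ℚ) y ≡ Pmat 0F 3F) where

    -- The number stands for y itself and q - 1 further points of Ω on each of the q² + 1 lines
    -- through y.
    length-perp : ∀ {y} → InΩ y → ι (ℤ.+ length (perp y)) ≡ 1ℚ ℚ.+ (q̂ ℚ.- 1ℚ) ℚ.* r
    length-perp {y} y∈ = begin
      ι (ℤ.+ length (perp y))
        ≡⟨ sym (ℚₚ.*-identityʳ (ι (ℤ.+ length (perp y)))) ⟩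
      ι (ℤ.+ length (perp y)) ℚ.* 1ℚ
        ≡⟨ sym (∑-const (perp y) 1ℚ) ⟩
      ∑ (perp y) (λ _ → 1ℚ)
        ≡⟨ ∑-filter (λ z → B y z ≟ 0#) Ω (λ _ → 1ℚ) ⟩
      ∑ Ω (λ x → 𝟙 (does (B y x ≟ 0#)) ℚ.* 1ℚ)
        ≡⟨ ∑-cong Ω (λ {x} x∈ → trans (cong (ℚ._* 1ℚ) (𝟙-perp (∈Ω⇒InΩ x∈) y∈)) (ℚₚ.*-distribʳ-+ 1ℚ (𝟙 (does (x ≟P y))) (𝟙 (rel 3F x y)))) ⟩
      ∑ Ω (λ x → 𝟙 (does (x ≟P y)) ℚ.* 1ℚ ℚ.+ 𝟙 (rel 3F x y) ℚ.* 1ℚ)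
        ≡⟨ ∑-+ Ω _ _ ⟩
      ∑ Ω (λ x → 𝟙 (does (x ≟P y)) ℚ.* 1ℚ) ℚ.+ A 3F (λ _ → 1ℚ) y
        ≡⟨ cong₂ ℚ._+_ (∑-δ _≟P_ unique-Ω (InΩ⇒∈Ω y∈) (λ _ → 1ℚ)) (trans (val₃ y∈) P₀₃) ⟩
      1ℚ ℚ.+ (q̂ ℚ.- 1ℚ) ℚ.* r ∎
      where open ≡-Reasoning

    module _ {x : Pt K 3} (x∈ : InΩ x) where

      -- Each of the q² + 1 lines through y has sum 0, so its points other than y contribute
      -- -m(x,y), and 1 - (q² + 1) = -q². Formally, `∑-perp` is solved for the sum and q - 1 is
      -- cancelled.
      ∑m-perp : ∀ {y} → InΩ y → ∑ (perp y) (m x) ≡ ℚ.- (q̂ ℚ.* q̂ ℚ.* m x y)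
      ∑m-perp {y} y∈ = *-cancelˡ Y (ℚ.- (q̂ ℚ.* q̂ ℚ.* m x y)) q̂-1≢0 (begin
        (q̂ ℚ.- 1ℚ) ℚ.* Y
          ≡⟨ Id.perp-solve q̂ X Y ⟩
        X ℚ.- Y ℚ.+ q̂ ℚ.* Y ℚ.- X
          ≡⟨ cong₂ ℚ._-_ (∑-perp y∈ (m x) (∑m-line x∈ y∈)) (cong (ℚ._* m x y) (length-perp y∈)) ⟩
        q̂ ℚ.* m x y ℚ.- (1ℚ ℚ.+ (q̂ ℚ.- 1ℚ) ℚ.* r) ℚ.* m x y
          ≡⟨ Id.perp-value q̂ (m x y) ⟩
        (q̂ ℚ.- 1ℚ) ℚ.* (ℚ.- (q̂ ℚ.* q̂ ℚ.* m x y)) ∎)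
        where
        open ≡-Reasoning
        X = ι (ℤ.+ length (perp y)) ℚ.* m x y
        Y = ∑ (perp y) (m x)

      -- In G = qI - N the matrix N multiplies the row `m x` by -q², by `∑m-perp`; hence the factor
      -- q + q².
      ∑g*m : ∀ {y} → InΩ y → ∑ Ω (λ a → g y a ℚ.* m x a) ≡ β ℚ.* m x y
      ∑g*m {y} y∈ = begin
        ∑ Ω (λ a → g y a ℚ.* m x a)
          ≡⟨ ∑-cong Ω (λ {a} _ → Id.g-expand q̂ (𝟙 (does (a ≟P y))) (𝟙 (does (B y a ≟ 0#))) (m x a)) ⟩
        ∑ Ω (λ a → q̂ ℚ.* (𝟙 (does (a ≟P y)) ℚ.* m x a) ℚ.- 𝟙 (does (B y a ≟ 0#)) ℚ.* m x a)
          ≡⟨ ∑-minus Ω _ _ ⟩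
        ∑ Ω (λ a → q̂ ℚ.* (𝟙 (does (a ≟P y)) ℚ.* m x a)) ℚ.- ∑ Ω (λ a → 𝟙 (does (B y a ≟ 0#)) ℚ.* m x a)
          ≡⟨ cong₂ ℚ._-_ (trans (∑-*ˡ Ω q̂ _) (cong (q̂ ℚ.*_) (∑-δ _≟P_ unique-Ω (InΩ⇒∈Ω y∈) (m x))))
               (trans (sym (∑-filter (λ z → B y z ≟ 0#) Ω (m x))) (∑m-perp y∈)) ⟩
        q̂ ℚ.* m x y ℚ.- (ℚ.- (q̂ ℚ.* q̂ ℚ.* m x y))
          ≡⟨ Id.g-value q̂ (m x y) ⟩
        β ℚ.* m x y ∎
        where open ≡-Reasoning

    -- Row y of M is row y of G minus row σ(y). As `m x` is odd under σ, the two contributions are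
    -- equal and double the factor β.
    M² : ∀ {x y} → InΩ x → InΩ y → ∑ Ω (λ a → m x a ℚ.* m y a) ≡ α ℚ.* m x y
    M² {x} {y} x∈ y∈ = begin
      ∑ Ω (λ a → m x a ℚ.* m y a)
        ≡⟨ ∑-cong Ω (λ {a} _ → Id.m-expand (g y a) (g (σ y) a) (m x a)) ⟩
      ∑ Ω (λ a → g y a ℚ.* m x a ℚ.- g (σ y) a ℚ.* m x a)
        ≡⟨ ∑-minus Ω _ _ ⟩
      ∑ Ω (λ a → g y a ℚ.* m x a) ℚ.- ∑ Ω (λ a → g (σ y) a ℚ.* m x a)
        ≡⟨ cong₂ ℚ._-_ (∑g*m x∈ y∈) (trans (∑g*m x∈ (σ-InΩ y∈)) (cong (β ℚ.*_) (m-σ x∈ y∈))) ⟩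
      β ℚ.* m x y ℚ.- β ℚ.* (ℚ.- m x y)
        ≡⟨ Id.m-value β (m x y) ⟩
      α ℚ.* m x y ∎
      where open ≡-Reasoning

  M-V₁ : ∀ {v} → InV 1F v → ∀ {y} → InΩ y → ∑ Ω (λ x → m y x ℚ.* v x) ≡ α ℚ.* v y
  M-V₁ {v} v∈ {y} y∈ = begin
    ∑ Ω (λ x → m y x ℚ.* v x)
      ≡⟨ ∑-cong Ω (λ {x} x∈ → trans (cong (ℚ._* v x) (m-rel (∈Ω⇒InΩ x∈) y∈))
           (Id.combine₄ k (𝟙 (rel 0F x y)) (𝟙 (rel 4F x y)) (𝟙 (rel 3F x y)) (𝟙 (rel 1F x y)) (v x))) ⟩
    ∑ Ω (λ x → k ℚ.* h 0F x ℚ.- h 3F x ℚ.- (k ℚ.* h 4F x ℚ.- h 1F x))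
      ≡⟨ trans (∑-minus Ω _ _) (cong₂ ℚ._-_ (∑-minus Ω _ _) (∑-minus Ω _ _)) ⟩
    ∑ Ω (λ x → k ℚ.* h 0F x) ℚ.- A 3F v y ℚ.- (∑ Ω (λ x → k ℚ.* h 4F x) ℚ.- A 1F v y)
      ≡⟨ cong₂ ℚ._-_
           (cong₂ ℚ._-_ (trans (∑-*ˡ Ω k (h 0F)) (cong (k ℚ.*_) (A-eigen 1F v∈ 0F y∈)))
             (trans (A-eigen 1F v∈ 3F y∈) (cong (ℚ._* v y) P₁₃)))
           (cong₂ ℚ._-_ (trans (∑-*ˡ Ω k (h 4F)) (cong (k ℚ.*_) (A-eigen 1F v∈ 4F y∈)))
             (trans (A-eigen 1F v∈ 1F y∈) (cong (ℚ._* v y) ι-qn1+1))) ⟩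
    k ℚ.* (1ℚ ℚ.* v y) ℚ.- (ℚ.- r) ℚ.* v y ℚ.- (k ℚ.* ((ℚ.- 1ℚ) ℚ.* v y) ℚ.- r ℚ.* v y)
      ≡⟨ Id.V₁-value q̂ (v y) ⟩
    α ℚ.* v y ∎
    where
    open ≡-Reasoning
    k = q̂ ℚ.- 1ℚ
    h : Fin 5 → Pt K 3 → ℚ
    h ℓ x = 𝟙 (rel ℓ x y) ℚ.* v x

  M∘M-V₄ : ∀ {t} → InV 4F t → ∀ {y} → InΩ y → ∑ Ω (λ x → m x y ℚ.* m x y ℚ.* t x) ≡ 0ℚ
  M∘M-V₄ {t} t∈ {y} y∈ = begin
    ∑ Ω (λ x → m x y ℚ.* m x y ℚ.* t x)
      ≡⟨ ∑-cong Ω (λ {x} x∈ → let x∈ = ∈Ω⇒InΩ x∈ in trans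
           (cong (ℚ._* t x) (trans (cong (λ z → z ℚ.* z) (trans (m-comm x∈ y∈) (m-rel x∈ y∈))) (𝟙-square k (relations-exclusive x∈ y∈))))
           (Id.square-combine (k ℚ.* k) (𝟙 (rel 0F x y)) (𝟙 (rel 4F x y)) (𝟙 (rel 3F x y)) (𝟙 (rel 1F x y)) (t x))) ⟩
    ∑ Ω (λ x → k ℚ.* k ℚ.* (h 0F x ℚ.+ h 4F x) ℚ.+ (h 3F x ℚ.+ h 1F x))
      ≡⟨ trans (∑-+ Ω _ _) (cong₂ ℚ._+_ (trans (∑-*ˡ Ω (k ℚ.* k) _) (cong (k ℚ.* k ℚ.*_) (∑-+ Ω (h 0F) (h 4F)))) (∑-+ Ω (h 3F) (h 1F))) ⟩
    k ℚ.* k ℚ.* (A 0F t y ℚ.+ A 4F t y) ℚ.+ (A 3F t y ℚ.+ A 1F t y)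
      ≡⟨ cong₂ ℚ._+_ (cong (k ℚ.* k ℚ.*_) (cong₂ ℚ._+_ (A-eigen 4F t∈ 0F y∈) (A-eigen 4F t∈ 4F y∈)))
           (cong₂ ℚ._+_ (trans (A-eigen 4F t∈ 3F y∈) (cong (ℚ._* t y) P₄₁)) (trans (A-eigen 4F t∈ 1F y∈) (cong (ℚ._* t y) P₄₁))) ⟩
    _
      ≡⟨ Id.V₄-value q̂ (t y) ⟩
    0ℚ ∎
    where
    open ≡-Reasoning
    k = q̂ ℚ.- 1ℚ
    h : Fin 5 → Pt K 3 → ℚ
    h ℓ x = 𝟙 (rel ℓ x y) ℚ.* t x

  -- Designs in V₀ + V₁ + V₄ for n = 3

  -- Evaluating A₄ at a point relies on Ω listing σ(y) exactly once, which `Lines` establishes for n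
  -- = 3; `half` treats general n with inequalities instead.
  A₄≡σ : ∀ f {y} → InΩ y → A 4F f y ≡ f (σ y)
  A₄≡σ f {y} y∈ = trans (∑-cong Ω (λ {x} _ → cong (λ b → 𝟙 b ℚ.* f x) (sig≡ x y∈))) (∑-δ _≟P_ unique-Ω (InΩ⇒∈Ω (σ-InΩ y∈)) f)

  -- χ² = χ at y and at σ(y), where v changes sign and t does not, gives
  -- v (2c + 2t − 1) = 0.
  ⟨2,3⟩-design : ∀ θ → Nontrivial θ → InV3 0F 1F 4F (χ θ) → InV2 0F 4F (χ θ) ⊎ 2 ℕ.* card θ ≡ cardΩ
  ⟨2,3⟩-design θ ((y₁ , y₁∈′ , θy₁) , _) (u , v , t , u∈ , v∈ , t∈ , χ≡′) =
    [ (λ ∑v²≡0 → inj₁ (u , t , u∈ , t∈ , λ x x∈ → trans (χ≡′ x x∈)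
        (cong (ℚ._+ t x) (trans (cong (u x ℚ.+_) (∑-square-zero Ω v ∑v²≡0 (InΩ⇒∈Ω (inΩ-sound x x∈)))) (ℚₚ.+-identityʳ (u x))))))
    , (λ 1-2c≡0 → inj₂ (mean-half θ (sym (Id.x-y≡0⇒x≡y 1-2c≡0)) ∑χ)) ]′
    (x*y≡0⇒x≡0∨y≡0 (∑ Ω (λ x → v x ℚ.* v x)) (1ℚ ℚ.- (c ℚ.+ c)) ∑v²*[1-2c]≡0)
    where
    open ≡-Reasoning
    y₁∈ : InΩ y₁
    y₁∈ = inΩ-sound y₁ y₁∈′
    c = u y₁

    χ≡ : ∀ {x} → InΩ x → χ θ x ≡ c ℚ.+ v x ℚ.+ t x
    χ≡ {x} x∈ = trans (χ≡′ x (inΩ-complete x∈)) (cong (λ z → z ℚ.+ v x ℚ.+ t x) (V₀-constant u∈ x∈ y₁∈))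

    ∑χ : ∑ Ω (χ θ) ≡ ι (ℤ.+ cardΩ) ℚ.* c
    ∑χ = begin
      ∑ Ω (χ θ)                              ≡⟨ ∑-cong Ω (λ x∈ → χ≡′ _ (∈Ω⇒inΩ x∈)) ⟩
      ∑ Ω (λ x → u x ℚ.+ v x ℚ.+ t x)        ≡⟨ trans (∑-+ Ω _ t) (cong (ℚ._+ ∑ Ω t) (∑-+ Ω u v)) ⟩
      ∑ Ω u ℚ.+ ∑ Ω v ℚ.+ ∑ Ω t              ≡⟨ cong₂ ℚ._+_ (cong₂ ℚ._+_ (∑-V₀ u∈ y₁∈) (∑-eigen-zero 1F rowSum₁≡0 v∈ y₁∈)) (∑-eigen-zero 4F rowSum₄≡0 t∈ y₁∈) ⟩
      ι (ℤ.+ cardΩ) ℚ.* c ℚ.+ 0ℚ ℚ.+ 0ℚ      ≡⟨ trans (ℚₚ.+-identityʳ _) (ℚₚ.+-identityʳ _) ⟩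
      ι (ℤ.+ cardΩ) ℚ.* c                    ∎

    -- If c were 0 then ∑ χ² = ∑ χ = c |Ω| would be 0, although χ is 1 at `y₁`.
    c≢0 : c ≢ 0ℚ
    c≢0 c≡0 = 1≢0 (trans (cong 𝟙 (sym θy₁)) (∑-square-zero Ω (χ θ)
      (trans (∑-cong Ω (λ {x} _ → 𝟙-idem (θ x))) (trans ∑χ (trans (cong (ι (ℤ.+ cardΩ) ℚ.*_) c≡0) (ℚₚ.*-zeroʳ (ι (ℤ.+ cardΩ)))))) (InΩ⇒∈Ω y₁∈)))
      where
      1≢0 : 1ℚ ≢ 0ℚ
      1≢0 ()

    val₃ : ∀ {y} → InΩ y → A 3F (λ _ → 1ℚ) y ≡ Pmat 0F 3F
    val₃ y∈ = valency u∈ y∈ (λ e → c≢0 (trans (V₀-constant u∈ y₁∈ y∈) e)) 3F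

    ∑v²t : ∑ Ω (λ x → v x ℚ.* v x ℚ.* t x) ≡ 0ℚ
    ∑v²t = ∑v²t≡0 Ω m α (λ x∈ y∈ → M² val₃ (∈Ω⇒InΩ x∈) (∈Ω⇒InΩ y∈)) t (λ y∈ → M∘M-V₄ t∈ (∈Ω⇒InΩ y∈))
      α≢0 v (λ x∈ → M-V₁ v∈ (∈Ω⇒InΩ x∈))

    v-σ : ∀ {y} → InΩ y → v (σ y) ≡ ℚ.- v y
    v-σ {y} y∈ = trans (sym (A₄≡σ v y∈)) (trans (A-eigen 1F v∈ 4F y∈) (Id.-1*x≡-x (v y)))

    t-σ : ∀ {y} → InΩ y → t (σ y) ≡ t y
    t-σ {y} y∈ = trans (sym (A₄≡σ t y∈)) (trans (A-eigen 4F t∈ 4F y∈) (ℚₚ.*-identityˡ (t y)))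

    χσ≡ : ∀ {y} → InΩ y → χ θ (σ y) ≡ c ℚ.- v y ℚ.+ t y
    χσ≡ {y} y∈ = trans (χ≡ (σ-InΩ y∈)) (cong₂ (λ r s → c ℚ.+ r ℚ.+ s) (v-σ y∈) (t-σ y∈))

    idem : ∀ x {z} → χ θ x ≡ z → z ℚ.* z ℚ.- z ≡ 0ℚ
    idem x refl = Id.x≡y⇒x-y≡0 (𝟙-idem (θ x))

    support : ∀ {y} → InΩ y → v y ℚ.* (c ℚ.+ t y ℚ.+ (c ℚ.+ t y) ℚ.- 1ℚ) ≡ 0ℚ
    support {y} y∈ = [ (λ ()) , (λ e → e) ]′ (x*y≡0⇒x≡0∨y≡0 (1ℚ ℚ.+ 1ℚ) _ (begin
      (1ℚ ℚ.+ 1ℚ) ℚ.* (v y ℚ.* w)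
        ≡⟨ Id.2*[v*w] (v y) w ⟩
      (v y ℚ.+ v y) ℚ.* w
        ≡⟨ Id.idempotent-difference c (v y) (t y) ⟩
      _
        ≡⟨ cong₂ ℚ._-_ (idem y (χ≡ y∈)) (idem (σ y) (χσ≡ y∈)) ⟩
      0ℚ ℚ.- 0ℚ
        ≡⟨ ℚₚ.+-inverseʳ 0ℚ ⟩
      0ℚ ∎))
      where w = c ℚ.+ t y ℚ.+ (c ℚ.+ t y) ℚ.- 1ℚ

    ∑v²*[1-2c]≡0 : ∑ Ω (λ x → v x ℚ.* v x) ℚ.* (1ℚ ℚ.- (c ℚ.+ c)) ≡ 0ℚ
    ∑v²*[1-2c]≡0 = begin
      ∑ Ω (λ x → v x ℚ.* v x) ℚ.* (1ℚ ℚ.- (c ℚ.+ c))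
        ≡⟨ sym (∑-*ʳ Ω (1ℚ ℚ.- (c ℚ.+ c)) _) ⟩
      ∑ Ω (λ x → v x ℚ.* v x ℚ.* (1ℚ ℚ.- (c ℚ.+ c)))
        -- Pointwise v²(1 - 2c) = 2v²t - v · v(2c + 2t - 1), and `support` kills the last product.
        ≡⟨ ∑-cong Ω (λ {x} x∈ → trans (Id.final-split c (v x) (t x))
             (trans (cong (λ z → (1ℚ ℚ.+ 1ℚ) ℚ.* (v x ℚ.* v x ℚ.* t x) ℚ.- v x ℚ.* z) (support (∈Ω⇒InΩ x∈)))
               (Id.x-y*0≡x ((1ℚ ℚ.+ 1ℚ) ℚ.* (v x ℚ.* v x ℚ.* t x)) (v x)))) ⟩
      ∑ Ω (λ x → (1ℚ ℚ.+ 1ℚ) ℚ.* (v x ℚ.* v x ℚ.* t x))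
        ≡⟨ trans (∑-*ˡ Ω (1ℚ ℚ.+ 1ℚ) _) (cong ((1ℚ ℚ.+ 1ℚ) ℚ.*_) ∑v²t) ⟩
      (1ℚ ℚ.+ 1ℚ) ℚ.* 0ℚ
        ≡⟨ ℚₚ.*-zeroʳ (1ℚ ℚ.+ 1ℚ) ⟩
      0ℚ ∎

open import Data.Nat using (_*_; _<_; _≤_)

theorem7p5 : (K : FiniteField) → 2 < FiniteField.order K →
    (n : ℕ) → 3 ≤ n →
    (a b : FiniteField.F K) → Anisotropic K a b →
    (p : Pt K n) → Scheme.Q K n a b p p ≢ FiniteField.0# K →
    (θ : Pt K n → Bool) → Scheme.Nontrivial K n a b p θ →
    ((Scheme.InV2 K n a b p zero (suc zero) (Scheme.χ K n a b p θ)
      ⊎ Scheme.InV2 K n a b p zero (suc (suc (suc zero))) (Scheme.χ K n a b p θ)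
      ⊎ Scheme.InV3 K n a b p zero (suc zero) (suc (suc (suc zero))) (Scheme.χ K n a b p θ))
      → 2 * Scheme.card K n a b p θ ≡ Scheme.cardΩ K n a b p)
    × (n ≡ 3 →
      Scheme.InV3 K n a b p zero (suc zero) (suc (suc (suc (suc zero)))) (Scheme.χ K n a b p θ) →
      Scheme.InV2 K n a b p zero (suc (suc (suc (suc zero)))) (Scheme.χ K n a b p θ)
      ⊎ 2 * Scheme.card K n a b p θ ≡ Scheme.cardΩ K n a b p)
theorem7p5 K 2<q n 3≤n a b aniso p Qp≢0 θ θ-nontrivial =
  (λ { (inj₁ design)        → half₂ 1F rowSum₁≡0 refl θ θ-nontrivial design
     ; (inj₂ (inj₁ design)) → half₂ 3F rowSum₃≡0 refl θ θ-nontrivial design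
     ; (inj₂ (inj₂ design)) → half₃ θ θ-nontrivial design }) ,
  λ { refl → GQ.⟨2,3⟩-design K 2<q a b aniso p Qp≢0 θ θ-nontrivial }
  where open Eigen K 2<q n a b p Qp≢0
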